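{- Let $\Phi=(G,\varphi)$ be a complex unit gain graph and let $C_p^{\varphi}$ be a pendant cycle of $\Phi$ of order $p$, with $v$ the unique vertex of $C_p$ of degree $3$ in $G$. Let $F^{\varphi}=(F,\varphi)=\Phi-C_p^{\varphi}$ (delete all vertices of $C_p$) and $H^{\varphi}=(H,\varphi)=F^{\varphi}+v$ (the induced subgraph on $V(F)\cup\{v\}$). If $r(\Phi)=r(G)-2\theta(G)$, then (a) $C_p^{\varphi}$ is of Type A with $p\equiv 2\pmod 4$; (b) $r(H^{\varphi})=r(H)-2\theta(H)$ and $r(F^{\varphi})=r(F)-2\theta(F)$; (c) $r(\Phi)=p-2+r(F^{\varphi})$, $r(F^{\varphi})=r(H^{\varphi})$, $r(G)=p+r(H)$ and $r(F)=r(H)$.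
   Context: A complex unit gain graph $\Phi=(G,\varphi)$ consists of a finite simple graph $G$ with vertex set $\{v_1,\dots,v_n\}$ and a gain function $\varphi$ assigning to each oriented edge $e_{ij}$ ($v_iv_j\in E(G)$) a complex number of modulus $1$ with $\varphi(e_{ji})=\overline{\varphi(e_{ij})}$. $A(\Phi)$ is the Hermitian matrix with $(i,j)$ entry $\varphi(e_{ij})$ if $v_iv_j\in E(G)$ and $0$ otherwise; $r(\Phi)$ is its rank; $r(\cdot)$ of a simple graph is the rank of its $0$-$1$ adjacency matrix. Induced subgraphs of $\Phi$ carry the gains of $\Phi$. $\theta(G)=|E(G)|-|V(G)|+\omega(G)$, $\omega(G)$ the number of components. A pendant cycle of $G$ is an induced subgraph $C_p$ that is a cycle and has a unique vertex of degree $3$ in $G$ (its other vertices having degree $2$ in $G$). For a gain cycle with vertices $v_1,\dots,v_p$ in cyclic order, $\varphi(C_p)=\varphi(e_{12})\cdots\varphi(e_{p1})$; for $p$ even it is of Type A if $\varphi(C_p)=(-1)^{p/2}$. -}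

module Defs where

open import Algebra.Bundles.Raw using (RawRing)
import Algebra.Definitions.RawSemiring as RawSemiringDefs
open import Axiom.ExcludedMiddle using (ExcludedMiddle)
open import Data.Bool.Base using (Bool; true; false; T; _∧_; if_then_else_)
open import Data.Fin.Base as Fin using (Fin; zero; suc; toℕ)
import Data.Fin.Properties as Fin
open import Data.Fin.Subset using (Subset; inside; outside) renaming (∣_∣ to card)
open import Data.Integer.Base as ℤ using (ℤ; +_)
open import Data.Nat.Base as ℕ using (ℕ; zero; suc)
open import Data.Nat.Divisibility using (_∣_)
open import Data.Nat.DivMod using (_/_; _mod_)
import Data.Nat.Properties as ℕ
open import Data.Product.Base using (∃; _×_; _,_)
open import Data.Rational.Base as ℚ using (ℚ; 0ℚ; 1ℚ; ½)
import Data.Rational.Properties as ℚ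
open import Data.Rational.Solver using (module +-*-Solver)
open import Data.Sum.Base using (_⊎_; inj₁)
open import Data.Unit.Base using (tt)
import Data.Vec.Base as Vec
open import Function.Base using (_∘_)
open import Function.Bundles using (_⇔_; module Equivalence)
open import Function.Definitions using (Injective)
open import Level using (0ℓ)
open import Relation.Binary.Construct.Closure.ReflexiveTransitive using (Star)
open import Relation.Binary.PropositionalEquality using (_≡_; _≢_; refl; sym; cong; cong₂; subst; module ≡-Reasoning)
open import Relation.Nullary.Decidable.Core using (Dec; does)
open import Relation.Nullary.Negation.Core using (¬_)

-- Real numbers are Cauchy sequences of rationals, as a setoid.

IsCauchy : (ℕ → ℚ) → Set
IsCauchy s = ∀ ε → 0ℚ ℚ.< ε → ∃ λ N → ∀ m n → N ℕ.≤ m → N ℕ.≤ n → ℚ.∣ s m ℚ.- s n ∣ ℚ.< ε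

record ℝ : Set where
  constructor mkℝ
  field
    seq    : ℕ → ℚ
    cauchy : IsCauchy seq

open ℝ public

infix 4 _≈ᵣ_

record _≈ᵣ_ (x y : ℝ) : Set where
  constructor mk≈ᵣ
  field
    close : ∀ ε → 0ℚ ℚ.< ε → ∃ λ N → ∀ n → N ℕ.≤ n → ℚ.∣ seq x n ℚ.- seq y n ∣ ℚ.< ε

module CauchyLemmas where
 abstract
  halve-pos : ∀ {ε} → 0ℚ ℚ.< ε → 0ℚ ℚ.< ½ ℚ.* ε
  halve-pos {ε} 0<ε = subst (ℚ._< ½ ℚ.* ε) (ℚ.*-zeroʳ ½) (ℚ.*-monoʳ-<-pos ½ 0<ε)

  halves : ∀ ε → ½ ℚ.* ε ℚ.+ ½ ℚ.* ε ≡ ε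
  halves ε = begin
    ½ ℚ.* ε ℚ.+ ½ ℚ.* ε ≡⟨ sym (ℚ.*-distribʳ-+ ε ½ ½) ⟩
    1ℚ ℚ.* ε            ≡⟨ ℚ.*-identityˡ ε ⟩
    ε                   ∎
    where open ≡-Reasoning

  const-cauchy : ∀ q → IsCauchy (λ _ → q)
  const-cauchy q ε 0<ε = 0 , λ _ _ _ _ → subst (λ t → ℚ.∣ t ∣ ℚ.< ε) (sym (ℚ.+-inverseʳ q)) 0<ε

  +-cauchy : ∀ {s t} → IsCauchy s → IsCauchy t → IsCauchy (λ n → s n ℚ.+ t n)
  +-cauchy {s} {t} cs ct ε 0<ε with cs (½ ℚ.* ε) (halve-pos 0<ε) | ct (½ ℚ.* ε) (halve-pos 0<ε)
  ... | M , hs | N , ht = M ℕ.⊔ N , λ m n m≥ n≥ → begin-strict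
    ℚ.∣ (s m ℚ.+ t m) ℚ.- (s n ℚ.+ t n) ∣           ≡⟨ cong ℚ.∣_∣ (rearrange (s m) (t m) (s n) (t n)) ⟩
    ℚ.∣ (s m ℚ.- s n) ℚ.+ (t m ℚ.- t n) ∣           ≤⟨ ℚ.∣p+q∣≤∣p∣+∣q∣ (s m ℚ.- s n) (t m ℚ.- t n) ⟩
    ℚ.∣ s m ℚ.- s n ∣ ℚ.+ ℚ.∣ t m ℚ.- t n ∣         <⟨ ℚ.+-mono-<
                                                         (hs m n (ℕ.m⊔n≤o⇒m≤o M N m≥) (ℕ.m⊔n≤o⇒m≤o M N n≥))
                                                         (ht m n (ℕ.m⊔n≤o⇒n≤o M N m≥) (ℕ.m⊔n≤o⇒n≤o M N n≥)) ⟩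
    ½ ℚ.* ε ℚ.+ ½ ℚ.* ε                             ≡⟨ halves ε ⟩
    ε                                               ∎
    where
    open ℚ.≤-Reasoning
    rearrange : ∀ a b c d → (a ℚ.+ b) ℚ.- (c ℚ.+ d) ≡ (a ℚ.- c) ℚ.+ (b ℚ.- d)
    rearrange = solve 4 (λ a b c d → (a :+ b) :- (c :+ d) := (a :- c) :+ (b :- d)) refl
      where open +-*-Solver

  neg-cauchy : ∀ {s} → IsCauchy s → IsCauchy (λ n → ℚ.- s n)
  neg-cauchy {s} cs ε 0<ε with cs ε 0<ε
  ... | N , h = N , λ m n m≥ n≥ → begin-strict
    ℚ.∣ ℚ.- s m ℚ.- ℚ.- s n ∣  ≡⟨ cong ℚ.∣_∣ (sym (ℚ.neg-distrib-+ (s m) (ℚ.- s n))) ⟩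
    ℚ.∣ ℚ.- (s m ℚ.- s n) ∣    ≡⟨ ℚ.∣-p∣≡∣p∣ (s m ℚ.- s n) ⟩
    ℚ.∣ s m ℚ.- s n ∣          <⟨ h m n m≥ n≥ ⟩
    ε                          ∎
    where open ℚ.≤-Reasoning

  eventually-bounded : ∀ {s} → IsCauchy s →
    ∃ λ B → 0ℚ ℚ.< B × ∃ λ N → ∀ n → N ℕ.≤ n → ℚ.∣ s n ∣ ℚ.≤ B
  eventually-bounded {s} cs with cs 1ℚ (ℚ.positive⁻¹ 1ℚ)
  ... | N , h = 1ℚ ℚ.+ ℚ.∣ s N ∣ , ℚ.+-mono-<-≤ (ℚ.positive⁻¹ 1ℚ) (ℚ.0≤∣p∣ (s N)) , N , λ n n≥ → begin
    ℚ.∣ s n ∣                          ≡⟨ cong ℚ.∣_∣ (split (s n) (s N)) ⟩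
    ℚ.∣ (s n ℚ.- s N) ℚ.+ s N ∣        ≤⟨ ℚ.∣p+q∣≤∣p∣+∣q∣ (s n ℚ.- s N) (s N) ⟩
    ℚ.∣ s n ℚ.- s N ∣ ℚ.+ ℚ.∣ s N ∣    ≤⟨ ℚ.+-monoˡ-≤ ℚ.∣ s N ∣ (ℚ.<⇒≤ (h n N n≥ ℕ.≤-refl)) ⟩
    1ℚ ℚ.+ ℚ.∣ s N ∣                   ∎
    where
    open ℚ.≤-Reasoning
    split : ∀ a b → a ≡ (a ℚ.- b) ℚ.+ b
    split = solve 2 (λ a b → a := (a :- b) :+ b) refl
      where open +-*-Solver

  *-bound : ∀ {a A d δ} → 0ℚ ℚ.< A → ℚ.∣ a ∣ ℚ.≤ A → ℚ.∣ d ∣ ℚ.< δ → ℚ.∣ a ℚ.* d ∣ ℚ.< A ℚ.* δ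
  *-bound {a} {A} {d} {δ} 0<A a≤A d<δ = begin-strict
    ℚ.∣ a ℚ.* d ∣          ≡⟨ ℚ.∣p*q∣≡∣p∣*∣q∣ a d ⟩
    ℚ.∣ a ∣ ℚ.* ℚ.∣ d ∣    ≤⟨ ℚ.*-monoʳ-≤-nonNeg ℚ.∣ d ∣ {{ℚ.nonNegative (ℚ.0≤∣p∣ d)}} a≤A ⟩
    A ℚ.* ℚ.∣ d ∣          <⟨ ℚ.*-monoʳ-<-pos A {{ℚ.positive 0<A}} d<δ ⟩
    A ℚ.* δ                ∎
    where open ℚ.≤-Reasoning

  scale : ∀ B ε → 0ℚ ℚ.< B → 0ℚ ℚ.< ε → ∃ λ δ → 0ℚ ℚ.< δ × B ℚ.* δ ≡ ε
  scale B ε 0<B 0<ε = ℚ.1/ B ℚ.* ε , 0<δ , eq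
    where
    open ≡-Reasoning
    instance
      B-pos : ℚ.Positive B
      B-pos = ℚ.positive 0<B
      B-nonZero : ℚ.NonZero B
      B-nonZero = ℚ.pos⇒nonZero B
      1/B-pos : ℚ.Positive (ℚ.1/ B)
      1/B-pos = ℚ.1/pos⇒pos B
    0<δ : 0ℚ ℚ.< ℚ.1/ B ℚ.* ε
    0<δ = subst (ℚ._< ℚ.1/ B ℚ.* ε) (ℚ.*-zeroʳ (ℚ.1/ B)) (ℚ.*-monoʳ-<-pos (ℚ.1/ B) 0<ε)
    eq : B ℚ.* (ℚ.1/ B ℚ.* ε) ≡ ε
    eq = begin
      B ℚ.* (ℚ.1/ B ℚ.* ε)  ≡⟨ sym (ℚ.*-assoc B (ℚ.1/ B) ε) ⟩
      B ℚ.* ℚ.1/ B ℚ.* ε    ≡⟨ cong (ℚ._* ε) (ℚ.*-inverseʳ B) ⟩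
      1ℚ ℚ.* ε              ≡⟨ ℚ.*-identityˡ ε ⟩
      ε                     ∎

  *-rearrange : ∀ a b c d → a ℚ.* b ℚ.- c ℚ.* d ≡ a ℚ.* (b ℚ.- d) ℚ.+ d ℚ.* (a ℚ.- c)
  *-rearrange a b c d = sym (begin
    a ℚ.* (b ℚ.- d) ℚ.+ d ℚ.* (a ℚ.- c)
      ≡⟨ cong₂ ℚ._+_ (ℚ.*-distribˡ-+ a b (ℚ.- d)) (ℚ.*-distribˡ-+ d a (ℚ.- c)) ⟩
    (a ℚ.* b ℚ.+ a ℚ.* ℚ.- d) ℚ.+ (d ℚ.* a ℚ.+ d ℚ.* ℚ.- c)
      ≡⟨ cong₂ (λ u v → (a ℚ.* b ℚ.+ u) ℚ.+ (d ℚ.* a ℚ.+ v)) (sym (ℚ.neg-distribʳ-* a d)) (sym (ℚ.neg-distribʳ-* d c)) ⟩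
    (a ℚ.* b ℚ.- a ℚ.* d) ℚ.+ (d ℚ.* a ℚ.- d ℚ.* c)
      ≡⟨ cong₂ (λ u v → (a ℚ.* b ℚ.- a ℚ.* d) ℚ.+ (u ℚ.- v)) (ℚ.*-comm d a) (ℚ.*-comm d c) ⟩
    (a ℚ.* b ℚ.- a ℚ.* d) ℚ.+ (a ℚ.* d ℚ.- c ℚ.* d)
      ≡⟨ telescope (a ℚ.* b) (a ℚ.* d) (c ℚ.* d) ⟩
    a ℚ.* b ℚ.- c ℚ.* d ∎)
    where
    open ≡-Reasoning
    telescope : ∀ x y z → (x ℚ.- y) ℚ.+ (y ℚ.- z) ≡ x ℚ.- z
    telescope = solve 3 (λ x y z → (x :- y) :+ (y :- z) := x :- z) refl
      where open +-*-Solver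

  *-close : ∀ {a b c d A B δ ε} → 0ℚ ℚ.< A → 0ℚ ℚ.< B → (A ℚ.+ B) ℚ.* δ ≡ ε →
    ℚ.∣ a ∣ ℚ.≤ A → ℚ.∣ d ∣ ℚ.≤ B → ℚ.∣ a ℚ.- c ∣ ℚ.< δ → ℚ.∣ b ℚ.- d ∣ ℚ.< δ →
    ℚ.∣ a ℚ.* b ℚ.- c ℚ.* d ∣ ℚ.< ε
  *-close {a} {b} {c} {d} {A} {B} {δ} {ε} 0<A 0<B eq a≤A d≤B a~c b~d = begin-strict
    ℚ.∣ a ℚ.* b ℚ.- c ℚ.* d ∣
      ≡⟨ cong ℚ.∣_∣ (*-rearrange a b c d) ⟩
    ℚ.∣ a ℚ.* (b ℚ.- d) ℚ.+ d ℚ.* (a ℚ.- c) ∣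
      ≤⟨ ℚ.∣p+q∣≤∣p∣+∣q∣ (a ℚ.* (b ℚ.- d)) (d ℚ.* (a ℚ.- c)) ⟩
    ℚ.∣ a ℚ.* (b ℚ.- d) ∣ ℚ.+ ℚ.∣ d ℚ.* (a ℚ.- c) ∣
      <⟨ ℚ.+-mono-< (*-bound {a} {A} {b ℚ.- d} {δ} 0<A a≤A b~d) (*-bound {d} {B} {a ℚ.- c} {δ} 0<B d≤B a~c) ⟩
    A ℚ.* δ ℚ.+ B ℚ.* δ
      ≡⟨ sym (ℚ.*-distribʳ-+ δ A B) ⟩
    (A ℚ.+ B) ℚ.* δ
      ≡⟨ eq ⟩
    ε ∎
    where open ℚ.≤-Reasoning

  *-cauchy : ∀ {s t} → IsCauchy s → IsCauchy t → IsCauchy (λ n → s n ℚ.* t n)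
  *-cauchy {s} {t} cs ct ε 0<ε =
    let A , 0<A , K , bs = eventually-bounded {s} cs
        B , 0<B , L , bt = eventually-bounded {t} ct
        δ , 0<δ , eq     = scale (A ℚ.+ B) ε (ℚ.+-mono-< 0<A 0<B) 0<ε
        M , hs           = cs δ 0<δ
        N , ht           = ct δ 0<δ
        ≥KL = λ {i} → ℕ.m⊔n≤o⇒m≤o {i} (K ℕ.⊔ L) (M ℕ.⊔ N)
        ≥MN = λ {i} → ℕ.m⊔n≤o⇒n≤o {i} (K ℕ.⊔ L) (M ℕ.⊔ N)
    in (K ℕ.⊔ L) ℕ.⊔ (M ℕ.⊔ N) , λ m n m≥ n≥ →
      *-close {s m} {t m} {s n} {t n} {A} {B} {δ} {ε} 0<A 0<B eq
        (bs m (ℕ.m⊔n≤o⇒m≤o K L (≥KL m≥)))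
        (bt n (ℕ.m⊔n≤o⇒n≤o K L (≥KL n≥)))
        (hs m n (ℕ.m⊔n≤o⇒m≤o M N (≥MN m≥)) (ℕ.m⊔n≤o⇒m≤o M N (≥MN n≥)))
        (ht m n (ℕ.m⊔n≤o⇒n≤o M N (≥MN m≥)) (ℕ.m⊔n≤o⇒n≤o M N (≥MN n≥)))

open CauchyLemmas

infixl 6 _+ᵣ_
infixl 7 _*ᵣ_
infix  8 -ᵣ_

0ᵣ 1ᵣ : ℝ
0ᵣ = mkℝ (λ _ → 0ℚ) (const-cauchy 0ℚ)
1ᵣ = mkℝ (λ _ → 1ℚ) (const-cauchy 1ℚ)

_+ᵣ_ _*ᵣ_ : ℝ → ℝ → ℝ
x +ᵣ y = mkℝ (λ n → seq x n ℚ.+ seq y n) (+-cauchy {seq x} {seq y} (cauchy x) (cauchy y))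
x *ᵣ y = mkℝ (λ n → seq x n ℚ.* seq y n) (*-cauchy {seq x} {seq y} (cauchy x) (cauchy y))

-ᵣ_ : ℝ → ℝ
-ᵣ x = mkℝ (λ n → ℚ.- seq x n) (neg-cauchy {seq x} (cauchy x))

record ℂ : Set where
  constructor _+i_
  field
    re : ℝ
    im : ℝ

open ℂ public

infix  4 _≈_
infixl 6 _+_
infixl 7 _*_
infix  8 -_

record _≈_ (z w : ℂ) : Set where
  constructor mk≈
  field
    re≈ : re z ≈ᵣ re w
    im≈ : im z ≈ᵣ im w

0ℂ 1ℂ : ℂ
0ℂ = 0ᵣ +i 0ᵣ
1ℂ = 1ᵣ +i 0ᵣ

_+_ _*_ : ℂ → ℂ → ℂ
z + w = (re z +ᵣ re w) +i (im z +ᵣ im w)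
z * w = (re z *ᵣ re w +ᵣ -ᵣ (im z *ᵣ im w)) +i (re z *ᵣ im w +ᵣ im z *ᵣ re w)

-_ conj : ℂ → ℂ
- z = (-ᵣ re z) +i (-ᵣ im z)
conj z = re z +i (-ᵣ im z)

-- |z| = 1, expressed as |z|² = 1 to avoid square roots.
Unimodular : ℂ → Set
Unimodular z = re z *ᵣ re z +ᵣ im z *ᵣ im z ≈ᵣ 1ᵣ

ℂ-rawRing : RawRing 0ℓ 0ℓ
ℂ-rawRing = record
  { Carrier = ℂ ; _≈_ = _≈_ ; _+_ = _+_ ; _*_ = _*_ ; -_ = -_ ; 0# = 0ℂ ; 1# = 1ℂ }

open RawSemiringDefs (RawRing.rawSemiring ℂ-rawRing) public using (sum; product; _^_)

Matrix : ℕ → ℕ → Set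
Matrix m n = Fin m → Fin n → ℂ

IndependentColumns : ∀ {m n k} → Matrix m n → (Fin k → Fin n) → Set
IndependentColumns {k = k} A f =
  ∀ (c : Fin k → ℂ) → (∀ i → sum (λ j → c j * A i (f j)) ≈ 0ℂ) → ∀ j → c j ≈ 0ℂ

-- The greatest k ≤ b satisfying P, or 0 if there is none.
greatest : (P : ℕ → Set) → (∀ k → Dec (P k)) → ℕ → ℕ
greatest P P? zero    = zero
greatest P P? (suc b) = if does (P? (suc b)) then suc b else greatest P P? b

record Graph (n : ℕ) : Set where
  field
    adjacent : Fin n → Fin n → Bool

  Adj : Fin n → Fin n → Set
  Adj i j = T (adjacent i j)

  field
    adj-sym    : ∀ {i j} → Adj i j → Adj j i
    adj-irrefl : ∀ {i} → ¬ Adj i i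

open Graph public

degree : ∀ {n} → Graph n → Fin n → ℕ
degree G i = card (Vec.tabulate (adjacent G i))

edgeCount : ∀ {n} → Graph n → ℕ
edgeCount G = Vec.sum (Vec.tabulate λ i → card (Vec.tabulate λ j → does (i Fin.<? j) ∧ adjacent G i j))

Connected : ∀ {n} → Graph n → Fin n → Fin n → Set
Connected G = Star (Adj G)

adjacencyMatrix : ∀ {n} → Graph n → Matrix n n
adjacencyMatrix G i j = if adjacent G i j then 1ℂ else 0ℂ

-- The increasing enumeration of a subset.
elements : ∀ {n} (S : Subset n) → Fin (card S) → Fin n
elements (inside  Vec.∷ S) zero    = zero
elements (inside  Vec.∷ S) (suc i) = suc (elements S i)
elements (outside Vec.∷ S) i       = suc (elements S i)

inducedGraph : ∀ {n} → Graph n → (S : Subset n) → Graph (card S)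
inducedGraph G S = record
  { adjacent   = λ i j → adjacent G (elements S i) (elements S j)
  ; adj-sym    = adj-sym G
  ; adj-irrefl = adj-irrefl G
  }

record GainGraph (n : ℕ) : Set where
  field
    graph      : Graph n
    gain       : ∀ {i j} → Adj graph i j → ℂ
    unimodular : ∀ {i j} (e : Adj graph i j) → Unimodular (gain e)
    gain-sym   : ∀ {i j} (e : Adj graph i j) → gain (adj-sym graph e) ≈ conj (gain e)

open GainGraph public

gainMatrix : ∀ {n} → GainGraph n → Matrix n n
gainMatrix Φ i j = entry (adjacent (graph Φ) i j) (gain Φ)
  where
  entry : (b : Bool) → (T b → ℂ) → ℂ
  entry true  g = g tt
  entry false g = 0ℂ

induced : ∀ {n} → GainGraph n → (S : Subset n) → GainGraph (card S)
induced Φ S = record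
  { graph      = inducedGraph (graph Φ) S
  ; gain       = gain Φ
  ; unimodular = unimodular Φ
  ; gain-sym   = gain-sym Φ
  }

next : ∀ {p} → Fin p → Fin p
next {suc m} i = suc (toℕ i) mod suc m

-- An induced subgraph that is a cycle, with its vertices listed in cyclic order.
record InducedCycle {n} (G : Graph n) (p : ℕ) : Set where
  field
    p≥3       : 3 ℕ.≤ p
    vertex    : Fin p → Fin n
    injective : Injective _≡_ _≡_ vertex
    adj⇔      : ∀ i j → Adj G (vertex i) (vertex j) ⇔ (j ≡ next i ⊎ i ≡ next j)

  edge : ∀ i → Adj G (vertex i) (vertex (next i))
  edge i = Equivalence.from (adj⇔ i (next i)) (inj₁ refl)

  vertices : Subset n
  vertices = Vec.tabulate λ u → does (Fin.any? λ i → vertex i Fin.≟ u)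

record PendantCycle {n} (G : Graph n) (p : ℕ) : Set where
  field
    cycle   : InducedCycle G p
    root    : Fin p

  open InducedCycle cycle public

  field
    degree-root  : degree G (vertex root) ≡ 3
    degree-other : ∀ i → i ≢ root → degree G (vertex i) ≡ 2

  attachment : Fin n
  attachment = vertex root

open PendantCycle public using (cycle; vertices; attachment)

cycleGain : ∀ {n p} (Φ : GainGraph n) → InducedCycle (graph Φ) p → ℂ
cycleGain Φ C = product λ i → gain Φ (InducedCycle.edge C i)

TypeA : ∀ {n p} (Φ : GainGraph n) → InducedCycle (graph Φ) p → Set
TypeA {p = p} Φ C = 2 ∣ p × cycleGain Φ C ≈ (- 1ℂ) ^ (p / 2)

-- Equality in ℂ is undecidable, so rank is a
-- total function only classically.

module Classical (em : ExcludedMiddle 0ℓ) where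

  -- The maximum number of linearly independent columns.
  rank : ∀ {m n} → Matrix m n → ℕ
  rank {n = n} A = greatest (λ k → ∃ λ (f : Fin k → Fin n) → IndependentColumns A f) (λ _ → em) n

  r : ∀ {n} → Graph n → ℕ
  r G = rank (adjacencyMatrix G)

  rᵍ : ∀ {n} → GainGraph n → ℕ
  rᵍ Φ = rank (gainMatrix Φ)

  -- Each component is counted once, at its least vertex.
  ω : ∀ {n} → Graph n → ℕ
  ω G = card (Vec.tabulate λ i → does (em {∀ j → Connected G i j → i Fin.≤ j}))

  θ : ∀ {n} → Graph n → ℤ
  θ {n} G = + edgeCount G ℤ.- + n ℤ.+ + ω G

{-# OPTIONS --safe #-}
-- Label the pendant cycle v = c₀, c₁, …, c_{p-1}.  Eliminating two consecutive path vertices by a Schur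
-- complement costs rank 2 and replaces them by an edge whose weight is minus the product of the weights
-- met.  For odd p this ends with H carrying a loop at v; for even p it ends with H and one more vertex
-- joined to v by an edge of weight ζ, where ζ = 0 exactly if the gain of the cycle is (-1)^(p/2).  Hence, for even p,
-- r = p - 2 + r(H) if ζ = 0 and r = p + r(F) otherwise, both for Φ and for G.
--
-- The lower bound r(Φ) ≥ r(G) - 2θ(G) holds because switching makes all gains equal to 1 except on at
-- most θ(G) edges, which meet at most 2θ(G) columns of the adjacency matrix.  Since θ(F) and θ(H) are
-- at most θ(G) - 1 and r(F) ≤ r(H) ≤ r(F) + 2, extremality of Φ rules out every case but ζ(Φ) = 0 and
-- ζ(G) ≠ 0, in which all the inequalities become equalities.  (For odd p the two matrices with loops
-- differ after switching in at most 2θ(H) + 1 columns, too few for extremality.)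
module Submission where

open import Algebra.Bundles using (CommutativeRing; Semiring)
import Algebra.Properties.CommutativeMonoid.Sum
import Algebra.Solver.Ring
open import Algebra.Solver.Ring.AlmostCommutativeRing using (_-Raw-AlmostCommutative⟶_; fromCommutativeRing)
open import Axiom.ExcludedMiddle using (ExcludedMiddle)
open import Data.Bool.Base using (if_then_else_; Bool; true; false; T; _∧_)
import Data.Bool.Properties as Bool
open import Data.Fin.Base as Fin using (Fin; zero; suc; toℕ; punchIn)
open import Data.Fin.Induction using (<-wellFounded)
open import Data.Fin.Permutation using (Permutation; permutation)
import Data.Fin.Properties as Fin
open import Data.Fin.Subset using (Subset; inside; outside; _∈_; ⁅_⁆; ∁; _∪_) renaming (∣_∣ to card)
import Data.Fin.Subset.Properties as Subset
open import Data.Integer.Base as ℤ using (ℤ; +_; -[1+_])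
import Data.Integer.Properties as ℤ
import Data.Integer.Tactic.RingSolver as ℤSolver
open import Data.List.Base as List using (List; []; _∷_; length; concat; applyUpTo)
import Data.List.Membership.Propositional as List
import Data.List.Membership.Propositional.Properties as List
import Data.List.Properties as List
open import Data.List.Relation.Unary.All as All using (All; []; _∷_)
import Data.List.Relation.Unary.All.Properties as All
open import Data.List.Relation.Unary.AllPairs as AllPairs using (AllPairs; []; _∷_)
import Data.List.Relation.Unary.AllPairs.Properties as AllPairs
open import Data.List.Relation.Unary.Any as Any using (Any; here; there; _─_)
open import Data.Maybe.Base as Maybe using (Maybe; nothing; just)
open import Data.Nat.Base as ℕ using (ℕ; zero; suc; z≤n; s≤s)
open import Data.Nat.DivMod using (_%_; _mod_; m%n<n; m<n⇒m%n≡m; m%n%n≡m%n; %-distribˡ-+; [m+n]%n≡m%n; _/_; m*n/n≡m; [m+kn]%n≡m%n)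
open import Data.Nat.Divisibility using (divides)
import Data.Nat.Properties as ℕ
open import Data.Nat.Tactic.RingSolver using (solve-∀)
open import Data.Product.Base as Product using (∃; _×_; _,_; proj₁; proj₂; swap)
open import Data.Rational.Base as ℚ using (ℚ; 0ℚ; 1ℚ; ½)
import Data.Rational.Properties as ℚ
import Data.Rational.Solver
open import Data.Sum.Base using (_⊎_; inj₁; inj₂; [_,_]′)
open import Data.Vec.Base as Vec using (here; there)
open import Data.Vec.Functional using (insertAt) renaming (_∷_ to _◂_)
import Data.Vec.Functional.Properties as Vector
import Data.Vec.Properties as Vec
open import Function.Base using (_∘_; id)
open import Function.Bundles using (_⇔_; mk⇔; module Equivalence)
open import Function.Construct.Composition using (_⇔-∘_)
open import Induction.WellFounded using (Acc; acc)
open import Level using (0ℓ)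
open import Relation.Binary.Construct.Closure.ReflexiveTransitive as Star using (Star; _◅_; _◅◅_; kleisliStar)
open import Relation.Binary.Definitions using (tri<; tri≈; tri>)
open import Relation.Binary.PropositionalEquality as ≡ using (_≡_; _≢_)
open import Relation.Nullary using (¬_; Dec; yes; no; does; contradiction)
open import Relation.Nullary.Decidable using (dec-true; dec-false; decidable-stable; _×-dec_; ¬?; T?)
open import Relation.Nullary.Decidable.Core using (dec⇒maybe)
open import Defs using (Graph; Adj; adjacent; adj-sym; adj-irrefl; degree; edgeCount; Connected; elements; greatest; inducedGraph; next; PendantCycle; module Classical)

-- The cases are ruled out by comparing losses. Since θ falls by at least 1 from `G` to `F` and to
-- `H`, extremality and the lower bound for the subgraph give r(Φ) + r(F) + 2 ≤ r(G) + r(F^φ), and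
-- likewise for `H`: passing from `G` to Φ loses at least 2 more than passing from `F` to F^φ. If
-- both matrices fell under the same reduction, the two losses would agree, so the reductions
-- differ, and only one of the two ways to differ has the right sign. Rank is the largest number of
-- independent columns, so a rank identity is proved as an equivalence of statements `A ⊒ k`, valid
-- for every k, and becomes numerical only at the end. Elimination is kept free of division by
-- cross-multiplying, which is sound in an integral domain. Row and column types are arbitrary, so
-- that adding or removing a vertex is the passage between `J` and `Maybe J`. Both matrices satisfy
-- W i j * W j i ≈ 1 on edges and vanish elsewhere, so each reduction is proved once for such
-- weightings and then applied to Φ and to `G`.

private variable
  n k : ℕ

-- Polynomial identities over a commutative ring

module IntegerCoefficientSolver (R : CommutativeRing 0ℓ 0ℓ) where
  open CommutativeRing R
  open import Algebra.Properties.Ring ring using (-‿distribˡ-*; -‿distribʳ-*)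
  open import Algebra.Properties.Group +-group using () renaming (⁻¹-involutive to -‿involutive; ε⁻¹≈ε to -0≈0)
  open import Algebra.Properties.AbelianGroup +-abelianGroup using () renaming (⁻¹-∙-comm to -‿+-comm)
  open import Algebra.Properties.Semiring.Mult.TCOptimised semiring using (1+×; ×-homo-+; ×1-homo-*) renaming (_×_ to _·_)
  open import Relation.Binary.Reasoning.Setoid setoid

  -- Equality in ℝ and ℂ is undecidable, so polynomials are normalised with coefficients in ℤ, where
  -- cancellation can be decided, and sent to the ring by the canonical homomorphism. The multiples
  -- `n · 1#` are taken in the variant where `1 · 1#` reduces to `1#`, so that `:0` and `:1`
  -- evaluate to `0#` and `1#`.
  fromℤ : ℤ → Carrier
  fromℤ (+ n)    = n · 1#
  fromℤ -[1+ n ] = - (suc n · 1#)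

  -‿homo : ∀ i → fromℤ (ℤ.- i) ≈ - fromℤ i
  -‿homo (+ zero)  = sym -0≈0
  -‿homo (+ suc n) = refl
  -‿homo -[1+ n ]  = sym (-‿involutive _)

  ⊖-homo : ∀ m n → fromℤ (m ℤ.⊖ n) ≈ m · 1# + - (n · 1#)
  ⊖-homo m zero = sym (trans (+-congˡ -0≈0) (+-identityʳ _))
  ⊖-homo zero (suc n) = sym (+-identityˡ _)
  ⊖-homo (suc m) (suc n) = begin
    fromℤ (suc m ℤ.⊖ suc n)                   ≡⟨ ≡.cong fromℤ (ℤ.[1+m]⊖[1+n]≡m⊖n m n) ⟩
    fromℤ (m ℤ.⊖ n)                           ≈⟨ ⊖-homo m n ⟩
    m · 1# + - (n · 1#)                       ≈⟨ +-congˡ (+-identityˡ _) ⟨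
    m · 1# + (0# + - (n · 1#))                ≈⟨ +-congˡ (+-congʳ (-‿inverseʳ 1#)) ⟨
    m · 1# + ((1# + - 1#) + - (n · 1#))       ≈⟨ +-congˡ (+-assoc _ _ _) ⟩
    m · 1# + (1# + (- 1# + - (n · 1#)))       ≈⟨ +-assoc _ _ _ ⟨
    (m · 1# + 1#) + (- 1# + - (n · 1#))       ≈⟨ +-cong (trans (+-comm _ _) (sym (1+× m 1#))) (trans (-‿+-comm _ _) (-‿cong (sym (1+× n 1#)))) ⟩
    suc m · 1# + - (suc n · 1#)               ∎

  +-homo : ∀ i j → fromℤ (i ℤ.+ j) ≈ fromℤ i + fromℤ j
  +-homo (+ m)    (+ n)    = ×-homo-+ 1# m n
  +-homo (+ m)    -[1+ n ] = ⊖-homo m (suc n)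
  +-homo -[1+ m ] (+ n)    = trans (⊖-homo n (suc m)) (+-comm _ _)
  +-homo -[1+ m ] -[1+ n ] = begin
    - (suc (suc (m ℕ.+ n)) · 1#)              ≡⟨ ≡.cong (λ k → - (suc k · 1#)) (ℕ.+-suc m n) ⟨
    - ((suc m ℕ.+ suc n) · 1#)                ≈⟨ -‿cong (×-homo-+ 1# (suc m) (suc n)) ⟩
    - (suc m · 1# + suc n · 1#)               ≈⟨ -‿+-comm _ _ ⟨
    - (suc m · 1#) + - (suc n · 1#)           ∎

  *-homo⁺ : ∀ m j → fromℤ (+ m ℤ.* j) ≈ fromℤ (+ m) * fromℤ j
  *-homo⁺ m (+ n) = trans (reflexive (≡.cong fromℤ (≡.sym (ℤ.pos-* m n)))) (×1-homo-* m n)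
  *-homo⁺ m -[1+ n ] = begin
    fromℤ (+ m ℤ.* -[1+ n ])                  ≡⟨ ≡.cong fromℤ (ℤ.neg-distribʳ-* (+ m) (+ suc n)) ⟨
    fromℤ (ℤ.- (+ m ℤ.* + suc n))             ≈⟨ -‿homo (+ m ℤ.* + suc n) ⟩
    - fromℤ (+ m ℤ.* + suc n)                 ≈⟨ -‿cong (*-homo⁺ m (+ suc n)) ⟩
    - (fromℤ (+ m) * (suc n · 1#))            ≈⟨ -‿distribʳ-* _ _ ⟩
    fromℤ (+ m) * - (suc n · 1#)              ∎

  *-homo : ∀ i j → fromℤ (i ℤ.* j) ≈ fromℤ i * fromℤ j
  *-homo (+ m) j = *-homo⁺ m j
  *-homo -[1+ m ] j = begin
    fromℤ (-[1+ m ] ℤ.* j)                    ≡⟨ ≡.cong fromℤ (ℤ.neg-distribˡ-* (+ suc m) j) ⟨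
    fromℤ (ℤ.- (+ suc m ℤ.* j))               ≈⟨ -‿homo (+ suc m ℤ.* j) ⟩
    - fromℤ (+ suc m ℤ.* j)                   ≈⟨ -‿cong (*-homo⁺ (suc m) j) ⟩
    - (fromℤ (+ suc m) * fromℤ j)             ≈⟨ -‿distribˡ-* _ _ ⟩
    - (suc m · 1#) * fromℤ j                  ∎

  morphism : ℤ.+-*-rawRing -Raw-AlmostCommutative⟶ fromCommutativeRing R
  morphism = record
    { ⟦_⟧    = fromℤ
    ; +-homo = +-homo
    ; *-homo = *-homo
    ; -‿homo = -‿homo
    ; 0-homo = refl
    ; 1-homo = refl
    }

  open Algebra.Solver.Ring ℤ.+-*-rawRing (fromCommutativeRing R) morphism
    (λ i j → Maybe.map (λ i≡j → reflexive (≡.cong fromℤ i≡j)) (dec⇒maybe (i ℤ.≟ j))) public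
    using (Polynomial; solve; con; _:+_; _:*_; :-_; _:=_)

  :0 :1 : ∀ {n} → Polynomial n
  :0 = con (+ 0)
  :1 = con (+ 1)

≢nothing⇒just : {A : Set} {x : Maybe A} → x ≢ nothing → ∃ λ y → x ≡ just y
≢nothing⇒just {x = just y}  _   = y , ≡.refl
≢nothing⇒just {x = nothing} x≢n = contradiction ≡.refl x≢n

-- `cancel` is the absence of zero divisors in the form in which it is applied: a nonzero factor is
-- discarded from an equation with 0. For ℂ this is provable by estimates, with no inverse of a
-- Cauchy sequence to construct.
record IntegralDomain : Set₁ where
  field
    commutativeRing : CommutativeRing 0ℓ 0ℓ

  open CommutativeRing commutativeRing public

  field
    1≉0    : ¬ 1# ≈ 0#
    cancel : ∀ {x y} → x * y ≈ 0# → ¬ x ≈ 0# → y ≈ 0#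

-- Counting in subsets and lists

elements-∈ : (S : Subset n) (i : Fin (card S)) → elements S i ∈ S
elements-∈ (inside  Vec.∷ S) zero    = here
elements-∈ (inside  Vec.∷ S) (suc i) = there (elements-∈ S i)
elements-∈ (outside Vec.∷ S) i       = there (elements-∈ S i)

elements-injective : (S : Subset n) {i j : Fin (card S)} → elements S i ≡ elements S j → i ≡ j
elements-injective (inside  Vec.∷ S) {zero}  {zero}  eq = ≡.refl
elements-injective (inside  Vec.∷ S) {suc i} {suc j} eq = ≡.cong suc (elements-injective S (Fin.suc-injective eq))
elements-injective (outside Vec.∷ S)                 eq = elements-injective S (Fin.suc-injective eq)

index : (S : Subset n) {x : Fin n} → x ∈ S → ∃ λ i → elements S i ≡ x
index (inside  Vec.∷ S) here = zero , ≡.refl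
index (inside  Vec.∷ S) (there x∈S) = let i , eq = index S x∈S in suc i , ≡.cong suc eq
index (outside Vec.∷ S) (there x∈S) = let i , eq = index S x∈S in i , ≡.cong suc eq

injective⇒≤card : (S : Subset n) (g : Fin k → Fin n) → (∀ {a b} → g a ≡ g b → a ≡ b) → (∀ a → g a ∈ S) → k ℕ.≤ card S
injective⇒≤card S g inj g∈S = Fin.injective⇒≤ {f = proj₁ ∘ index S ∘ g∈S} λ {a} {b} eq → inj
  (≡.trans (≡.sym (proj₂ (index S (g∈S a)))) (≡.trans (≡.cong (elements S) eq) (proj₂ (index S (g∈S b)))))

∈-tabulate⁺ : {f : Fin n → Bool} {x : Fin n} → T (f x) → x ∈ Vec.tabulate f
∈-tabulate⁺ {f = f} {x} fx = Vec.lookup⇒[]= x (Vec.tabulate f) (≡.trans (Vec.lookup∘tabulate f x) (Equivalence.to Bool.T-≡ fx))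

∈-tabulate⁻ : {f : Fin n → Bool} {x : Fin n} → x ∈ Vec.tabulate f → T (f x)
∈-tabulate⁻ {f = f} {x} x∈ = Equivalence.from Bool.T-≡ (≡.trans (≡.sym (Vec.lookup∘tabulate f x)) (Vec.[]=⇒lookup x∈))

does⁺ : {P : Set} (P? : Dec P) → P → T (does P?)
does⁺ (yes _) p = _
does⁺ (no ¬p) p = ¬p p

does⁻ : {P : Set} (P? : Dec P) → T (does P?) → P
does⁻ (yes p) _ = p

greatest-max : ∀ {P : ℕ → Set} {P? : ∀ k → Dec (P k)} {b k} → P k → k ℕ.≤ b → k ℕ.≤ greatest P P? b
greatest-max {b = zero} Pk k≤b = k≤b
greatest-max {P} {P?} {suc b} {k} Pk k≤b with P? (suc b)
... | yes _ = k≤b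
... | no ¬P = greatest-max Pk (ℕ.≤-pred (ℕ.≤∧≢⇒< k≤b λ { ≡.refl → ¬P Pk }))

greatest-holds : ∀ {P : ℕ → Set} {P? : ∀ k → Dec (P k)} b → P 0 → P (greatest P P? b)
greatest-holds zero P0 = P0
greatest-holds {P} {P?} (suc b) P0 with P? (suc b)
... | yes Pb = Pb
... | no _ = greatest-holds {P} {P?} b P0

module _ {A : Set} {_~_ : A → A → Set} (join : ∀ {x y z} → x ~ z → y ~ z → x ~ y) where

  remove-other : ∀ {x y ys} (p : Any (x ~_) ys) → ¬ x ~ y → Any (y ~_) ys → Any (y ~_) (ys ─ p)
  remove-other (here x~z) x≁y (here y~z) = contradiction (join x~z y~z) x≁y
  remove-other (here x~z) x≁y (there q) = q
  remove-other (there p) x≁y (here y~z) = here y~z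
  remove-other (there p) x≁y (there q) = there (remove-other p x≁y q)

  -- Pigeonhole up to a relation: by `join`, one entry of `ys` cannot serve two unrelated members of
  -- `xs`, so the entry used for the head may be deleted before the tail is treated.
  pairwise-≁⇒length≤ : ∀ {xs ys} → AllPairs (λ x y → ¬ x ~ y) xs → All (λ x → Any (x ~_) ys) xs → length xs ℕ.≤ length ys
  pairwise-≁⇒length≤ [] [] = z≤n
  pairwise-≁⇒length≤ {ys = ys} (x≁ ∷ xs≁) (p ∷ ps) = ℕ.≤-trans
    (s≤s (pairwise-≁⇒length≤ xs≁ (All.zipWith (λ (x≁y , q) → remove-other p x≁y q) (x≁ , ps))))
    (ℕ.≤-reflexive (≡.sym (List.length-removeAt′ ys (Any.index p))))

-- Undirected edges as ordered pairs up to reversal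

infix 4 _~_

_~_ : (e f : Fin n × Fin n) → Set
e ~ f = e ≡ f ⊎ e ≡ swap f

~-join : {x y z : Fin n × Fin n} → x ~ z → y ~ z → x ~ y
~-join (inj₁ ≡.refl) (inj₁ ≡.refl) = inj₁ ≡.refl
~-join (inj₁ ≡.refl) (inj₂ ≡.refl) = inj₂ ≡.refl
~-join (inj₂ ≡.refl) (inj₁ ≡.refl) = inj₂ ≡.refl
~-join (inj₂ ≡.refl) (inj₂ ≡.refl) = inj₁ ≡.refl

length-concat-tabulate : {A : Set} (f : Fin n → List A) →
  length (concat (List.tabulate f)) ≡ Vec.sum (Vec.tabulate (length ∘ f))
length-concat-tabulate {zero} f = ≡.refl
length-concat-tabulate {suc n} f = ≡.trans (List.length-++ (f zero))
  (≡.cong (length (f zero) ℕ.+_) (length-concat-tabulate (f ∘ suc)))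

module _ (G : Graph n) where

  upper : Fin n → Subset n
  upper i = Vec.tabulate λ j → does (i Fin.<? j) ∧ adjacent G i j

  star : Fin n → List (Fin n × Fin n)
  star i = List.tabulate λ l → i , elements (upper i) l

  -- An explicit list whose length is `edgeCount` turns comparisons of edge numbers into
  -- applications of the pigeonhole principle.
  edges : List (Fin n × Fin n)
  edges = concat (List.tabulate star)

  length-edges : length edges ≡ edgeCount G
  length-edges = ≡.trans (length-concat-tabulate star)
    (≡.cong Vec.sum (Vec.tabulate-cong λ i → List.length-tabulate λ l → i , elements (upper i) l))

  upper-< : ∀ i l → i Fin.< elements (upper i) l
  upper-< i l = does⁻ (i Fin.<? _) (proj₁ (Equivalence.to Bool.T-∧ (∈-tabulate⁻ (elements-∈ (upper i) l))))

  upper-Adj : ∀ i l → Adj G i (elements (upper i) l)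
  upper-Adj i l = proj₂ (Equivalence.to Bool.T-∧ (∈-tabulate⁻ (elements-∈ (upper i) l)))

  edges-Adj : ∀ {a b} → (a , b) List.∈ edges → Adj G a b
  edges-Adj e∈ with List.∈-concat⁻′ (List.tabulate star) e∈
  ... | es , e∈es , es∈ with List.∈-tabulate⁻ es∈
  ...   | i , ≡.refl with List.∈-tabulate⁻ e∈es
  ...     | l , ≡.refl = upper-Adj i l

  edges-complete-< : ∀ {a b} → a Fin.< b → Adj G a b → (a , b) List.∈ edges
  edges-complete-< {a} {b} a<b adj = List.∈-concat⁺′
    (≡.subst (λ x → (a , x) List.∈ star a) (proj₂ i) (List.∈-tabulate⁺ (proj₁ i)))
    (List.∈-tabulate⁺ a)
    where
    i = index (upper a) (∈-tabulate⁺ (Equivalence.from Bool.T-∧ (does⁺ (a Fin.<? b) a<b , adj)))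

  edges-complete : ∀ {a b} → Adj G a b → (a , b) List.∈ edges ⊎ (b , a) List.∈ edges
  edges-complete {a} {b} adj with Fin.<-cmp a b
  ... | tri< a<b _ _ = inj₁ (edges-complete-< a<b adj)
  ... | tri≈ _ ≡.refl _ = contradiction adj (adj-irrefl G)
  ... | tri> _ _ b<a = inj₂ (edges-complete-< b<a (adj-sym G adj))

  edges-distinct : AllPairs (λ e f → ¬ e ~ f) edges
  edges-distinct = AllPairs.concat⁺
    (All.tabulate⁺ λ i → AllPairs.tabulate⁺ λ {l} {l′} l≢l′ → λ where
      (inj₁ eq) → l≢l′ (elements-injective (upper i) (≡.cong proj₂ eq))
      (inj₂ eq) → Fin.<-irrefl (≡.sym (≡.cong proj₂ eq)) (upper-< i l))
    (AllPairs.tabulate⁺ λ {i} {i′} i≢i′ → All.tabulate⁺ λ l → All.tabulate⁺ λ l′ → λ where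
      (inj₁ eq) → i≢i′ (≡.cong proj₁ eq)
      (inj₂ eq) → Fin.<-asym (≡.subst (i Fin.<_) (≡.cong proj₂ eq) (upper-< i l))
                             (≡.subst (i′ Fin.<_) (≡.sym (≡.cong proj₁ eq)) (upper-< i′ l′)))

  distinct⇒length≤edgeCount : ∀ {es} → AllPairs (λ e f → ¬ e ~ f) es → All (λ e → Adj G (proj₁ e) (proj₂ e)) es →
    length es ℕ.≤ edgeCount G
  distinct⇒length≤edgeCount distinct adj = ≡.subst (_ ℕ.≤_) length-edges
    (pairwise-≁⇒length≤ ~-join distinct (All.map present adj))
    where
    present : ∀ {e} → Adj G (proj₁ e) (proj₂ e) → Any (e ~_) edges
    present adj with edges-complete adj
    ... | inj₁ e∈ = Any.map inj₁ e∈
    ... | inj₂ e∈ = Any.map (λ { ≡.refl → inj₂ ≡.refl }) e∈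

  Connected-sym : ∀ {i j} → Connected G i j → Connected G j i
  Connected-sym = Star.reverse (adj-sym G)

-- Connected components

module Components (em : ExcludedMiddle 0ℓ) where
  open Classical em using (ω)

  module _ {n : ℕ} (_R_ : Fin n → Fin n → Set) where

    -- The relation is a parameter because switching applies this to the links of a growing edge
    -- list as well as to adjacency in a graph.
    Separated : (Fin k → Fin n) → Set
    Separated g = ∀ {a b} → Star _R_ (g a) (g b) → a ≡ b

  least : ∀ {n} (G : Graph n) i → ∃ λ l → Connected G i l × (∀ j → Connected G l j → l Fin.≤ j)
  least G i = go i (<-wellFounded i)
    where
    go : ∀ i → Acc Fin._<_ i → ∃ λ l → Connected G i l × (∀ j → Connected G l j → l Fin.≤ j)
    go i (acc rs) with em {∃ λ j → Connected G i j × j Fin.< i}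
    ... | yes (j , i~j , j<i) = let l , j~l , min = go j (rs j<i) in l , i~j ◅◅ j~l , min
    ... | no none = i , Star.ε , λ j i~j → ℕ.≮⇒≥ λ j<i → none (j , i~j , j<i)

  -- Moving each member of the family to the least vertex of its component keeps the members
  -- distinct. With `ω-separated` this describes `ω` as the largest size of a separated family, the
  -- only description used later.
  separated⇒≤ω : ∀ {n} (G : Graph n) {g : Fin k → Fin n} → Separated (Adj G) g → k ℕ.≤ ω G
  separated⇒≤ω G {g} sep = injective⇒≤card _ (λ a → proj₁ (least G (g a)))
    (λ {a} {b} eq → sep (proj₁ (proj₂ (least G (g a))) ◅◅
       ≡.subst (λ l → Connected G l (g b)) (≡.sym eq) (Connected-sym G (proj₁ (proj₂ (least G (g b)))))))
    (λ a → ∈-tabulate⁺ (does⁺ em (proj₂ (proj₂ (least G (g a))))))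

  leastVertices : ∀ {n} → Graph n → Subset n
  leastVertices G = Vec.tabulate λ i → does (em {∀ j → Connected G i j → i Fin.≤ j})

  ω-separated : ∀ {n} (G : Graph n) → ∃ λ (g : Fin (ω G) → Fin n) → Separated (Adj G) g
  ω-separated G = elements (leastVertices G) , λ {a} {b} a~b → elements-injective (leastVertices G) (Fin.≤-antisym
    (isLeast a _ a~b) (isLeast b _ (Connected-sym G a~b)))
    where
    isLeast : ∀ a j → Connected G (elements (leastVertices G) a) j → elements (leastVertices G) a Fin.≤ j
    isLeast a = does⁻ em (∈-tabulate⁻ (elements-∈ (leastVertices G) a))

  -- `ρ` turns a path of `G` between two vertices `ι i`, `ι j` into a connection of i and j in `F`,
  -- so `ι` preserves separated families.
  retract⇒ω≤ : ∀ {m n} (F : Graph m) (G : Graph n) (ι : Fin m → Fin n) (ρ : Fin n → Fin m) →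
    (∀ i → ρ (ι i) ≡ i) → (∀ {x y} → Adj G x y → Connected F (ρ x) (ρ y)) → ω F ℕ.≤ ω G
  retract⇒ω≤ F G ι ρ ρι step = let g , sep = ω-separated F in
    separated⇒≤ω G {ι ∘ g} λ {a} {b} c → sep (≡.subst₂ (Connected F) (ρι (g a)) (ρι (g b)) (kleisliStar ρ step c))

-- Counting vertices and edges of induced subgraphs

unique⇒length≤card : (S : Subset n) {xs : List (Fin n)} → AllPairs _≢_ xs → All (_∈ S) xs → length xs ℕ.≤ card S
unique⇒length≤card S {xs} unique xs∈S = ≡.subst (length xs ℕ.≤_) (List.length-tabulate (elements S))
  (pairwise-≁⇒length≤ (λ { ≡.refl ≡.refl → ≡.refl }) unique
    (All.map (λ x∈S → ≡.subst (List._∈ _) (proj₂ (index S x∈S)) (List.∈-tabulate⁺ (proj₁ (index S x∈S)))) xs∈S))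

cover⇒≤ : (S : Subset n) (g : Fin k → Fin n) → (∀ x → x ∈ S ⊎ ∃ λ l → g l ≡ x) → n ℕ.≤ card S ℕ.+ k
cover⇒≤ {n} {k} S g cover = Fin.injective⇒≤ {f = λ x → Fin.join (card S) k (proj₁ (code x))} λ {x} {y} eq →
  ≡.trans (≡.sym (proj₂ (code x))) (≡.trans (≡.cong [ elements S , g ]′
    (≡.trans (≡.sym (Fin.splitAt-join (card S) k (proj₁ (code x)))) (≡.trans (≡.cong (Fin.splitAt (card S)) eq) (Fin.splitAt-join (card S) k (proj₁ (code y))))))
    (proj₂ (code y)))
  where
  code : ∀ x → ∃ λ (s : Fin (card S) ⊎ Fin k) → [ elements S , g ]′ s ≡ x
  code x with cover x
  ... | inj₁ x∈S = let i , eq = index S x∈S in inj₁ i , eq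
  ... | inj₂ (l , eq) = inj₂ l , eq

-- The edges inside `S` followed by `es`, none of which lies inside `S`, form a duplicate-free list
-- of edges of `G`.
induced-edgeCount : (G : Graph n) (S : Subset n) {es : List (Fin n × Fin n)} →
  AllPairs (λ e f → ¬ e ~ f) es → All (λ (a , b) → Adj G a b) es → All (λ (a , b) → ¬ (a ∈ S × b ∈ S)) es →
  edgeCount (inducedGraph G S) ℕ.+ length es ℕ.≤ edgeCount G
induced-edgeCount {n} G S {es} distinct adj outside-S = ℕ.≤-trans (ℕ.≤-reflexive (≡.sym lengths))
  (distinct⇒length≤edgeCount G
    (AllPairs.++⁺ (AllPairs.map⁺ (AllPairs.map (λ ≁ → ≁ ∘ lift) (edges-distinct (inducedGraph G S)))) distinct
      (All.map⁺ (All.universal (λ e → All.map (λ {f} out → λ where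
        (inj₁ ≡.refl) → out (elements-∈ S _ , elements-∈ S _)
        (inj₂ eq) → out (≡.subst (_∈ S) (≡.cong proj₂ eq) (elements-∈ S _) , ≡.subst (_∈ S) (≡.cong proj₁ eq) (elements-∈ S _))) outside-S) _)))
    (All.++⁺ (All.map⁺ (All.tabulate (edges-Adj (inducedGraph G S)))) adj))
  where
  ι : Fin (card S) × Fin (card S) → Fin n × Fin n
  ι = Product.map (elements S) (elements S)
  lift : ∀ {e f} → ι e ~ ι f → e ~ f
  lift (inj₁ eq) = inj₁ (≡.cong₂ _,_ (elements-injective S (≡.cong proj₁ eq)) (elements-injective S (≡.cong proj₂ eq)))
  lift (inj₂ eq) = inj₂ (≡.cong₂ _,_ (elements-injective S (≡.cong proj₁ eq)) (elements-injective S (≡.cong proj₂ eq)))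
  lengths : length (List.map ι (edges (inducedGraph G S)) List.++ es) ≡ edgeCount (inducedGraph G S) ℕ.+ length es
  lengths = ≡.trans (List.length-++ (List.map ι (edges (inducedGraph G S))))
    (≡.cong (ℕ._+ length es) (≡.trans (List.length-map ι (edges (inducedGraph G S))) (length-edges (inducedGraph G S))))

-- Cyclic indices counted from the root

toℕ-mod : ∀ m d → toℕ (m mod suc d) ≡ m % suc d
toℕ-mod m d = Fin.toℕ-fromℕ< (m%n<n m (suc d))

[m+n%d]%d≡[m+n]%d : ∀ m n d → (m ℕ.+ n % suc d) % suc d ≡ (m ℕ.+ n) % suc d
[m+n%d]%d≡[m+n]%d m n d = ≡.trans (%-distribˡ-+ m (n % suc d) (suc d))
  (≡.trans (≡.cong (λ x → (m % suc d ℕ.+ x) % suc d) (m%n%n≡m%n n (suc d))) (≡.sym (%-distribˡ-+ m n (suc d))))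

module Rotation {d : ℕ} (root : Fin (suc d)) where
  private
    p = suc d
    r = toℕ root

  r≤p : r ℕ.≤ p
  r≤p = ℕ.<⇒≤ (Fin.toℕ<n root)

  -- Natural numbers as indices make the successor free of wrap-around; the return to the root
  -- appears as index p, by `rot-period`.
  rot : ℕ → Fin p
  rot k = (r ℕ.+ k) mod p

  unrot : Fin p → ℕ
  -- `p ∸ r` stands for -r modulo p.
  unrot i = (p ℕ.∸ r ℕ.+ toℕ i) % p

  rot-zero : rot 0 ≡ root
  rot-zero = Fin.toℕ-injective (≡.trans (toℕ-mod (r ℕ.+ 0) d)
    (≡.trans (≡.cong (_% p) (ℕ.+-identityʳ r)) (m<n⇒m%n≡m (Fin.toℕ<n root))))

  rot-period : rot p ≡ rot 0
  rot-period = Fin.toℕ-injective (≡.trans (toℕ-mod (r ℕ.+ p) d) (≡.trans ([m+n]%n≡m%n r p)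
    (≡.trans (≡.cong (_% p) (≡.sym (ℕ.+-identityʳ r))) (≡.sym (toℕ-mod (r ℕ.+ 0) d)))))

  next-rot : ∀ k → next (rot k) ≡ rot (suc k)
  next-rot k = Fin.toℕ-injective (begin
    toℕ (next (rot k))             ≡⟨ toℕ-mod (suc (toℕ (rot k))) d ⟩
    suc (toℕ (rot k)) % p          ≡⟨ ≡.cong (λ x → suc x % p) (toℕ-mod (r ℕ.+ k) d) ⟩
    (1 ℕ.+ (r ℕ.+ k) % p) % p      ≡⟨ [m+n%d]%d≡[m+n]%d 1 (r ℕ.+ k) d ⟩
    suc (r ℕ.+ k) % p              ≡⟨ ≡.cong (_% p) (ℕ.+-suc r k) ⟨
    (r ℕ.+ suc k) % p              ≡⟨ toℕ-mod (r ℕ.+ suc k) d ⟨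
    toℕ (rot (suc k))              ∎)
    where open ≡.≡-Reasoning

  unrot-rot : ∀ k → unrot (rot k) ≡ k % p
  unrot-rot k = begin
    (p ℕ.∸ r ℕ.+ toℕ (rot k)) % p          ≡⟨ ≡.cong (λ x → (p ℕ.∸ r ℕ.+ x) % p) (toℕ-mod (r ℕ.+ k) d) ⟩
    (p ℕ.∸ r ℕ.+ (r ℕ.+ k) % p) % p        ≡⟨ [m+n%d]%d≡[m+n]%d (p ℕ.∸ r) (r ℕ.+ k) d ⟩
    (p ℕ.∸ r ℕ.+ (r ℕ.+ k)) % p            ≡⟨ ≡.cong (_% p) (≡.trans (≡.sym (ℕ.+-assoc (p ℕ.∸ r) r k)) (≡.trans (≡.cong (ℕ._+ k) (ℕ.m∸n+n≡m r≤p)) (ℕ.+-comm p k))) ⟩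
    (k ℕ.+ p) % p                          ≡⟨ [m+n]%n≡m%n k p ⟩
    k % p                                  ∎
    where open ≡.≡-Reasoning

  rot-unrot : ∀ i → rot (unrot i) ≡ i
  rot-unrot i = Fin.toℕ-injective (begin
    toℕ (rot (unrot i))                          ≡⟨ toℕ-mod (r ℕ.+ unrot i) d ⟩
    (r ℕ.+ (p ℕ.∸ r ℕ.+ toℕ i) % p) % p          ≡⟨ [m+n%d]%d≡[m+n]%d r (p ℕ.∸ r ℕ.+ toℕ i) d ⟩
    (r ℕ.+ (p ℕ.∸ r ℕ.+ toℕ i)) % p              ≡⟨ ≡.cong (_% p) (≡.trans (≡.sym (ℕ.+-assoc r (p ℕ.∸ r) (toℕ i))) (≡.trans (≡.cong (ℕ._+ toℕ i) (ℕ.m+[n∸m]≡n r≤p)) (ℕ.+-comm p (toℕ i)))) ⟩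
    (toℕ i ℕ.+ p) % p                            ≡⟨ [m+n]%n≡m%n (toℕ i) p ⟩
    toℕ i % p                                    ≡⟨ m<n⇒m%n≡m (Fin.toℕ<n i) ⟩
    toℕ i                                        ∎)
    where open ≡.≡-Reasoning

  unrot<p : ∀ i → unrot i ℕ.< p
  unrot<p i = m%n<n (p ℕ.∸ r ℕ.+ toℕ i) p

  rot-injective : ∀ {k l} → k ℕ.< p → l ℕ.< p → rot k ≡ rot l → k ≡ l
  rot-injective {k} {l} k<p l<p eq = begin
    k                ≡⟨ m<n⇒m%n≡m k<p ⟨
    k % p            ≡⟨ unrot-rot k ⟨
    unrot (rot k)    ≡⟨ ≡.cong unrot eq ⟩
    unrot (rot l)    ≡⟨ unrot-rot l ⟩
    l % p            ≡⟨ m<n⇒m%n≡m l<p ⟩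
    l                ∎
    where open ≡.≡-Reasoning

  -- Serves to reorder the product of the gains so that it starts at the root.
  rotation : Permutation p p
  rotation = permutation (rot ∘ toℕ) (λ i → Fin.fromℕ< (unrot<p i))
    (λ i → ≡.trans (≡.cong rot (Fin.toℕ-fromℕ< (unrot<p i))) (rot-unrot i))
    (λ k → Fin.toℕ-injective (≡.trans (Fin.toℕ-fromℕ< (unrot<p (rot (toℕ k)))) (≡.trans (unrot-rot (toℕ k)) (m<n⇒m%n≡m (Fin.toℕ<n k)))))

-- The drop of |E| - |V| + ω when at most m vertices but at least m + 1 edges disappear and no
-- component is gained, written without subtraction.
cyclomatic : ∀ {e e′ w w′ n n′} m → e′ ℕ.+ suc m ℕ.≤ e → w′ ℕ.≤ w → n ℕ.≤ n′ ℕ.+ m →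
  suc (e′ ℕ.+ w′) ℕ.+ n ℕ.≤ e ℕ.+ w ℕ.+ n′
cyclomatic {e} {e′} {w} {w′} {n} {n′} m e≤ w≤ n≤ = begin
  suc (e′ ℕ.+ w′) ℕ.+ n               ≤⟨ ℕ.+-monoʳ-≤ (suc (e′ ℕ.+ w′)) n≤ ⟩
  suc (e′ ℕ.+ w′) ℕ.+ (n′ ℕ.+ m)      ≡⟨ rearrange e′ w′ n′ m ⟩
  (e′ ℕ.+ suc m) ℕ.+ w′ ℕ.+ n′        ≤⟨ ℕ.+-monoˡ-≤ n′ (ℕ.+-mono-≤ e≤ w≤) ⟩
  e ℕ.+ w ℕ.+ n′                      ∎
  where
  open ℕ.≤-Reasoning
  rearrange : ∀ e w n m → suc (e ℕ.+ w) ℕ.+ (n ℕ.+ m) ≡ (e ℕ.+ suc m) ℕ.+ w ℕ.+ n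
  rearrange = solve-∀

-- Combinatorics of a pendant cycle

module Pendant {n : ℕ} (G : Graph n) {q : ℕ} (C : PendantCycle G (3 ℕ.+ q)) where
  open PendantCycle C
  open Rotation root public

  p : ℕ
  p = 3 ℕ.+ q

  c : ℕ → Fin n
  c k = vertex (rot k)

  c-zero : c 0 ≡ attachment
  c-zero = ≡.cong vertex rot-zero

  c-period : c p ≡ c 0
  c-period = ≡.cong vertex rot-period

  c-injective : ∀ {k l} → k ℕ.< p → l ℕ.< p → c k ≡ c l → k ≡ l
  c-injective k<p l<p eq = rot-injective k<p l<p (injective eq)

  c-Adj : ∀ k → Adj G (c k) (c (suc k))
  c-Adj k = ≡.subst (λ i → Adj G (c k) (vertex i)) (next-rot k) (edge (rot k))

  OnCycle : Fin n → Set
  OnCycle x = ∃ λ k → k ℕ.< p × c k ≡ x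

  c-OnCycle : ∀ k → k ℕ.≤ p → OnCycle (c k)
  c-OnCycle k k≤p with ℕ.m≤n⇒m<n∨m≡n k≤p
  ... | inj₁ k<p = k , k<p , ≡.refl
  ... | inj₂ ≡.refl = 0 , s≤s z≤n , ≡.sym c-period

  ∈vertices⇔ : ∀ {x} → (x ∈ vertices → OnCycle x) × (OnCycle x → x ∈ vertices)
  ∈vertices⇔ {x} =
    (λ x∈ → let i , eq = does⁻ (Fin.any? λ i → vertex i Fin.≟ x) (∈-tabulate⁻ x∈)
            in unrot i , unrot<p i , ≡.trans (≡.cong vertex (rot-unrot i)) eq) ,
    (λ (k , _ , eq) → ∈-tabulate⁺ (does⁺ (Fin.any? λ i → vertex i Fin.≟ x) (rot k , eq)))

  SF SH : Subset n
  SF = ∁ vertices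
  SH = SF ∪ ⁅ attachment ⁆

  ∈SF⁺ : ∀ {x} → ¬ OnCycle x → x ∈ SF
  ∈SF⁺ off = Subset.x∉p⇒x∈∁p (off ∘ proj₁ ∈vertices⇔)

  ∈SF⁻ : ∀ {x} → x ∈ SF → ¬ OnCycle x
  ∈SF⁻ x∈ on = Subset.x∈∁p⇒x∉p x∈ (proj₂ ∈vertices⇔ on)

  ∈SH⁺ : ∀ {x} → ¬ OnCycle x ⊎ x ≡ c 0 → x ∈ SH
  ∈SH⁺ (inj₁ off) = Subset.x∈p∪q⁺ (inj₁ (∈SF⁺ off))
  ∈SH⁺ (inj₂ ≡.refl) = Subset.x∈p∪q⁺ {p = SF} (inj₂ (≡.subst (_∈ ⁅ attachment ⁆) (≡.sym c-zero) (Subset.x∈⁅x⁆ attachment)))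

  ∈SH⁻ : ∀ {x} → x ∈ SH → ¬ OnCycle x ⊎ x ≡ c 0
  ∈SH⁻ x∈ with Subset.x∈p∪q⁻ SF ⁅ attachment ⁆ x∈
  ... | inj₁ x∈SF = inj₁ (∈SF⁻ x∈SF)
  ... | inj₂ x∈v = inj₂ (≡.trans (Subset.x∈⁅y⁆⇒x≡y attachment x∈v) (≡.sym c-zero))

  -- Here p ≥ 3 enters: if 2 + k = p then `c (2 + k)` is `c 0`, and k = p - 2 is positive.
  c≢c+2 : ∀ {k} → suc k ℕ.< p → c k ≢ c (2 ℕ.+ k)
  c≢c+2 {k} 1+k<p eq with ℕ.m≤n⇒m<n∨m≡n 1+k<p
  ... | inj₁ 2+k<p with c-injective (ℕ.<-trans (ℕ.n<1+n k) 1+k<p) 2+k<p eq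
  ...   | ()
  c≢c+2 {k} 1+k<p eq | inj₂ ≡.refl with c-injective (ℕ.<-trans (ℕ.n<1+n k) 1+k<p) (s≤s z≤n) (≡.trans eq c-period)
  ...   | ()

  -- Otherwise x, `c k` and `c (2 + k)` would be three distinct neighbours of a vertex of degree 2.
  c-neighbours : ∀ {k x} → suc k ℕ.< p → Adj G (c (suc k)) x → x ≡ c k ⊎ x ≡ c (2 ℕ.+ k)
  c-neighbours {k} {x} 1+k<p adj with x Fin.≟ c k | x Fin.≟ c (2 ℕ.+ k)
  ... | yes eq | _ = inj₁ eq
  ... | no _ | yes eq = inj₂ eq
  ... | no x≢ | no x≢′ = contradiction
    (ℕ.≤-trans (unique⇒length≤card _ ((x≢ ∷ x≢′ ∷ []) ∷ (c≢c+2 1+k<p ∷ []) ∷ [] ∷ [])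
      (∈-tabulate⁺ adj ∷ ∈-tabulate⁺ (adj-sym G (c-Adj k)) ∷ ∈-tabulate⁺ (c-Adj (suc k)) ∷ []))
      (ℕ.≤-reflexive (degree-other (rot (suc k)) λ eq → ℕ.1+n≢0 (rot-injective 1+k<p (s≤s z≤n) (≡.trans eq (≡.sym rot-zero))))))
    λ { (s≤s (s≤s ())) }

  off-cycle-neighbour : ∀ {k x} → k ℕ.< p → Adj G (c k) x → ¬ OnCycle x → k ≡ 0
  off-cycle-neighbour {zero} _ _ _ = ≡.refl
  off-cycle-neighbour {suc k} 1+k<p adj off with c-neighbours 1+k<p adj
  ... | inj₁ ≡.refl = contradiction (c-OnCycle k (ℕ.<⇒≤ (ℕ.<-trans (ℕ.n<1+n k) 1+k<p))) off
  ... | inj₂ ≡.refl = contradiction (c-OnCycle (2 ℕ.+ k) 1+k<p) off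

  last : ℕ
  last = 2 ℕ.+ q

  last-Adj : Adj G (c 0) (c last)
  last-Adj = adj-sym G (≡.subst (Adj G (c last)) c-period (c-Adj last))

  c1≢last : c 1 ≢ c last
  c1≢last eq with c-injective (s≤s (s≤s z≤n)) ℕ.≤-refl eq
  ... | ()

  cycle-Adj : ∀ {k} → k ℕ.< p → Adj G (c 0) (c k) → c k ≡ c 1 ⊎ c k ≡ c last
  cycle-Adj {k} k<p adj with Equivalence.to (adj⇔ (rot 0) (rot k)) adj
  ... | inj₁ eq = inj₁ (≡.cong vertex (≡.trans eq (next-rot 0)))
  ... | inj₂ eq with ℕ.m≤n⇒m<n∨m≡n k<p
  ...   | inj₂ ≡.refl = inj₂ ≡.refl
  ...   | inj₁ 1+k<p with rot-injective (s≤s z≤n) 1+k<p (≡.trans eq (next-rot k))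
  ...     | ()

  -- `c 1` and `c last` are two of the three neighbours of `c 0`. A fourth is excluded by counting,
  -- and without a third the neighbourhood would inject into two elements. The third is off the
  -- cycle because an induced cycle has no chords.
  attachment-neighbour : ∃ λ u → ¬ OnCycle u × Adj G (c 0) u × (∀ {x} → Adj G (c 0) x → ¬ OnCycle x → x ≡ u)
  attachment-neighbour with Fin.any? (λ u → T? (adjacent G (c 0) u) ×-dec ¬? (u Fin.≟ c 1) ×-dec ¬? (u Fin.≟ c last))
  ... | yes (u , adj , u≢1 , u≢last) = u , off , adj , unique
    where
    off : ¬ OnCycle u
    off (k , k<p , ≡.refl) with cycle-Adj k<p adj
    ... | inj₁ eq = u≢1 eq
    ... | inj₂ eq = u≢last eq
    unique : ∀ {x} → Adj G (c 0) x → ¬ OnCycle x → x ≡ u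
    unique {x} adjx offx with x Fin.≟ u
    ... | yes eq = eq
    ... | no x≢u = contradiction
      (ℕ.≤-trans (unique⇒length≤card _
        ((x≢u ∷ (λ { ≡.refl → offx (c-OnCycle 1 (s≤s z≤n)) }) ∷ (λ { ≡.refl → offx (c-OnCycle last (ℕ.n≤1+n last)) }) ∷ [])
          ∷ (u≢1 ∷ u≢last ∷ []) ∷ (c1≢last ∷ []) ∷ [] ∷ [])
        (∈-tabulate⁺ adjx ∷ ∈-tabulate⁺ adj ∷ ∈-tabulate⁺ (c-Adj 0) ∷ ∈-tabulate⁺ last-Adj ∷ []))
        (ℕ.≤-reflexive (≡.trans (≡.cong (degree G) c-zero) degree-root)))
      λ { (s≤s (s≤s (s≤s ()))) }
  ... | no none = contradiction (ℕ.≤-trans (ℕ.≤-reflexive (≡.sym (≡.trans (≡.cong (degree G) c-zero) degree-root)))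
      (Fin.injective⇒≤ {f = side} side-injective)) λ { (s≤s (s≤s ())) }
    where
    S = Vec.tabulate (adjacent G (c 0))
    side : Fin (card S) → Fin 2
    side i with elements S i Fin.≟ c 1
    ... | yes _ = zero
    ... | no _ = suc zero
    side-injective : ∀ {i j} → side i ≡ side j → i ≡ j
    side-injective {i} {j} eq with elements S i Fin.≟ c 1 | elements S j Fin.≟ c 1
    ... | yes i≡ | yes j≡ = elements-injective S (≡.trans i≡ (≡.sym j≡))
    ... | no i≢ | no j≢ = elements-injective S (≡.trans (isLast i i≢) (≡.sym (isLast j j≢)))
      where
      isLast : ∀ i → elements S i ≢ c 1 → elements S i ≡ c last
      isLast i i≢ with elements S i Fin.≟ c last
      ... | yes eq = eq
      ... | no i≢′ = contradiction (elements S i , ∈-tabulate⁻ (elements-∈ S i) , i≢ , i≢′) none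

  cycleEdge : ℕ → Fin n × Fin n
  cycleEdge k = c k , c (suc k)

  cycleEdges : List (Fin n × Fin n)
  cycleEdges = applyUpTo cycleEdge p

  cycleEdges-distinct : AllPairs (λ e f → ¬ e ~ f) cycleEdges
  cycleEdges-distinct = AllPairs.applyUpTo⁺₁ cycleEdge p λ {i} {j} i<j j<p → λ where
      (inj₁ eq) → ℕ.<⇒≢ i<j (c-injective (ℕ.<-trans i<j j<p) j<p (≡.cong proj₁ eq))
      -- Coincidence with a reversed edge forces j = i + 1 and then `c i ≡ c (2 + i)`.
      (inj₂ eq) → crossing i<j j<p (≡.cong proj₁ eq) (≡.cong proj₂ eq)
    where
    crossing : ∀ {i j} → i ℕ.< j → j ℕ.< p → c i ≡ c (suc j) → c (suc i) ≢ c j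
    crossing i<j j<p eq eq′ with c-injective (ℕ.≤-<-trans i<j j<p) j<p eq′
    ... | ≡.refl = c≢c+2 j<p eq

  cycleEdges-Adj : All (λ (a , b) → Adj G a b) cycleEdges
  cycleEdges-Adj = All.applyUpTo⁺₂ cycleEdge p c-Adj

  c-∉SF : ∀ {k} → k ℕ.≤ p → ¬ c k ∈ SF
  c-∉SF k≤p c∈ = ∈SF⁻ c∈ (c-OnCycle _ k≤p)

  c-∉SH : ∀ {k} → suc k ℕ.< p → ¬ c (suc k) ∈ SH
  c-∉SH 1+k<p c∈ with ∈SH⁻ c∈
  ... | inj₁ off = off (c-OnCycle _ (ℕ.<⇒≤ 1+k<p))
  ... | inj₂ eq = ℕ.1+n≢0 (c-injective 1+k<p (s≤s z≤n) eq)

  F H : Graph _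
  F = inducedGraph G SF
  H = inducedGraph G SH

  -- The cycle edges and the edge from `c 0` to its outer neighbour are lost: p + 1 edges against p
  -- vertices.
  edgeCount-F : edgeCount F ℕ.+ suc p ℕ.≤ edgeCount G
  edgeCount-F with attachment-neighbour
  ... | u , off , adj , _ = ℕ.≤-trans (ℕ.≤-reflexive (≡.cong (λ l → edgeCount F ℕ.+ suc l) (≡.sym (List.length-applyUpTo cycleEdge p))))
    (induced-edgeCount G SF {(c 0 , u) ∷ cycleEdges}
      (All.applyUpTo⁺₁ cycleEdge p (λ {k} k<p → λ where
        (inj₁ eq) → off (≡.subst OnCycle (≡.sym (≡.cong proj₂ eq)) (c-OnCycle (suc k) k<p))
        (inj₂ eq) → off (≡.subst OnCycle (≡.sym (≡.cong proj₂ eq)) (c-OnCycle k (ℕ.<⇒≤ k<p)))) ∷ cycleEdges-distinct)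
      (adj ∷ cycleEdges-Adj)
      ((λ (c∈ , _) → c-∉SF z≤n c∈) ∷ All.applyUpTo⁺₁ cycleEdge p (λ k<p (c∈ , _) → c-∉SF (ℕ.<⇒≤ k<p) c∈)))

  -- `H` keeps `c 0`, but every cycle edge has another end on the cycle: p edges are lost against p
  -- - 1 vertices.
  edgeCount-H : edgeCount H ℕ.+ p ℕ.≤ edgeCount G
  edgeCount-H = ℕ.≤-trans (ℕ.≤-reflexive (≡.cong (edgeCount H ℕ.+_) (≡.sym (List.length-applyUpTo cycleEdge p))))
    (induced-edgeCount G SH cycleEdges-distinct cycleEdges-Adj (All.applyUpTo⁺₁ cycleEdge p not-inside))
    where
    not-inside : ∀ {k} → k ℕ.< p → ¬ (c k ∈ SH × c (suc k) ∈ SH)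
    not-inside {zero}  _   (_ , c∈) = c-∉SH (s≤s (s≤s z≤n)) c∈
    not-inside {suc k} k<p (c∈ , _) = c-∉SH k<p c∈

  OnCycle? : ∀ x → Dec (OnCycle x)
  OnCycle? x with x Subset.∈? vertices
  ... | yes x∈ = yes (proj₁ ∈vertices⇔ x∈)
  ... | no x∉ = no (x∉ ∘ proj₂ ∈vertices⇔)

  order-F : n ℕ.≤ card SF ℕ.+ p
  order-F = cover⇒≤ SF (c ∘ toℕ) cover
    where
    cover : ∀ x → x ∈ SF ⊎ ∃ λ (l : Fin p) → c (toℕ l) ≡ x
    cover x with OnCycle? x
    ... | no off = inj₁ (∈SF⁺ off)
    ... | yes (k , k<p , eq) = inj₂ (Fin.fromℕ< k<p , ≡.trans (≡.cong c (Fin.toℕ-fromℕ< k<p)) eq)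

  order-H : n ℕ.≤ card SH ℕ.+ last
  order-H = cover⇒≤ SH (c ∘ suc ∘ toℕ) cover
    where
    cover : ∀ x → x ∈ SH ⊎ ∃ λ (l : Fin last) → c (suc (toℕ l)) ≡ x
    cover x with OnCycle? x
    ... | no off = inj₁ (∈SH⁺ (inj₁ off))
    ... | yes (zero , _ , eq) = inj₁ (∈SH⁺ (inj₂ (≡.sym eq)))
    ... | yes (suc k , s≤s k< , eq) = inj₂ (Fin.fromℕ< k< , ≡.trans (≡.cong (c ∘ suc) (Fin.toℕ-fromℕ< k<)) eq)

  module _ (em : ExcludedMiddle 0ℓ) where
    open Classical em using (ω)
    open Components em

    collapse : Fin n → Fin n → Fin n
    collapse b x = if does (OnCycle? x) then b else x

    -- Sending the whole cycle to `b` retracts `G` onto `S`. Each edge is kept or contracted: edges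
    -- leaving the cycle start at `c 0`, and `crossing` says what becomes of them.
    collapse⇒ω≤ : ∀ b (S : Subset n) → b ∈ S → (∀ {x} → ¬ OnCycle x → x ∈ S) → (∀ {x} → x ∈ S → OnCycle x → x ≡ b) →
      (∀ {x} → Adj G (c 0) x → ¬ OnCycle x → b ≡ x ⊎ Adj G b x) → ω (inducedGraph G S) ℕ.≤ ω G
    collapse⇒ω≤ b S b∈ off⇒∈ on⇒b crossing = retract⇒ω≤ (inducedGraph G S) G (elements S) (proj₁ ∘ ρ)
      (λ i → elements-injective S (≡.trans (proj₂ (ρ (elements S i))) (fixed (elements-∈ S i))))
      (λ {x} {y} adj → connect {x} {y} (step adj))
      where
      collapse∈ : ∀ x → collapse b x ∈ S
      collapse∈ x with OnCycle? x
      ... | yes _ = b∈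
      ... | no off = off⇒∈ off
      ρ : ∀ x → ∃ λ i → elements S i ≡ collapse b x
      ρ x = index S (collapse∈ x)
      fixed : ∀ {x} → x ∈ S → collapse b x ≡ x
      fixed {x} x∈ with OnCycle? x
      ... | yes on = ≡.sym (on⇒b x∈ on)
      ... | no _ = ≡.refl
      mixed : ∀ {x y} → Adj G x y → OnCycle x → ¬ OnCycle y → b ≡ y ⊎ Adj G b y
      mixed adj (k , k<p , ≡.refl) off with off-cycle-neighbour k<p adj off
      ... | ≡.refl = crossing adj off
      step : ∀ {x y} → Adj G x y → collapse b x ≡ collapse b y ⊎ Adj G (collapse b x) (collapse b y)
      step {x} {y} adj with OnCycle? x | OnCycle? y
      ... | yes _ | yes _ = inj₁ ≡.refl
      ... | no _ | no _ = inj₂ adj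
      ... | yes on | no off = mixed adj on off
      ... | no off | yes on with mixed (adj-sym G adj) on off
      ...   | inj₁ eq = inj₁ (≡.sym eq)
      ...   | inj₂ adj′ = inj₂ (adj-sym G adj′)
      connect : ∀ {x y} → collapse b x ≡ collapse b y ⊎ Adj G (collapse b x) (collapse b y) →
        Connected (inducedGraph G S) (proj₁ (ρ x)) (proj₁ (ρ y))
      connect {x} {y} (inj₁ eq) = ≡.subst (Connected (inducedGraph G S) (proj₁ (ρ x)))
        (elements-injective S (≡.trans (proj₂ (ρ x)) (≡.trans eq (≡.sym (proj₂ (ρ y)))))) Star.ε
      connect {x} {y} (inj₂ adj) = ≡.subst₂ (Adj G) (≡.sym (proj₂ (ρ x))) (≡.sym (proj₂ (ρ y))) adj ◅ Star.ε

    ω-H : ω H ℕ.≤ ω G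
    ω-H = collapse⇒ω≤ (c 0) SH (∈SH⁺ (inj₂ ≡.refl)) (∈SH⁺ ∘ inj₁) only-c0 (λ adj _ → inj₂ adj)
      where
      only-c0 : ∀ {x} → x ∈ SH → OnCycle x → x ≡ c 0
      only-c0 x∈ on with ∈SH⁻ x∈
      ... | inj₁ off = contradiction on off
      ... | inj₂ eq = eq

    ω-F : ω F ℕ.≤ ω G
    ω-F with attachment-neighbour
    -- Collapsing onto the outer neighbour `u` contracts the single edge that leaves the cycle.
    ... | u , off , adj , unique = collapse⇒ω≤ u SF (∈SF⁺ off) ∈SF⁺ (λ x∈ on → contradiction on (∈SF⁻ x∈))
      (λ adjx offx → inj₁ (≡.sym (unique adjx offx)))

    -- θ(F) + 1 ≤ θ(G) and θ(H) + 1 ≤ θ(G), with the vertex counts moved so that no subtraction occurs.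
    cyclomatic-F : suc (edgeCount F ℕ.+ ω F) ℕ.+ n ℕ.≤ edgeCount G ℕ.+ ω G ℕ.+ card SF
    cyclomatic-F = cyclomatic p edgeCount-F ω-F order-F

    cyclomatic-H : suc (edgeCount H ℕ.+ ω H) ℕ.+ n ℕ.≤ edgeCount G ℕ.+ ω G ℕ.+ card SH
    cyclomatic-H = cyclomatic last edgeCount-H ω-H order-H

-- Arithmetic of the rank inequalities

double-bound : ∀ {k n x} k′ b l → k ℕ.≤ k′ ℕ.+ (2 ℕ.* b ℕ.+ l) → b ℕ.+ n ℕ.≤ x →
  k ℕ.+ 2 ℕ.* n ℕ.≤ k′ ℕ.+ l ℕ.+ 2 ℕ.* x
double-bound {k} {n} {x} k′ b l k≤ b≤ = begin
  k ℕ.+ 2 ℕ.* n                              ≤⟨ ℕ.+-monoˡ-≤ (2 ℕ.* n) k≤ ⟩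
  k′ ℕ.+ (2 ℕ.* b ℕ.+ l) ℕ.+ 2 ℕ.* n         ≡⟨ rearrange k′ b l n ⟩
  k′ ℕ.+ l ℕ.+ 2 ℕ.* (b ℕ.+ n)               ≤⟨ ℕ.+-monoʳ-≤ (k′ ℕ.+ l) (ℕ.*-monoʳ-≤ 2 b≤) ⟩
  k′ ℕ.+ l ℕ.+ 2 ℕ.* x                       ∎
  where
  open ℕ.≤-Reasoning
  rearrange : ∀ k b l n → k ℕ.+ (2 ℕ.* b ℕ.+ l) ℕ.+ 2 ℕ.* n ≡ k ℕ.+ l ℕ.+ 2 ℕ.* (b ℕ.+ n)
  rearrange = solve-∀

-- Here x - n is θ(G) and y - m is θ' of the subgraph, with x and y standing for |E| + ω. The
-- conclusion reads r(Φ) + 2θ' + 2 ≤ r(G).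
rank-gap : ∀ {rΦ rG x n y m} → rΦ ℕ.+ 2 ℕ.* x ≡ rG ℕ.+ 2 ℕ.* n → suc y ℕ.+ n ℕ.≤ x ℕ.+ m →
  rΦ ℕ.+ 2 ℕ.* y ℕ.+ 2 ℕ.≤ rG ℕ.+ 2 ℕ.* m
rank-gap {rΦ} {rG} {x} {n} {y} {m} eq le = ℕ.+-cancelʳ-≤ (2 ℕ.* n) _ _ (begin
  rΦ ℕ.+ 2 ℕ.* y ℕ.+ 2 ℕ.+ 2 ℕ.* n      ≡⟨ lem₁ rΦ y n ⟩
  rΦ ℕ.+ 2 ℕ.* (suc y ℕ.+ n)            ≤⟨ ℕ.+-monoʳ-≤ rΦ (ℕ.*-monoʳ-≤ 2 le) ⟩
  rΦ ℕ.+ 2 ℕ.* (x ℕ.+ m)                ≡⟨ lem₂ rΦ x m ⟩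
  rΦ ℕ.+ 2 ℕ.* x ℕ.+ 2 ℕ.* m            ≡⟨ ≡.cong (ℕ._+ 2 ℕ.* m) eq ⟩
  rG ℕ.+ 2 ℕ.* n ℕ.+ 2 ℕ.* m            ≡⟨ lem₃ rG n m ⟩
  rG ℕ.+ 2 ℕ.* m ℕ.+ 2 ℕ.* n            ∎)
  where
  open ℕ.≤-Reasoning
  lem₁ : ∀ r y n → r ℕ.+ 2 ℕ.* y ℕ.+ 2 ℕ.+ 2 ℕ.* n ≡ r ℕ.+ 2 ℕ.* (suc y ℕ.+ n)
  lem₁ = solve-∀
  lem₂ : ∀ r x m → r ℕ.+ 2 ℕ.* (x ℕ.+ m) ≡ r ℕ.+ 2 ℕ.* x ℕ.+ 2 ℕ.* m
  lem₂ = solve-∀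
  lem₃ : ∀ r n m → r ℕ.+ 2 ℕ.* n ℕ.+ 2 ℕ.* m ≡ r ℕ.+ 2 ℕ.* m ℕ.+ 2 ℕ.* n
  lem₃ = solve-∀

-- The loss from `G` to Φ is at least 2θ' + 2 and the loss on the subgraph at most 2θ'. Subtracting
-- eliminates θ'.
rank-difference : ∀ {rΦ rG rS rSᵠ y m} → rΦ ℕ.+ 2 ℕ.* y ℕ.+ 2 ℕ.≤ rG ℕ.+ 2 ℕ.* m →
  rS ℕ.+ 2 ℕ.* m ℕ.≤ rSᵠ ℕ.+ 2 ℕ.* y → rΦ ℕ.+ rS ℕ.+ 2 ℕ.≤ rG ℕ.+ rSᵠ
rank-difference {rΦ} {rG} {rS} {rSᵠ} {y} {m} gap lower = ℕ.+-cancelʳ-≤ (2 ℕ.* y ℕ.+ 2 ℕ.* m) _ _ (begin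
  rΦ ℕ.+ rS ℕ.+ 2 ℕ.+ (2 ℕ.* y ℕ.+ 2 ℕ.* m)          ≡⟨ lem₁ rΦ rS y m ⟩
  rΦ ℕ.+ 2 ℕ.* y ℕ.+ 2 ℕ.+ (rS ℕ.+ 2 ℕ.* m)          ≤⟨ ℕ.+-mono-≤ gap lower ⟩
  rG ℕ.+ 2 ℕ.* m ℕ.+ (rSᵠ ℕ.+ 2 ℕ.* y)               ≡⟨ lem₂ rG rSᵠ y m ⟩
  rG ℕ.+ rSᵠ ℕ.+ (2 ℕ.* y ℕ.+ 2 ℕ.* m)               ∎)
  where
  open ℕ.≤-Reasoning
  lem₁ : ∀ a b y m → a ℕ.+ b ℕ.+ 2 ℕ.+ (2 ℕ.* y ℕ.+ 2 ℕ.* m) ≡ a ℕ.+ 2 ℕ.* y ℕ.+ 2 ℕ.+ (b ℕ.+ 2 ℕ.* m)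
  lem₁ = solve-∀
  lem₂ : ∀ a b y m → a ℕ.+ 2 ℕ.* m ℕ.+ (b ℕ.+ 2 ℕ.* y) ≡ a ℕ.+ b ℕ.+ (2 ℕ.* y ℕ.+ 2 ℕ.* m)
  lem₂ = solve-∀

-- The `1` is the column of the loop: 2θ' + 1 columns are one too few for a loss of 2θ' + 2.
odd-contradiction : ∀ {rΦ rG y m k k′} h → rΦ ℕ.+ 2 ℕ.* y ℕ.+ 2 ℕ.≤ rG ℕ.+ 2 ℕ.* m → rG ≡ h ℕ.+ k → h ℕ.+ k′ ℕ.≤ rΦ →
  ¬ k ℕ.+ 2 ℕ.* m ℕ.≤ k′ ℕ.+ 1 ℕ.+ 2 ℕ.* y
odd-contradiction {rΦ} {rG} {y} {m} {k} {k′} h gap ≡.refl le bound = ℕ.<-irrefl ≡.refl (begin-strict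
  h ℕ.+ k ℕ.+ 2 ℕ.* m              ≡⟨ ℕ.+-assoc h k (2 ℕ.* m) ⟩
  h ℕ.+ (k ℕ.+ 2 ℕ.* m)            ≤⟨ ℕ.+-monoʳ-≤ h bound ⟩
  h ℕ.+ (k′ ℕ.+ 1 ℕ.+ 2 ℕ.* y)     ≡⟨ lem h k′ y ⟩
  suc (h ℕ.+ k′ ℕ.+ 2 ℕ.* y)       ≤⟨ s≤s (ℕ.+-monoˡ-≤ (2 ℕ.* y) le) ⟩
  suc (rΦ ℕ.+ 2 ℕ.* y)             <⟨ ℕ.≤-reflexive (ℕ.+-comm 2 (rΦ ℕ.+ 2 ℕ.* y)) ⟩
  rΦ ℕ.+ 2 ℕ.* y ℕ.+ 2             ≤⟨ gap ⟩
  h ℕ.+ k ℕ.+ 2 ℕ.* m              ∎)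
  where
  open ℕ.≤-Reasoning
  lem : ∀ h k y → h ℕ.+ (k ℕ.+ 1 ℕ.+ 2 ℕ.* y) ≡ suc (h ℕ.+ k ℕ.+ 2 ℕ.* y)
  lem = solve-∀

-- Once r(Φ) = m + a and r(G) = m + 2 + b, the gap of 2 is used up by the 2 in r(G), and what
-- remains is the reverse of the lower bound.
gap-to-equality : ∀ {a b b′ y n m} → b ≡ b′ → m ℕ.+ a ℕ.+ 2 ℕ.* y ℕ.+ 2 ℕ.≤ m ℕ.+ (2 ℕ.+ b) ℕ.+ 2 ℕ.* n →
  b′ ℕ.+ 2 ℕ.* n ℕ.≤ a ℕ.+ 2 ℕ.* y → a ℕ.+ 2 ℕ.* y ≡ b′ ℕ.+ 2 ℕ.* n
gap-to-equality {a} {b} {_} {y} {n} {m} ≡.refl gap lower = ℕ.≤-antisym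
  (ℕ.+-cancelˡ-≤ (m ℕ.+ 2) _ _ (ℕ.≤-trans (ℕ.≤-reflexive (lem₁ m a (2 ℕ.* y))) (ℕ.≤-trans gap (ℕ.≤-reflexive (lem₂ m b (2 ℕ.* n)))))) lower
  where
  lem₁ : ∀ m a y → m ℕ.+ 2 ℕ.+ (a ℕ.+ y) ≡ m ℕ.+ a ℕ.+ y ℕ.+ 2
  lem₁ = solve-∀
  lem₂ : ∀ m b n → m ℕ.+ (2 ℕ.+ b) ℕ.+ n ≡ m ℕ.+ 2 ℕ.+ (b ℕ.+ n)
  lem₂ = solve-∀

shifted-≤ : ∀ {rΦ rG a b f x} h → rΦ ≡ h ℕ.+ a → rG ≡ h ℕ.+ (2 ℕ.+ f) → rΦ ℕ.+ b ℕ.+ 2 ℕ.≤ rG ℕ.+ x →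
  a ℕ.+ b ℕ.≤ f ℕ.+ x
shifted-≤ {a = a} {b} {f} {x} h ≡.refl ≡.refl le = ℕ.+-cancelˡ-≤ (h ℕ.+ 2) _ _
  (≡.subst₂ ℕ._≤_ (lem₁ h a b) (lem₂ h f x) le)
  where
  lem₁ : ∀ h a b → h ℕ.+ a ℕ.+ b ℕ.+ 2 ≡ h ℕ.+ 2 ℕ.+ (a ℕ.+ b)
  lem₁ = solve-∀
  lem₂ : ∀ h f x → h ℕ.+ (2 ℕ.+ f) ℕ.+ x ≡ h ℕ.+ 2 ℕ.+ (f ℕ.+ x)
  lem₂ = solve-∀

no-gap : ∀ {rΦ rG a b} h → rΦ ≡ h ℕ.+ a → rG ℕ.≤ h ℕ.+ b → ¬ rΦ ℕ.+ b ℕ.+ 2 ℕ.≤ rG ℕ.+ a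
no-gap {rG = rG} {a} {b} h ≡.refl rG≤ le = ℕ.<-irrefl ≡.refl (begin-strict
  rG ℕ.+ a               ≤⟨ ℕ.+-monoˡ-≤ a rG≤ ⟩
  h ℕ.+ b ℕ.+ a          <⟨ ℕ.n<1+n _ ⟩
  suc (h ℕ.+ b ℕ.+ a)    ≤⟨ ℕ.n≤1+n _ ⟩
  2 ℕ.+ (h ℕ.+ b ℕ.+ a)  ≡⟨ lem h a b ⟩
  h ℕ.+ a ℕ.+ b ℕ.+ 2    ≤⟨ le ⟩
  rG ℕ.+ a               ∎)
  where
  open ℕ.≤-Reasoning
  lem : ∀ h a b → 2 ℕ.+ (h ℕ.+ b ℕ.+ a) ≡ h ℕ.+ a ℕ.+ b ℕ.+ 2
  lem = solve-∀

minus-two : ∀ {x p h f} → x ≡ h ℕ.+ f → p ≡ 2 ℕ.+ h → + x ≡ + p ℤ.- + 2 ℤ.+ + f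
minus-two {h = h} {f} ≡.refl ≡.refl = lem (+ h) (+ f)
  where
  lem : ∀ h f → h ℤ.+ f ≡ + 2 ℤ.+ h ℤ.- + 2 ℤ.+ f
  lem = ℤSolver.solve-∀

[2+2t]%4≡2 : ∀ {p t} a → p ≡ 2 ℕ.+ t ℕ.* 2 → t ≡ a ℕ.* 2 → p % 4 ≡ 2
[2+2t]%4≡2 a ≡.refl ≡.refl = ≡.trans (≡.cong (λ x → (2 ℕ.+ x) % 4) (ℕ.*-assoc a 2 2)) ([m+kn]%n≡m%n 2 a 4)

halve : ∀ q → ∃ λ s → q ≡ s ℕ.* 2 ℕ.+ 0 ⊎ q ≡ s ℕ.* 2 ℕ.+ 1
halve zero = 0 , inj₁ ≡.refl
halve (suc zero) = 0 , inj₂ ≡.refl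
halve (suc (suc q)) with halve q
... | s , inj₁ ≡.refl = suc s , inj₁ ≡.refl
... | s , inj₂ ≡.refl = suc s , inj₂ ≡.refl

-- Links the integer equation with θ expanded to the form in ℕ on which the whole argument runs.
extremal-⇔ : ∀ (a b e n w : ℕ) → + a ≡ + b ℤ.- + 2 ℤ.* (+ e ℤ.- + n ℤ.+ + w) ⇔ a ℕ.+ 2 ℕ.* (e ℕ.+ w) ≡ b ℕ.+ 2 ℕ.* n
extremal-⇔ a b e n w = mk⇔
  (λ eq → ℤ.+-injective (begin
    + (a ℕ.+ 2 ℕ.* (e ℕ.+ w))                                       ≡⟨ cast a (e ℕ.+ w) ⟩
    + a ℤ.+ + 2 ℤ.* (+ e ℤ.+ + w)                                   ≡⟨ ≡.cong (ℤ._+ + 2 ℤ.* (+ e ℤ.+ + w)) eq ⟩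
    + b ℤ.- + 2 ℤ.* (+ e ℤ.- + n ℤ.+ + w) ℤ.+ + 2 ℤ.* (+ e ℤ.+ + w) ≡⟨ lem₁ (+ b) (+ e) (+ n) (+ w) ⟩
    + b ℤ.+ + 2 ℤ.* + n                                             ≡⟨ cast b n ⟨
    + (b ℕ.+ 2 ℕ.* n)                                               ∎))
  (λ eq → begin
    + a                                                              ≡⟨ lem₂ (+ a) (+ e) (+ w) ⟩
    + a ℤ.+ + 2 ℤ.* (+ e ℤ.+ + w) ℤ.- + 2 ℤ.* (+ e ℤ.+ + w)          ≡⟨ ≡.cong (ℤ._- + 2 ℤ.* (+ e ℤ.+ + w)) (≡.trans (≡.sym (cast a (e ℕ.+ w))) (≡.trans (≡.cong +_ eq) (cast b n))) ⟩
    + b ℤ.+ + 2 ℤ.* + n ℤ.- + 2 ℤ.* (+ e ℤ.+ + w)                    ≡⟨ lem₃ (+ b) (+ e) (+ n) (+ w) ⟩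
    + b ℤ.- + 2 ℤ.* (+ e ℤ.- + n ℤ.+ + w)                            ∎)
  where
  open ≡.≡-Reasoning
  cast : ∀ a m → + (a ℕ.+ 2 ℕ.* m) ≡ + a ℤ.+ + 2 ℤ.* + m
  cast a m = ≡.cong (λ i → + a ℤ.+ i) (ℤ.pos-* 2 m)
  lem₁ : ∀ b e n w → b ℤ.- + 2 ℤ.* (e ℤ.- n ℤ.+ w) ℤ.+ + 2 ℤ.* (e ℤ.+ w) ≡ b ℤ.+ + 2 ℤ.* n
  lem₁ = ℤSolver.solve-∀
  lem₂ : ∀ a e w → a ≡ a ℤ.+ + 2 ℤ.* (e ℤ.+ w) ℤ.- + 2 ℤ.* (e ℤ.+ w)
  lem₂ = ℤSolver.solve-∀
  lem₃ : ∀ b e n w → b ℤ.+ + 2 ℤ.* n ℤ.- + 2 ℤ.* (e ℤ.+ w) ≡ b ℤ.- + 2 ℤ.* (e ℤ.- n ℤ.+ w)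
  lem₃ = ℤSolver.solve-∀

-- Column rank over an integral domain, with rows and columns indexed by arbitrary types

module OverDomain (em : ExcludedMiddle 0ℓ) (D : IntegralDomain) where
  open IntegralDomain D hiding (zero)
  open IntegerCoefficientSolver commutativeRing
  open Classical em using (ω)
  open Components em
  open import Algebra.Properties.Semiring.Sum semiring using (sum; sum-cong-≋; sum-remove; sum-replicate-zero)
  open import Algebra.Definitions.RawSemiring (Semiring.rawSemiring semiring) using (_^_; product)
  open import Relation.Binary.Reasoning.Setoid setoid

  private variable
    I J I′ J′ : Set

  record Independent {I J : Set} {k : ℕ} (A : I → J → Carrier) (f : Fin k → J) : Set where
    constructor independent
    field
      trivial : ∀ (c : Fin k → Carrier) → (∀ i → sum (λ j → c j * A i (f j)) ≈ 0#) → ∀ j → c j ≈ 0#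

  open Independent public

  infix 4 _⊒_

  -- "Rank at least k", meaningful for any row and column types.
  _⊒_ : (I → J → Carrier) → ℕ → Set
  A ⊒ k = ∃ λ (f : Fin k → _) → Independent A f

  *-≉0 : ∀ {x y} → ¬ x ≈ 0# → ¬ y ≈ 0# → ¬ x * y ≈ 0#
  *-≉0 x≉0 y≉0 xy≈0 = y≉0 (cancel xy≈0 x≉0)

  unit≉0 : ∀ {x y} → x * y ≈ 1# → ¬ x ≈ 0#
  unit≉0 xy≈1 x≈0 = 1≉0 (trans (sym xy≈1) (trans (*-congʳ x≈0) (zeroˡ _)))

  sum-zero : ∀ (c v : Fin k → Carrier) → (∀ j → c j ≈ 0#) → sum (λ j → c j * v j) ≈ 0#
  sum-zero {k} c v c≈0 = trans (sum-cong-≋ λ j → trans (*-congʳ (c≈0 j)) (zeroˡ (v j))) (sum-replicate-zero k)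

  sum-linear : ∀ p q (c d v : Fin k → Carrier) →
    sum (λ j → (p * c j + q * d j) * v j) ≈ p * sum (λ j → c j * v j) + q * sum (λ j → d j * v j)
  sum-linear {zero} p q c d v = solve 2 (λ p q → :0 := p :* :0 :+ q :* :0) refl p q
  sum-linear {suc k} p q c d v = trans
    (+-congˡ (sum-linear p q (c ∘ suc) (d ∘ suc) (v ∘ suc)))
    (solve 7 (λ p q c d v s t → (p :* c :+ q :* d) :* v :+ (p :* s :+ q :* t) := p :* (c :* v :+ s) :+ q :* (d :* v :+ t))
      refl p q (c zero) (d zero) (v zero) _ _)

  sum-scale : ∀ p (c v : Fin k → Carrier) → sum (λ j → (p * c j) * v j) ≈ p * sum (λ j → c j * v j)
  sum-scale {zero} p c v = sym (zeroʳ p)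
  sum-scale {suc k} p c v = trans
    (+-congˡ (sum-scale p (c ∘ suc) (v ∘ suc)))
    (solve 4 (λ p c v s → (p :* c) :* v :+ p :* s := p :* (c :* v :+ s)) refl p (c zero) (v zero) _)

  sum-insert-zero : ∀ (c : Fin k → Carrier) j (v : Fin (suc k) → Carrier) →
    sum (λ l → insertAt c j 0# l * v l) ≈ sum (λ l → c l * v (punchIn j l))
  sum-insert-zero c j v = begin
    sum (λ l → insertAt c j 0# l * v l)
      ≈⟨ sum-remove {i = j} (λ l → insertAt c j 0# l * v l) ⟩
    insertAt c j 0# j * v j + sum (λ l → insertAt c j 0# (punchIn j l) * v (punchIn j l))
      ≈⟨ +-cong (*-congʳ (reflexive (Vector.insertAt-lookup c j 0#)))
                (sum-cong-≋ λ l → *-congʳ (reflexive (Vector.insertAt-punchIn c j 0# l))) ⟩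
    0# * v j + sum (λ l → c l * v (punchIn j l))
      ≈⟨ trans (+-congʳ (zeroˡ _)) (+-identityˡ _) ⟩
    sum (λ l → c l * v (punchIn j l)) ∎

  -- Up to the column factors y, each row of `A` is a multiple of a row of `B`. A relation c among
  -- the columns of `B` therefore gives the relation `y j * c j` among those of `A`.
  Independent-transfer : {A : I → J → Carrier} {B : I′ → J′ → Carrier} {f : Fin k → J} {g : Fin k → J′}
    (φ : I → I′) (x : I → Carrier) (y : Fin k → Carrier) → (∀ j → ¬ y j ≈ 0#) →
    (∀ i j → A i (f j) * y j ≈ x i * B (φ i) (g j)) → Independent A f → Independent B g
  Independent-transfer {A = A} {B} {f} {g} φ x y y≉0 eq ind = independent λ c rel j →
    cancel (trivial ind (λ j → y j * c j) (rel′ c rel) j) (y≉0 j)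
    where
    rel′ : ∀ c → (∀ i → sum (λ j → c j * B i (g j)) ≈ 0#) → ∀ i → sum (λ j → (y j * c j) * A i (f j)) ≈ 0#
    rel′ c rel i = begin
      sum (λ j → (y j * c j) * A i (f j))
        ≈⟨ sum-cong-≋ (λ j → trans
             (solve 3 (λ y c a → (y :* c) :* a := c :* (a :* y)) refl (y j) (c j) (A i (f j)))
             (trans (*-congˡ (eq i j))
             (solve 3 (λ x c b → c :* (x :* b) := (x :* c) :* b) refl (x i) (c j) (B (φ i) (g j))))) ⟩
      sum (λ j → (x i * c j) * B (φ i) (g j))  ≈⟨ sum-scale (x i) c (λ j → B (φ i) (g j)) ⟩
      x i * sum (λ j → c j * B (φ i) (g j))    ≈⟨ *-congˡ (rel (φ i)) ⟩
      x i * 0#                                 ≈⟨ zeroʳ _ ⟩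
      0#                                       ∎

  Independent-reindex : {A : I → J → Carrier} {B : I′ → J′ → Carrier} {f : Fin k → J} {g : Fin k → J′}
    (φ : I → I′) → (∀ i j → A i (f j) ≈ B (φ i) (g j)) → Independent A f → Independent B g
  Independent-reindex φ eq = Independent-transfer φ (λ _ → 1#) (λ _ → 1#) (λ _ → 1≉0)
    λ i j → trans (*-identityʳ _) (trans (eq i j) (sym (*-identityˡ _)))

  ⊒-reindex : {A : I → J → Carrier} {B : I′ → J′ → Carrier} (φ : I → I′) (ψ : J → J′) →
    (∀ i j → A i j ≈ B (φ i) (ψ j)) → A ⊒ k → B ⊒ k
  ⊒-reindex φ ψ eq (f , ind) = ψ ∘ f , Independent-reindex φ (λ i j → eq i (f j)) ind

  Independent-punchIn : {A : I → J → Carrier} {f : Fin (suc k) → J} →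
    Independent A f → ∀ j → Independent A (f ∘ punchIn j)
  Independent-punchIn {A = A} {f} ind j = independent λ c rel l → trans
    (reflexive (≡.sym (Vector.insertAt-punchIn c j 0# l)))
    (trivial ind (insertAt c j 0#) (λ i → trans (sum-insert-zero c j (λ l → A i (f l))) (rel i)) (punchIn j l))

  δ : Fin k → Fin k → Carrier
  δ i j = if does (i Fin.≟ j) then 1# else 0#

  δ-refl : (i : Fin k) → δ i i ≡ 1#
  δ-refl i rewrite dec-true (i Fin.≟ i) ≡.refl = ≡.refl

  δ-≢ : {i j : Fin k} → i ≢ j → δ i j ≡ 0#
  δ-≢ {i = i} {j} i≢j rewrite dec-false (i Fin.≟ j) i≢j = ≡.refl

  sum-δ : ∀ (i : Fin k) (v : Fin k → Carrier) → sum (λ j → δ i j * v j) ≈ v i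
  sum-δ {suc k} i v = begin
    sum (λ j → δ i j * v j)
      ≈⟨ sum-remove {i = i} (λ j → δ i j * v j) ⟩
    δ i i * v i + sum (λ j → δ i (punchIn i j) * v (punchIn i j))
      ≈⟨ +-cong (trans (*-congʳ (reflexive (δ-refl i))) (*-identityˡ _))
                (sum-zero (δ i ∘ punchIn i) (v ∘ punchIn i) λ j → reflexive (δ-≢ (Fin.punchInᵢ≢i i j ∘ ≡.sym))) ⟩
    v i + 0#
      ≈⟨ +-identityʳ _ ⟩
    v i ∎

  Independent⇒nonzero : {A : I → J → Carrier} {f : Fin k → J} →
    Independent A f → ∀ j → ¬ (∀ i → A i (f j) ≈ 0#)
  Independent⇒nonzero {A = A} {f} ind j A≈0 = 1≉0 (trans (reflexive (≡.sym (δ-refl j)))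
    (trivial ind (δ j) (λ i → trans (sum-δ j (λ l → A i (f l))) (A≈0 i)) j))

  Independent⇒injective : {A : I → J → Carrier} {f : Fin k → J} →
    Independent A f → ∀ {a b} → f a ≡ f b → a ≡ b
  Independent⇒injective {A = A} {f} ind {a} {b} fa≡fb with a Fin.≟ b
  ... | yes a≡b = a≡b
  ... | no a≢b = contradiction
    (trans (sym (trans (+-cong (trans (*-identityˡ _) (reflexive (δ-refl a)))
                               (trans (*-congˡ (reflexive (δ-≢ (a≢b ∘ ≡.sym)))) (zeroʳ _)))
                       (+-identityʳ _)))
      (trivial ind (λ j → 1# * δ a j + - 1# * δ b j) rel a)) 1≉0
    where
    -- For equal columns, the difference of the unit vectors at a and b is a relation, with
    -- coefficient 1 at a.
    rel : ∀ i → sum (λ j → (1# * δ a j + - 1# * δ b j) * A i (f j)) ≈ 0#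
    rel i = begin
      sum (λ j → (1# * δ a j + - 1# * δ b j) * A i (f j))
        ≈⟨ sum-linear 1# (- 1#) (δ a) (δ b) (λ j → A i (f j)) ⟩
      1# * sum (λ j → δ a j * A i (f j)) + - 1# * sum (λ j → δ b j * A i (f j))
        ≈⟨ +-cong (*-congˡ (sum-δ a (λ j → A i (f j)))) (*-congˡ (sum-δ b (λ j → A i (f j)))) ⟩
      1# * A i (f a) + - 1# * A i (f b)
        ≡⟨ ≡.cong (λ c → 1# * A i c + - 1# * A i (f b)) fa≡fb ⟩
      1# * A i (f b) + - 1# * A i (f b)
        ≈⟨ solve 1 (λ x → :1 :* x :+ :- :1 :* x := :0) refl _ ⟩
      0# ∎

  -- Steinitz exchange. If `l ◂ f` is independent, any other column may be dropped. Otherwise some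
  -- relation involves a column of `f`, because column l alone is nonzero, and that column is
  -- dropped.
  exchange : {A : I → J → Carrier} {f : Fin (suc k) → J} → Independent A f →
    ∀ i l → ¬ A i l ≈ 0# → ∃ λ j → Independent A (l ◂ f ∘ punchIn j)
  exchange {k = k} {A} {f} ind i₀ l A≉0 with em {Independent A (l ◂ f)}
  ... | yes ind′ = zero , Independent-reindex id
          (λ { i zero → refl ; i (suc j) → refl }) (Independent-punchIn ind′ (suc zero))
  ... | no dep with em {∃ λ (d : Fin (2 ℕ.+ k) → Carrier) →
                        (∀ i → sum (λ j → d j * A i ((l ◂ f) j)) ≈ 0#) × ∃ λ j → ¬ d (suc j) ≈ 0#}
  ...   | no none = contradiction dep′ dep
    where
    dep′ : Independent A (l ◂ f)
    dep′ = independent λ d rel → λ { zero → d₀≈0 d rel ; (suc j) → rest d rel j }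
      where
      module _ (d : Fin (2 ℕ.+ k) → Carrier) (rel : ∀ i → sum (λ j → d j * A i ((l ◂ f) j)) ≈ 0#) where
        rest : ∀ j → d (suc j) ≈ 0#
        rest j with em {d (suc j) ≈ 0#}
        ... | yes eq = eq
        ... | no neq = contradiction (d , rel , j , neq) none
        d₀≈0 : d zero ≈ 0#
        d₀≈0 = cancel (begin
          A i₀ l * d zero                                         ≈⟨ *-comm _ _ ⟩
          d zero * A i₀ l                                         ≈⟨ +-identityʳ _ ⟨
          d zero * A i₀ l + 0#                                    ≈⟨ +-congˡ (sum-zero (d ∘ suc) (λ j → A i₀ (f j)) rest) ⟨
          d zero * A i₀ l + sum (λ j → d (suc j) * A i₀ (f j))    ≈⟨ rel i₀ ⟩
          0#                                                      ∎) A≉0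
  ...   | yes (d , rel , j₀ , d≉0) = j₀ , independent λ c relc → λ { zero → c₀≈0 c relc ; (suc j) → rest c relc j }
    where
    module _ (c : Fin (suc k) → Carrier)
             (relc : ∀ i → sum (λ j → c j * A i ((l ◂ f ∘ punchIn j₀) j)) ≈ 0#) where
      -- Scaling d by `c zero` and c by `- d zero` and adding cancels column l. The result is a
      -- relation among the columns `f` with coefficient `c zero * d (suc j₀)` at j₀.
      c′ : Fin (suc k) → Carrier
      c′ = insertAt (c ∘ suc) j₀ 0#
      c₀≈0 : c zero ≈ 0#
      c₀≈0 = cancel (begin
        d (suc j₀) * c zero
          ≈⟨ solve 3 (λ d e c → d :* c := c :* d :+ e :* :0) refl (d (suc j₀)) (- d zero) (c zero) ⟩
        c zero * d (suc j₀) + - d zero * 0#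
          ≈⟨ +-congˡ (*-congˡ (reflexive (Vector.insertAt-lookup (c ∘ suc) j₀ 0#))) ⟨
        c zero * d (suc j₀) + - d zero * c′ j₀
          ≈⟨ trivial ind (λ j → c zero * d (suc j) + - d zero * c′ j) combined j₀ ⟩
        0# ∎) d≉0
        where
        combined : ∀ i → sum (λ j → (c zero * d (suc j) + - d zero * c′ j) * A i (f j)) ≈ 0#
        combined i = begin
          sum (λ j → (c zero * d (suc j) + - d zero * c′ j) * A i (f j))
            ≈⟨ sum-linear (c zero) (- d zero) (d ∘ suc) c′ (λ j → A i (f j)) ⟩
          c zero * s + - d zero * sum (λ j → c′ j * A i (f j))
            ≈⟨ +-congˡ (*-congˡ (sum-insert-zero (c ∘ suc) j₀ (λ j → A i (f j)))) ⟩
          c zero * s + - d zero * t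
            ≈⟨ solve 5 (λ c d a s t → c :* s :+ :- d :* t := c :* (d :* a :+ s) :+ :- d :* (c :* a :+ t)) refl
                 (c zero) (d zero) (A i l) s t ⟩
          c zero * (d zero * A i l + s) + - d zero * (c zero * A i l + t)
            ≈⟨ +-cong (*-congˡ (rel i)) (*-congˡ (relc i)) ⟩
          c zero * 0# + - d zero * 0#
            ≈⟨ trans (+-cong (zeroʳ _) (zeroʳ _)) (+-identityʳ _) ⟩
          0# ∎
          where
          s = sum (λ j → d (suc j) * A i (f j))
          t = sum (λ j → c (suc j) * A i (f (punchIn j₀ j)))
      rest : ∀ j → c (suc j) ≈ 0#
      rest = trivial (Independent-punchIn ind j₀) (c ∘ suc) λ i → begin
        sum (λ j → c (suc j) * A i (f (punchIn j₀ j)))                      ≈⟨ +-identityˡ _ ⟨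
        0# + sum (λ j → c (suc j) * A i (f (punchIn j₀ j)))                 ≈⟨ +-congʳ (trans (*-congʳ c₀≈0) (zeroˡ _)) ⟨
        c zero * A i l + sum (λ j → c (suc j) * A i (f (punchIn j₀ j)))     ≈⟨ relc i ⟩
        0#                                                                  ∎

  -- S is κ⁻¹ times the Schur complement of the pivot M nothing nothing, stated without division.
  IsSchur : Carrier → (Maybe I → Maybe J → Carrier) → (I → J → Carrier) → Set
  IsSchur κ M S = ∀ i j →
    κ * S i j + M (just i) nothing * M nothing (just j) ≈ M nothing nothing * M (just i) (just j)

  module _ {κ : Carrier} {M : Maybe I → Maybe J → Carrier} {S : I → J → Carrier}
           (schur : IsSchur κ M S) (κ≉0 : ¬ κ ≈ 0#) (a≉0 : ¬ M nothing nothing ≈ 0#) where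
    private a = M nothing nothing

    -- The identity defining `IsSchur` is linear in the column, so it extends to combinations.
    sum-schur : ∀ (f : Fin k → J) (c : Fin k → Carrier) i →
      κ * sum (λ j → c j * S i (f j)) + M (just i) nothing * sum (λ j → c j * M nothing (just (f j)))
      ≈ a * sum (λ j → c j * M (just i) (just (f j)))
    sum-schur {k = zero} f c i = solve 3 (λ κ m a → κ :* :0 :+ m :* :0 := a :* :0) refl κ (M (just i) nothing) a
    sum-schur {k = suc k} f c i = begin
      κ * (c zero * S i j + s) + m * (c zero * y + t)
        ≈⟨ solve 7 (λ κ c S s m y t → κ :* (c :* S :+ s) :+ m :* (c :* y :+ t)
             := c :* (κ :* S :+ m :* y) :+ (κ :* s :+ m :* t)) refl κ (c zero) (S i j) s m y t ⟩
      c zero * (κ * S i j + m * y) + (κ * s + m * t)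
        ≈⟨ +-cong (*-congˡ (schur i j)) (sum-schur (f ∘ suc) (c ∘ suc) i) ⟩
      c zero * (a * M (just i) (just j)) + a * x
        ≈⟨ solve 4 (λ c a m x → c :* (a :* m) :+ a :* x := a :* (c :* m :+ x)) refl (c zero) a (M (just i) (just j)) x ⟩
      a * (c zero * M (just i) (just j) + x) ∎
      where
      j = f zero
      m = M (just i) nothing
      y = M nothing (just j)
      s = sum (λ l → c (suc l) * S i (f (suc l)))
      t = sum (λ l → c (suc l) * M nothing (just (f (suc l))))
      x = sum (λ l → c (suc l) * M (just i) (just (f (suc l))))

    -- The pivot column is added to the family. The pivot row expresses its coefficient by the
    -- others, and substituting this in the remaining rows yields κ times a relation in `S`.
    schur-⊒⁻¹ : S ⊒ k → M ⊒ suc k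
    schur-⊒⁻¹ {k = k} (f , ind) = nothing ◂ just ∘ f , independent λ c rel → λ { zero → c₀≈0 c rel ; (suc j) → rest c rel j }
      where
      module _ (c : Fin (suc k) → Carrier)
               (rel : ∀ i → sum (λ j → c j * M i ((nothing ◂ just ∘ f) j)) ≈ 0#) where
        y = sum (λ j → c (suc j) * M nothing (just (f j)))
        rest : ∀ j → c (suc j) ≈ 0#
        rest = trivial ind (c ∘ suc) λ i →
          let s = sum (λ j → c (suc j) * S i (f j))
              x = sum (λ j → c (suc j) * M (just i) (just (f j)))
              m = M (just i) nothing
          in cancel (begin
            κ * s
              ≈⟨ solve 3 (λ κs m y → κs := (κs :+ m :* y) :+ :- (m :* y)) refl (κ * s) m y ⟩
            (κ * s + m * y) + - (m * y)
              ≈⟨ +-congʳ (sum-schur f (c ∘ suc) i) ⟩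
            a * x + - (m * y)
              ≈⟨ solve 5 (λ a x m y c → a :* x :+ :- (m :* y) := a :* (c :* m :+ x) :+ :- (m :* (c :* a :+ y))) refl a x m y (c zero) ⟩
            a * (c zero * m + x) + - (m * (c zero * a + y))
              ≈⟨ +-cong (*-congˡ (rel (just i))) (-‿cong (*-congˡ (rel nothing))) ⟩
            a * 0# + - (m * 0#)
              ≈⟨ solve 2 (λ a m → a :* :0 :+ :- (m :* :0) := :0) refl a m ⟩
            0# ∎) κ≉0
        c₀≈0 : c zero ≈ 0#
        c₀≈0 = cancel (begin
          a * c zero          ≈⟨ *-comm _ _ ⟩
          c zero * a          ≈⟨ +-identityʳ _ ⟨
          c zero * a + 0#     ≈⟨ +-congˡ (sum-zero (c ∘ suc) (λ j → M nothing (just (f j))) rest) ⟨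
          c zero * a + y      ≈⟨ rel nothing ⟩
          0#                  ∎) a≉0

    -- A relation c in `S` extends to `M` as a * c, with -y on the pivot column: this choice cancels
    -- the pivot row, and `sum-schur` cancels the others.
    schur-Independent : {f : Fin k → J} → Independent M (nothing ◂ just ∘ f) → Independent S f
    schur-Independent {k = k} {f} ind = independent λ c rel j → cancel (trivial ind (d c rel) (relM c rel) (suc j)) a≉0
      where
      module _ (c : Fin k → Carrier) (rel : ∀ i → sum (λ j → c j * S i (f j)) ≈ 0#) where
        y : Carrier
        y = sum (λ j → c j * M nothing (just (f j)))
        d : Fin (suc k) → Carrier
        d = - y ◂ λ j → a * c j
        relM : ∀ i → sum (λ j → d j * M i ((nothing ◂ just ∘ f) j)) ≈ 0#
        relM nothing = trans (+-congˡ (sum-scale a c (λ j → M nothing (just (f j)))))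
          (solve 2 (λ a y → :- y :* a :+ a :* y := :0) refl a y)
        relM (just i) = begin
          - y * m + sum (λ j → (a * c j) * M (just i) (just (f j)))   ≈⟨ +-congˡ (sum-scale a c (λ j → M (just i) (just (f j)))) ⟩
          - y * m + a * x                                             ≈⟨ +-congˡ (sum-schur f c i) ⟨
          - y * m + (κ * s + m * y)                                   ≈⟨ solve 3 (λ y m κs → :- y :* m :+ (κs :+ m :* y) := κs) refl y m (κ * s) ⟩
          κ * s                                                       ≈⟨ *-congˡ (rel i) ⟩
          κ * 0#                                                      ≈⟨ zeroʳ κ ⟩
          0#                                                          ∎
          where
          m = M (just i) nothing
          s = sum (λ j → c j * S i (f j))
          x = sum (λ j → c j * M (just i) (just (f j)))

    schur-⊒ : M ⊒ suc k → S ⊒ k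
    -- The pivot column is nonzero at the pivot row, so it can be exchanged in; by injectivity the
    -- other columns then differ from it.
    schur-⊒ {k = k} (f , ind) with exchange ind nothing nothing a≉0
    ... | j₀ , ind′ = proj₁ ∘ isJust , schur-Independent (Independent-reindex id columns ind′)
      where
      isJust : ∀ j → ∃ λ l → f (punchIn j₀ j) ≡ just l
      isJust j = ≢nothing⇒just λ eq → Fin.0≢1+n (Independent⇒injective ind′ {zero} {suc j} (≡.sym eq))
      columns : ∀ i j → M i ((nothing ◂ f ∘ punchIn j₀) j) ≈ M i ((nothing ◂ just ∘ proj₁ ∘ isJust) j)
      columns i zero = refl
      columns i (suc j) = reflexive (≡.cong (M i) (proj₂ (isJust j)))

    schur-⇔ : M ⊒ suc k ⇔ S ⊒ k
    schur-⇔ = mk⇔ schur-⊒ schur-⊒⁻¹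

  -- Eliminating two vertices and deleting one

  swapTop : Maybe (Maybe J) → Maybe (Maybe J)
  swapTop nothing         = just nothing
  swapTop (just nothing)  = nothing
  swapTop (just (just j)) = just (just j)

  swapTop-involutive : (j : Maybe (Maybe J)) → swapTop (swapTop j) ≡ j
  swapTop-involutive nothing         = ≡.refl
  swapTop-involutive (just nothing)  = ≡.refl
  swapTop-involutive (just (just j)) = ≡.refl

  module _ {κ : Carrier} (N : Maybe (Maybe I) → Maybe (Maybe J) → Carrier) {S : I → J → Carrier} where
    private
      o : {A : Set} → Maybe (Maybe A)
      o = nothing
      t : {A : Set} → Maybe (Maybe A)
      t = just nothing
      s : {A : Set} → A → Maybe (Maybe A)
      s j = just (just j)
      a = N o t
      b = N t o

    -- The zero at (o, o) cannot be a pivot, so the first two columns are swapped: a becomes the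
    -- first pivot and a * b the second. The displayed equation says that κ S is a * b times the
    -- Schur complement of the block with rows (0, a) and (b, N t t).
    two-vertex-schur : ¬ κ ≈ 0# → ¬ a ≈ 0# → ¬ b ≈ 0# → N o o ≈ 0# →
      (∀ i j → κ * S i j + (b * (N (s i) t * N o (s j)) + a * (N (s i) o * N t (s j)))
               ≈ a * b * N (s i) (s j) + N (s i) o * (N t t * N o (s j))) →
      N ⊒ 2 ℕ.+ k ⇔ S ⊒ k
    two-vertex-schur {k = k} κ≉0 a≉0 b≉0 Noo≈0 eq = mk⇔
      (to second ∘ to first ∘ ⊒-reindex id swapTop (λ i j → reflexive (≡.cong (N i) (≡.sym (swapTop-involutive j)))))
      (⊒-reindex id swapTop (λ _ _ → refl) ∘ from first ∘ from second)
      where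
      open Equivalence
      N′ : Maybe (Maybe _) → Maybe (Maybe _) → Carrier
      N′ i j = N i (swapTop j)
      S₁ : Maybe _ → Maybe _ → Carrier
      S₁ i j = a * N′ (just i) (just j) + - (N′ (just i) nothing * N′ nothing (just j))
      first : N′ ⊒ 2 ℕ.+ k ⇔ S₁ ⊒ suc k
      first = schur-⇔ {κ = 1#} (λ i j → solve 3 (λ x y z → :1 :* (x :+ :- (y :* z)) :+ y :* z := x) refl
        (a * N′ (just i) (just j)) (N′ (just i) nothing) (N′ nothing (just j))) 1≉0 a≉0
      second : S₁ ⊒ suc k ⇔ S ⊒ k
      second = schur-⇔ {κ = a * κ} schur (*-≉0 a≉0 κ≉0) pivot≉0
        where
        pivot≉0 : ¬ S₁ nothing nothing ≈ 0#
        pivot≉0 eq = *-≉0 a≉0 b≉0 (begin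
          a * b                        ≈⟨ solve 3 (λ a b c → a :* b := a :* b :+ :- (c :* :0)) refl a b (N t t) ⟩
          a * b + - (N t t * 0#)       ≈⟨ +-congˡ (-‿cong (*-congˡ Noo≈0)) ⟨
          a * b + - (N t t * N o o)    ≈⟨ eq ⟩
          0#                           ∎)
        schur : IsSchur (a * κ) S₁ S
        schur i j = begin
          a * κ * S i j + (a * p + - (q * N o o)) * (a * r + - (c * u))
            ≈⟨ +-congˡ (*-congʳ (+-congˡ (-‿cong (*-congˡ Noo≈0)))) ⟩
          a * κ * S i j + (a * p + - (q * 0#)) * (a * r + - (c * u))
            ≈⟨ solve 9 (λ a κ S b p q r c u →
                 a :* κ :* S :+ (a :* p :+ :- (q :* :0)) :* (a :* r :+ :- (c :* u))
                 := a :* (κ :* S :+ (b :* (q :* u) :+ a :* (p :* r))) :+ :- (a :* (b :* (q :* u)) :+ a :* (p :* (c :* u))))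
                 refl a κ (S i j) b p q r c u ⟩
          a * (κ * S i j + (b * (q * u) + a * (p * r))) + - (a * (b * (q * u)) + a * (p * (c * u)))
            ≈⟨ +-congʳ (*-congˡ (eq i j)) ⟩
          a * (a * b * x + p * (c * u)) + - (a * (b * (q * u)) + a * (p * (c * u)))
            ≈⟨ solve 7 (λ a b x p c u q →
                 a :* (a :* b :* x :+ p :* (c :* u)) :+ :- (a :* (b :* (q :* u)) :+ a :* (p :* (c :* u)))
                 := (a :* b :+ :- (c :* :0)) :* (a :* x :+ :- (q :* u))) refl a b x p c u q ⟩
          (a * b + - (c * 0#)) * (a * x + - (q * u))
            ≈⟨ *-congʳ (+-congˡ (-‿cong (*-congˡ Noo≈0))) ⟨
          (a * b + - (c * N o o)) * (a * x + - (q * u)) ∎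
          where
          c = N t t
          p = N (s i) o
          q = N (s i) t
          r = N t (s j)
          u = N o (s j)
          x = N (s i) (s j)

  -- `X` attaches a pendant vertex to the vertex to be deleted, which cannot lower the rank.
  -- Eliminating the pendant vertex together with its neighbour costs exactly 2 and leaves the
  -- smaller matrix.
  ⊒-delete : {N : Maybe I → Maybe J → Carrier} → N ⊒ 2 ℕ.+ k → (λ i j → N (just i) (just j)) ⊒ k
  ⊒-delete {I} {J} {N = N} = Equivalence.to
    (two-vertex-schur {κ = 1#} X 1≉0 1≉0 1≉0 refl λ i j →
       solve 4 (λ x q r c → :1 :* x :+ (:1 :* (q :* :0) :+ :1 :* (:0 :* r))
                := :1 :* :1 :* x :+ :0 :* (c :* :0)) refl
         (N (just i) (just j)) (N (just i) nothing) (N nothing (just j)) (N nothing nothing))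
    ∘ ⊒-reindex just just (λ _ _ → refl)
    where
    unit : {A : Set} → Maybe A → Carrier
    unit nothing  = 1#
    unit (just _) = 0#
    X : Maybe (Maybe I) → Maybe (Maybe J) → Carrier
    X nothing  nothing  = 0#
    X nothing  (just j) = unit j
    X (just i) nothing  = unit i
    X (just i) (just j) = N i j

  ⊒-isolated : {N : Maybe I → Maybe J → Carrier} → (∀ i → N i nothing ≈ 0#) → (∀ j → N nothing (just j) ≈ 0#) →
    N ⊒ k → (λ i j → N (just i) (just j)) ⊒ k
  ⊒-isolated {k = k} {N = N} column row (f , ind) = proj₁ ∘ isJust , independent λ c rel → trivial ind′ c (rows c rel)
    where
    isJust : ∀ j → ∃ λ l → f j ≡ just l
    isJust j = ≢nothing⇒just λ eq →
      Independent⇒nonzero ind j λ i → trans (reflexive (≡.cong (N i) eq)) (column i)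
    ind′ : Independent N (just ∘ proj₁ ∘ isJust)
    ind′ = Independent-reindex id (λ i j → reflexive (≡.cong (N i) (proj₂ (isJust j)))) ind
    rows : ∀ c → (∀ i → sum (λ j → c j * N (just i) (just (proj₁ (isJust j)))) ≈ 0#) →
           ∀ i → sum (λ j → c j * N i (just (proj₁ (isJust j)))) ≈ 0#
    rows c rel (just i) = rel i
    rows c rel nothing = trans (sum-cong-≋ λ j → trans (*-congˡ (row (proj₁ (isJust j)))) (zeroʳ (c j))) (sum-replicate-zero k)

  -- Cycles grown out of a vertex and their contraction

  bord : (J → J → Carrier) → (J → Carrier) → (J → Carrier) → Maybe J → Maybe J → Carrier
  bord M u v nothing  nothing  = 0#
  bord M u v (just i) nothing  = u i
  bord M u v nothing  (just j) = v j
  bord M u v (just i) (just j) = M i j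

  Ext : ℕ → Set → Set
  Ext zero    I = I
  Ext (suc m) I = Maybe (Ext m I)

  prod : (ℕ → Carrier) → ℕ → Carrier
  prod w zero    = 1#
  prod w (suc m) = prod w m * w m

  prod-suc : ∀ w m → w 0 * prod (w ∘ suc) m ≈ prod w m * w m
  prod-suc w zero    = *-comm _ _
  prod-suc w (suc m) = trans (sym (*-assoc _ _ _)) (*-congʳ (prod-suc w m))

  prod-ones : ∀ w m → (∀ k → w k ≈ 1#) → prod w m ≈ 1#
  prod-ones w zero    w≈1 = refl
  prod-ones w (suc m) w≈1 = trans (*-cong (prod-ones w m w≈1) (w≈1 m)) (*-identityˡ 1#)

  product≈prod : ∀ w m → product (λ (k : Fin m) → w (toℕ k)) ≈ prod w m
  product≈prod w zero    = refl
  product≈prod w (suc m) = trans (*-congˡ (product≈prod (w ∘ suc) m)) (prod-suc w m)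

  -- A cycle through the "vertex" e of B: a path with m further vertices grows out of e (K),
  -- and its tip is joined back to e by an edge of weights z, z′ (Q).  Vectors such as e, tip and base
  -- stand for vertices through their indicator functions.
  module Cycle {I : Set} (B : I → I → Carrier) (e : I → Carrier)
    (w w′ : ℕ → Carrier) (ww′≈1 : ∀ m → w m * w′ m ≈ 1#) where

    tip base : ∀ m → Ext m I → Carrier
    tip zero    i        = e i
    tip (suc m) nothing  = 1#
    tip (suc m) (just i) = 0#
    base zero    i        = e i
    base (suc m) nothing  = 0#
    base (suc m) (just i) = base m i

    K : ∀ m → Ext m I → Ext m I → Carrier
    K zero    = B
    K (suc m) = bord (K m) (λ i → w m * tip m i) (λ i → w′ m * tip m i)

    Q : ∀ m → Carrier → Carrier → Ext m I → Ext m I → Carrier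
    Q m z z′ i j = K m i j + z * (tip m i * base m j) + z′ * (base m i * tip m j)

    -- Of the two outermost vertices, one is joined to the tip of the shorter path by `w m` and the
    -- other to the base by z. Their elimination thus only adds an edge from that tip to the base, a
    -- loop when m is 0.
    Q-step : ∀ m z z′ → Q (2 ℕ.+ m) z z′ ⊒ 2 ℕ.+ k ⇔
      Q m (- (w m * w (suc m) * z)) (- (w′ m * w′ (suc m) * z′)) ⊒ k
    Q-step m z z′ = two-vertex-schur {κ = 1#} (Q (2 ℕ.+ m) z z′) 1≉0
      (λ eq → unit≉0 (trans (*-comm a b) (ww′≈1 (suc m))) (trans
        (solve 3 (λ a z z′ → a := a :* :1 :+ z :* (:1 :* :0) :+ z′ :* (:0 :* :0)) refl a z z′) eq))
      (λ eq → unit≉0 (ww′≈1 (suc m)) (trans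
        (solve 3 (λ b z z′ → b := b :* :1 :+ z :* (:0 :* :0) :+ z′ :* (:0 :* :1)) refl b z z′) eq))
      (solve 2 (λ z z′ → :0 :+ z :* (:1 :* :0) :+ z′ :* (:0 :* :1) := :0) refl z z′)
      λ i j → trans
        -- The constants 0 and 1 are the values of `tip` and `base` at the two eliminated vertices.
        (solve 11 (λ k tᵢ tⱼ bᵢ bⱼ v v′ a b z z′ →
          :1 :* (k :+ (:- (v :* b :* z)) :* (tᵢ :* bⱼ) :+ (:- (v′ :* a :* z′)) :* (bᵢ :* tⱼ))
          :+ ((b :* :1 :+ z :* (:0 :* :0) :+ z′ :* (:0 :* :1))
              :* ((v :* tᵢ :+ z :* (:0 :* :0) :+ z′ :* (bᵢ :* :0))
                  :* (a :* :0 :+ z :* (:1 :* bⱼ) :+ z′ :* (:0 :* :0)))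
             :+ (a :* :1 :+ z :* (:1 :* :0) :+ z′ :* (:0 :* :0))
              :* ((b :* :0 :+ z :* (:0 :* :0) :+ z′ :* (bᵢ :* :1))
                  :* (v′ :* tⱼ :+ z :* (:0 :* bⱼ) :+ z′ :* (:0 :* :0))))
          := :1 :* k) refl
          (K m i j) (tip m i) (tip m j) (base m i) (base m j) (w m) (w′ m) a b z z′)
        (trans (*-congʳ (sym (ww′≈1 (suc m))))
        (solve 7 (λ k bᵢ bⱼ a b z z′ →
          b :* a :* k
          := (a :* :1 :+ z :* (:1 :* :0) :+ z′ :* (:0 :* :0)) :* (b :* :1 :+ z :* (:0 :* :0) :+ z′ :* (:0 :* :1))
               :* (k :+ z :* (:0 :* bⱼ) :+ z′ :* (bᵢ :* :0))
             :+ (b :* :0 :+ z :* (:0 :* :0) :+ z′ :* (bᵢ :* :1))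
               :* ((:0 :+ z :* (:0 :* :0) :+ z′ :* (:0 :* :0)) :* (a :* :0 :+ z :* (:1 :* bⱼ) :+ z′ :* (:0 :* :0))))
          refl (K m i j) (base m i) (base m j) a b z z′))
      where
      a = w′ (suc m)
      b = w (suc m)

    -- The weight of the closing edge after 2t vertices of a path with 2t + ε vertices are contracted.
    contract : (ℕ → Carrier) → ℕ → ℕ → Carrier → Carrier
    contract v ε zero    z = z
    contract v ε (suc t) z = contract v ε t (- (v (t ℕ.* 2 ℕ.+ ε) * v (suc (t ℕ.* 2 ℕ.+ ε)) * z))

    Q-contract : ∀ ε t z z′ → Q (t ℕ.* 2 ℕ.+ ε) z z′ ⊒ t ℕ.* 2 ℕ.+ k ⇔
      Q ε (contract w ε t z) (contract w′ ε t z′) ⊒ k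
    Q-contract ε zero    z z′ = mk⇔ id id
    Q-contract ε (suc t) z z′ = Q-contract ε t _ _ ⇔-∘ Q-step (t ℕ.* 2 ℕ.+ ε) z z′

    -- Each step moves two path weights into the closing weight and changes its sign. The first ε
    -- weights stay on the path, whence the factor on the left.
    contract-product : ∀ v ε t z → prod v ε * contract v ε t z ≈ (- 1#) ^ t * (prod v (t ℕ.* 2 ℕ.+ ε) * z)
    contract-product v ε zero z = sym (*-identityˡ _)
    contract-product v ε (suc t) z = trans (contract-product v ε t _)
      (solve 5 (λ s p x y z → s :* (p :* (:- (x :* y :* z))) := :- :1 :* s :* (p :* x :* y :* z)) refl
        ((- 1#) ^ t) (prod v m) (v m) (v (suc m)) z)
      where m = t ℕ.* 2 ℕ.+ ε

    contract-unit : ∀ ε t z z′ → z * z′ ≈ 1# → contract w ε t z * contract w′ ε t z′ ≈ 1#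
    contract-unit ε zero z z′ zz′≈1 = zz′≈1
    contract-unit ε (suc t) z z′ zz′≈1 = contract-unit ε t _ _ (begin
      - (w m * w (suc m) * z) * - (w′ m * w′ (suc m) * z′)
        ≈⟨ solve 6 (λ a b z a′ b′ z′ → :- (a :* b :* z) :* :- (a′ :* b′ :* z′) := a :* a′ :* (b :* b′) :* (z :* z′)) refl
             (w m) (w (suc m)) z (w′ m) (w′ (suc m)) z′ ⟩
      w m * w′ m * (w (suc m) * w′ (suc m)) * (z * z′)
        ≈⟨ *-cong (*-cong (ww′≈1 m) (ww′≈1 (suc m))) zz′≈1 ⟩
      1# * 1# * 1#
        ≈⟨ trans (*-congʳ (*-identityˡ _)) (*-identityˡ _) ⟩
      1# ∎)
      where m = t ℕ.* 2 ℕ.+ ε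

  module EvenCycle {I : Set} (B : Maybe I → Maybe I → Carrier) (B₀₀≈0 : B nothing nothing ≈ 0#)
    (e : Maybe I → Carrier) (e₀≈1 : e nothing ≈ 1#) (e₁≈0 : ∀ i → e (just i) ≈ 0#)
    (w w′ : ℕ → Carrier) (ww′≈1 : ∀ m → w m * w′ m ≈ 1#) where

    open Cycle B e w w′ ww′≈1 public

    private
      -- The last path edge and the closing edge now join the same two vertices, so their weights
      -- add. This sum is the ζ of the even case.
      row : ∀ y y′ j → Q 1 y y′ nothing (just j) ≈ (w′ 0 + y) * e j
      row y y′ j = solve 4 (λ v y y′ e → v :* e :+ y :* (:1 :* e) :+ y′ :* (:0 :* :0) := (v :+ y) :* e) refl (w′ 0) y y′ (e j)

      column : ∀ y y′ i → Q 1 y y′ (just i) nothing ≈ (w 0 + y′) * e i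
      column y y′ i = solve 4 (λ v y y′ e → v :* e :+ y :* (:0 :* :0) :+ y′ :* (e :* :1) := (v :+ y′) :* e) refl (w 0) y y′ (e i)

      corner : ∀ y y′ → Q 1 y y′ nothing nothing ≈ 0#
      corner = solve 2 (λ y y′ → :0 :+ y :* (:1 :* :0) :+ y′ :* (:0 :* :1) := :0) refl

      block : ∀ y y′ i j → Q 1 y y′ (just i) (just j) ≈ B i j
      block y y′ i j = solve 5 (λ b y y′ e e′ → b :+ y :* (:0 :* e) :+ y′ :* (e′ :* :0) := b) refl (B i j) y y′ (e j) (e i)

    -- The reverse weight `w 0 + y′` equals `w 0 * y′ * (w′ 0 + y)`, so it vanishes too and the
    -- extra vertex is isolated.
    Q-singular : ∀ {y y′} → y * y′ ≈ 1# → w′ 0 + y ≈ 0# → Q 1 y y′ ⊒ k ⇔ B ⊒ k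
    Q-singular {y = y} {y′} yy′≈1 ζ≈0 = mk⇔
      (⊒-reindex id id (λ i j → block y y′ i j) ∘ ⊒-isolated
        (λ { nothing → corner y y′ ; (just i) → trans (column y y′ i) (trans (*-congʳ ζ′≈0) (zeroˡ _)) })
        (λ j → trans (row y y′ j) (trans (*-congʳ ζ≈0) (zeroˡ _))))
      (⊒-reindex just just (λ i j → sym (block y y′ i j)))
      where
      ζ′≈0 : w 0 + y′ ≈ 0#
      ζ′≈0 = begin
        w 0 + y′                           ≈⟨ +-cong (*-identityʳ _) (*-identityˡ _) ⟨
        w 0 * 1# + 1# * y′                 ≈⟨ +-cong (*-congˡ yy′≈1) (*-congʳ (ww′≈1 0)) ⟨
        w 0 * (y * y′) + w 0 * w′ 0 * y′   ≈⟨ solve 4 (λ w w′ y y′ → w :* (y :* y′) :+ w :* w′ :* y′ := w :* y′ :* (w′ :+ y)) refl (w 0) (w′ 0) y y′ ⟩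
        w 0 * y′ * (w′ 0 + y)              ≈⟨ *-congˡ ζ≈0 ⟩
        w 0 * y′ * 0#                      ≈⟨ zeroʳ _ ⟩
        0#                                 ∎

    -- The extra vertex is now pendant at the base, and eliminating both leaves the rest of `B`
    -- unchanged.
    Q-regular : ∀ {y y′} → y * y′ ≈ 1# → ¬ w′ 0 + y ≈ 0# → Q 1 y y′ ⊒ 2 ℕ.+ k ⇔ (λ i j → B (just i) (just j)) ⊒ k
    Q-regular {y = y} {y′} yy′≈1 ζ≉0 = two-vertex-schur (Q 1 y y′) (*-≉0 a≉0 b≉0) a≉0 b≉0 (corner y y′) λ i j → begin
      a * b * B (just i) (just j) + (b * (N (s i) c * N o (s j)) + a * (N (s i) o * N c (s j)))
        ≈⟨ +-cong (*-congˡ (sym (block y y′ (just i) (just j))))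
                  (+-cong (*-congˡ (*-congˡ (N-row j))) (*-congˡ (*-congʳ (N-column i)))) ⟩
      a * b * N (s i) (s j) + (b * (N (s i) c * 0#) + a * (0# * N c (s j)))
        ≈⟨ solve 7 (λ a b x q r d u → a :* b :* x :+ (b :* (q :* :0) :+ a :* (:0 :* r)) := a :* b :* x :+ :0 :* (d :* u)) refl
             a b (N (s i) (s j)) (N (s i) c) (N c (s j)) (N c c) (N o (s j)) ⟩
      a * b * N (s i) (s j) + 0# * (N c c * N o (s j))
        ≈⟨ +-congˡ (*-congʳ (sym (N-column i))) ⟩
      a * b * N (s i) (s j) + N (s i) o * (N c c * N o (s j)) ∎
      where
      o : Maybe (Maybe I)
      o = nothing
      c : Maybe (Maybe I)
      c = just nothing
      N : Maybe (Maybe I) → Maybe (Maybe I) → Carrier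
      N = Q 1 y y′
      s : I → Maybe (Maybe I)
      s i = just (just i)
      a = N o c
      b = N c o
      ζ′≉0 : ¬ w 0 + y′ ≈ 0#
      ζ′≉0 ζ′≈0 = ζ≉0 (begin
        w′ 0 + y                           ≈⟨ +-cong (*-identityʳ _) (*-identityˡ _) ⟨
        w′ 0 * 1# + 1# * y                 ≈⟨ +-cong (*-congˡ yy′≈1) (*-congʳ (ww′≈1 0)) ⟨
        w′ 0 * (y * y′) + w 0 * w′ 0 * y   ≈⟨ solve 4 (λ w w′ y y′ → w′ :* (y :* y′) :+ w :* w′ :* y := w′ :* y :* (w :+ y′)) refl (w 0) (w′ 0) y y′ ⟩
        w′ 0 * y * (w 0 + y′)              ≈⟨ *-congˡ ζ′≈0 ⟩
        w′ 0 * y * 0#                      ≈⟨ zeroʳ _ ⟩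
        0#                                 ∎)
      a≉0 : ¬ a ≈ 0#
      a≉0 a≈0 = ζ≉0 (trans (sym (trans (row y y′ nothing) (trans (*-congˡ e₀≈1) (*-identityʳ _)))) a≈0)
      b≉0 : ¬ b ≈ 0#
      b≉0 b≈0 = ζ′≉0 (trans (sym (trans (column y y′ nothing) (trans (*-congˡ e₀≈1) (*-identityʳ _)))) b≈0)
      N-row : ∀ j → N o (just (just j)) ≈ 0#
      N-row j = trans (row y y′ (just j)) (trans (*-congˡ (e₁≈0 j)) (zeroʳ _))
      N-column : ∀ i → N (just (just i)) o ≈ 0#
      N-column i = trans (column y y′ (just i)) (trans (*-congˡ (e₁≈0 i)) (zeroʳ _))

  -- Switching

  Linked : ∀ {n} → List (Fin n × Fin n) → Fin n → Fin n → Set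
  Linked es a b = (a , b) List.∈ es ⊎ (b , a) List.∈ es

  Linked-sym : ∀ {n} {es : List (Fin n × Fin n)} {a b} → Linked es a b → Linked es b a
  Linked-sym (inj₁ e∈) = inj₂ e∈
  Linked-sym (inj₂ e∈) = inj₁ e∈

  -- x is a potential: `x a * A a b * x⁻¹ b` is 1 on good edges. `count` bounds the bad edges by the
  -- cyclomatic number of `es`. A separated family suffices as record of the components, since
  -- `separated⇒≤ω` bounds its size by `ω`.
  record Switching {n} (A : Fin n → Fin n → Carrier) (es : List (Fin n × Fin n)) : Set where
    field
      x x⁻¹ : Fin n → Carrier
      x-inverse : ∀ i → x i * x⁻¹ i ≈ 1#
      bad : List (Fin n × Fin n)
      components : ℕ
      representative : Fin components → Fin n
      separated : Separated (Linked es) representative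
      count : length bad ℕ.+ n ℕ.≤ length es ℕ.+ components
      good : ∀ {a b} → (a , b) List.∈ es → (a , b) List.∈ bad ⊎ x a * A a b ≈ x b

  -- A spanning forest is grown edge by edge. An edge inside a component is declared bad; an edge
  -- joining two components is made good by rescaling x on one of them, which leaves the equations
  -- inside each component intact.
  switch : ∀ {n} (A : Fin n → Fin n → Carrier) es → All (λ (a , b) → A a b * A b a ≈ 1#) es → Switching A es
  switch {n} A [] [] = record
    { x = λ _ → 1# ; x⁻¹ = λ _ → 1# ; x-inverse = λ _ → *-identityˡ 1#
    ; bad = [] ; components = n ; representative = id
    ; separated = λ { Star.ε → ≡.refl ; (inj₁ () ◅ _) ; (inj₂ () ◅ _) }
    ; count = ℕ.≤-refl
    ; good = λ () }
  switch {n} A ((a , b) ∷ es) (unit ∷ units) with em {Star (Linked es) a b}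
  ... | yes a~b = record
    { Switching S
    ; bad = (a , b) ∷ S.bad
    ; separated = λ path → S.separated (kleisliStar id old path)
    ; count = s≤s S.count
    ; good = λ { (here eq) → inj₁ (here eq) ; (there e∈) → Data.Sum.Base.map₁ there (S.good e∈) } }
    where
    S = switch A es units
    module S = Switching S
    old : ∀ {i j} → Linked ((a , b) ∷ es) i j → Star (Linked es) i j
    old (inj₁ (here ≡.refl)) = a~b
    old (inj₁ (there e∈)) = inj₁ e∈ ◅ Star.ε
    old (inj₂ (here ≡.refl)) = Star.reverse Linked-sym a~b
    old (inj₂ (there e∈)) = inj₂ e∈ ◅ Star.ε
  ... | no a≁b = record
    { x = x ; x⁻¹ = x⁻¹ ; x-inverse = x-inverse
    ; bad = S.bad
    ; components = proj₁ remaining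
    ; representative = S.representative ∘ proj₁ (proj₂ remaining)
    ; separated = separated
    ; count = ℕ.≤-trans S.count (ℕ.≤-trans (ℕ.+-monoʳ-≤ (length es) (proj₁ (proj₂ (proj₂ (proj₂ remaining)))))
                (ℕ.≤-reflexive (ℕ.+-suc (length es) (proj₁ remaining))))
    ; good = good }
    where
    S = switch A es units
    module S = Switching S
    InB : Fin n → Set
    InB i = Star (Linked es) b i
    c c⁻¹ : Carrier
    -- The factor that turns `S.x b` into `S.x a * A a b`; it is applied on the whole component of
    -- b.
    c   = S.x a * A a b * S.x⁻¹ b
    c⁻¹ = S.x⁻¹ a * A b a * S.x b
    cc⁻¹≈1 : c * c⁻¹ ≈ 1#
    cc⁻¹≈1 = begin
      c * c⁻¹
        ≈⟨ solve 6 (λ p q r s t u → (p :* q :* r) :* (s :* t :* u) := (p :* s) :* (q :* t) :* (u :* r)) refl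
             (S.x a) (A a b) (S.x⁻¹ b) (S.x⁻¹ a) (A b a) (S.x b) ⟩
      (S.x a * S.x⁻¹ a) * (A a b * A b a) * (S.x b * S.x⁻¹ b)
        ≈⟨ *-cong (*-cong (S.x-inverse a) unit) (S.x-inverse b) ⟩
      1# * 1# * 1#
        ≈⟨ trans (*-congʳ (*-identityˡ 1#)) (*-identityˡ 1#) ⟩
      1# ∎
    x x⁻¹ : Fin n → Carrier
    x i   = if does (em {InB i}) then S.x i * c else S.x i
    x⁻¹ i = if does (em {InB i}) then S.x⁻¹ i * c⁻¹ else S.x⁻¹ i
    x-inverse : ∀ i → x i * x⁻¹ i ≈ 1#
    x-inverse i with em {InB i}
    ... | no _ = S.x-inverse i
    ... | yes _ = begin
      (S.x i * c) * (S.x⁻¹ i * c⁻¹)  ≈⟨ solve 4 (λ p q r s → (p :* q) :* (r :* s) := (p :* r) :* (q :* s)) refl (S.x i) c (S.x⁻¹ i) c⁻¹ ⟩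
      (S.x i * S.x⁻¹ i) * (c * c⁻¹)  ≈⟨ *-cong (S.x-inverse i) cc⁻¹≈1 ⟩
      1# * 1#                        ≈⟨ *-identityˡ 1# ⟩
      1#                             ∎
    inside-x : ∀ {i} → InB i → x i ≡ S.x i * c
    inside-x {i} h with em {InB i}
    ... | yes _ = ≡.refl
    ... | no ¬h = contradiction h ¬h
    outside-x : ∀ {i} → ¬ InB i → x i ≡ S.x i
    outside-x {i} ¬h with em {InB i}
    ... | yes h = contradiction h ¬h
    ... | no _ = ≡.refl
    good : ∀ {i j} → (i , j) List.∈ (a , b) ∷ es → (i , j) List.∈ S.bad ⊎ x i * A i j ≈ x j
    good (here ≡.refl) = inj₂ (begin
      x a * A a b                          ≡⟨ ≡.cong (_* A a b) (outside-x λ b~a → a≁b (Star.reverse Linked-sym b~a)) ⟩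
      S.x a * A a b                        ≈⟨ *-identityʳ _ ⟨
      S.x a * A a b * 1#                   ≈⟨ *-congˡ (S.x-inverse b) ⟨
      S.x a * A a b * (S.x b * S.x⁻¹ b)    ≈⟨ solve 4 (λ p q r s → p :* q :* (r :* s) := r :* (p :* q :* s)) refl (S.x a) (A a b) (S.x b) (S.x⁻¹ b) ⟩
      S.x b * c                            ≡⟨ inside-x Star.ε ⟨
      x b                                  ∎)
    good {i} {j} (there e∈) with S.good e∈
    ... | inj₁ e∈bad = inj₁ e∈bad
    ... | inj₂ eq with em {InB i}
    ...   | yes h = inj₂ (begin
      S.x i * c * A i j    ≈⟨ solve 3 (λ p q r → p :* q :* r := p :* r :* q) refl (S.x i) c (A i j) ⟩
      S.x i * A i j * c    ≈⟨ *-congʳ eq ⟩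
      S.x j * c            ≡⟨ inside-x (h ◅◅ inj₁ e∈ ◅ Star.ε) ⟨
      x j                  ∎)
    ...   | no ¬h = inj₂ (trans eq (reflexive (≡.sym (outside-x λ h → ¬h (h ◅◅ inj₂ e∈ ◅ Star.ε)))))
    -- At most one representative lies in the component of b, by separation. Dropping it pays for
    -- the new edge in `count`, and paths between the remaining ones can be rerouted off the new
    -- edge.
    remaining : ∃ λ k → ∃ λ (ρ : Fin k → Fin S.components) → (∀ {l m} → ρ l ≡ ρ m → l ≡ m) ×
      S.components ℕ.≤ suc k × (∀ l → ¬ InB (S.representative (ρ l)))
    remaining with em {∃ λ l → InB (S.representative l)}
    ... | no none = S.components , id , id , ℕ.n≤1+n _ , λ l h → none (l , h)
    ... | yes (l , h) = drop S.components S.representative S.separated l h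
      where
      drop : ∀ k (g : Fin k → Fin n) → Separated (Linked es) g → ∀ l → InB (g l) →
        ∃ λ k′ → ∃ λ (ρ : Fin k′ → Fin k) → (∀ {l m} → ρ l ≡ ρ m → l ≡ m) × k ℕ.≤ suc k′ × (∀ l → ¬ InB (g (ρ l)))
      drop (suc k) g sep l h = k , punchIn l , Fin.punchIn-injective l _ _ , ℕ.≤-refl ,
        λ m h′ → Fin.punchInᵢ≢i l m (sep (Star.reverse Linked-sym h′ ◅◅ h))
    separated : Separated (Linked ((a , b) ∷ es)) (S.representative ∘ proj₁ (proj₂ remaining))
    separated {l} {m} path = proj₁ (proj₂ (proj₂ remaining))
      (S.separated (avoid (proj₂ (proj₂ (proj₂ (proj₂ remaining))) l) (proj₂ (proj₂ (proj₂ (proj₂ remaining))) m) path))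
      where
      a∉B : ¬ InB a
      a∉B b~a = a≁b (Star.reverse Linked-sym b~a)
      avoid : ∀ {i j} → ¬ InB i → ¬ InB j → Star (Linked ((a , b) ∷ es)) i j → Star (Linked es) i j
      -- An excursion into the component of b starts and ends at a.
      excursion : ∀ {i j} → InB i → ¬ InB j → Star (Linked ((a , b) ∷ es)) i j → Star (Linked es) a j
      avoid ¬i ¬j Star.ε = Star.ε
      avoid ¬i ¬j (inj₁ (there e∈) ◅ path) = inj₁ e∈ ◅ avoid (λ h → ¬i (h ◅◅ inj₂ e∈ ◅ Star.ε)) ¬j path
      avoid ¬i ¬j (inj₂ (there e∈) ◅ path) = inj₂ e∈ ◅ avoid (λ h → ¬i (h ◅◅ inj₁ e∈ ◅ Star.ε)) ¬j path
      avoid ¬i ¬j (inj₂ (here ≡.refl) ◅ path) = contradiction Star.ε ¬i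
      avoid ¬i ¬j (inj₁ (here ≡.refl) ◅ path) = excursion Star.ε ¬j path
      excursion i∈ ¬j Star.ε = contradiction i∈ ¬j
      excursion i∈ ¬j (inj₁ (there e∈) ◅ path) = excursion (i∈ ◅◅ inj₁ e∈ ◅ Star.ε) ¬j path
      excursion i∈ ¬j (inj₂ (there e∈) ◅ path) = excursion (i∈ ◅◅ inj₂ e∈ ◅ Star.ε) ¬j path
      excursion i∈ ¬j (inj₁ (here ≡.refl) ◅ path) = contradiction i∈ a∉B
      excursion i∈ ¬j (inj₂ (here ≡.refl) ◅ path) = avoid a∉B ¬j path

  -- Comparing a weighting with the 0-1 matrix

  -- Independent columns are distinct, so each listed column costs at most one of them.
  avoid-columns : {I J : Set} {A : I → J → Carrier} {f : Fin k → J} → Independent A f → ∀ L →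
    ∃ λ k′ → ∃ λ (ρ : Fin k′ → Fin k) → k ℕ.≤ k′ ℕ.+ length L × (∀ i → ¬ f (ρ i) List.∈ L) × Independent A (f ∘ ρ)
  avoid-columns {k} ind [] = k , id , ℕ.m≤m+n k 0 , (λ _ ()) , ind
  avoid-columns {k} {A = A} {f} ind (l ∷ L) with avoid-columns ind L
  ... | k′ , ρ , k≤ , avoids , ind′ with em {∃ λ i → f (ρ i) ≡ l}
  ...   | no none = k′ , ρ , ℕ.≤-trans k≤ (ℕ.+-monoʳ-≤ k′ (ℕ.n≤1+n (length L))) ,
            (λ { i (here eq) → none (i , eq) ; i (there l∈) → avoids i l∈ }) , ind′
  ...   | yes (i , eq) = drop k′ ρ k≤ avoids ind′ i eq
    where
    drop : ∀ k′ (ρ : Fin k′ → Fin k) → k ℕ.≤ k′ ℕ.+ length L → (∀ i → ¬ f (ρ i) List.∈ L) →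
      Independent A (f ∘ ρ) → ∀ i → f (ρ i) ≡ l →
      ∃ λ k′ → ∃ λ (ρ : Fin k′ → Fin k) → k ℕ.≤ k′ ℕ.+ suc (length L) × (∀ i → ¬ f (ρ i) List.∈ l ∷ L) × Independent A (f ∘ ρ)
    drop (suc k′) ρ k≤ avoids ind i eq = k′ , ρ ∘ punchIn i ,
      ℕ.≤-trans k≤ (ℕ.≤-reflexive (≡.sym (ℕ.+-suc k′ (length L)))) ,
      (λ { j (here eq′) → Fin.punchInᵢ≢i i j (Independent⇒injective ind (≡.trans eq′ (≡.sym eq)))
         ; j (there l∈) → avoids (punchIn i j) l∈ }) ,
      Independent-punchIn ind i

  -- Common form of the gain matrix, where `W j i` is the conjugate of `W i j`, and of the adjacency
  -- matrix.
  record UnitWeighting {n} (G : Graph n) (W : Fin n → Fin n → Carrier) : Set where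
    field
      off  : ∀ {i j} → ¬ Adj G i j → W i j ≈ 0#
      unit : ∀ {i j} → Adj G i j → W i j * W j i ≈ 1#

  open UnitWeighting public

  ones : Graph n → Fin n → Fin n → Carrier
  ones G i j = if adjacent G i j then 1# else 0#

  ones-Adj : (G : Graph n) {i j : Fin n} → Adj G i j → ones G i j ≡ 1#
  ones-Adj G {i} {j} adj with adjacent G i j
  ... | true = ≡.refl

  ones-¬Adj : (G : Graph n) {i j : Fin n} → ¬ Adj G i j → ones G i j ≡ 0#
  ones-¬Adj G {i} {j} ¬adj with adjacent G i j
  ... | true  = contradiction _ ¬adj
  ... | false = ≡.refl

  ones-unit : (G : Graph n) → UnitWeighting G (ones G)
  ones-unit G = record
    { off  = λ ¬adj → reflexive (ones-¬Adj G ¬adj)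
    ; unit = λ adj → trans (reflexive (≡.cong₂ _*_ (ones-Adj G adj) (ones-Adj G (adj-sym G adj)))) (*-identityˡ 1#) }

  endpoints : List (Fin n × Fin n) → List (Fin n)
  endpoints []             = []
  endpoints ((a , b) ∷ es) = a ∷ b ∷ endpoints es

  length-endpoints : (es : List (Fin n × Fin n)) → length (endpoints es) ≡ 2 ℕ.* length es
  length-endpoints [] = ≡.refl
  length-endpoints (e ∷ es) = ≡.trans (≡.cong (2 ℕ.+_) (length-endpoints es)) (≡.sym (ℕ.*-suc 2 (length es)))

  endpoints-∈ : ∀ {n} {es : List (Fin n × Fin n)} {a b} → (a , b) List.∈ es → a List.∈ endpoints es × b List.∈ endpoints es
  endpoints-∈ (here ≡.refl) = here ≡.refl , there (here ≡.refl)
  endpoints-∈ (there e∈) = let a∈ , b∈ = endpoints-∈ e∈ in there (there a∈) , there (there b∈)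

  -- After switching, W agrees with the 0-1 matrix outside the columns met by the bad edges,
  -- of which there are at most θ(G).
  switch-⊒ : ∀ {n} (G : Graph n) {W} → UnitWeighting G W → (M N : Fin n → Fin n → Carrier) (L : List (Fin n)) →
    (∀ i j → ¬ j List.∈ L → M i j ≈ ones G i j) → (∀ i j → ¬ j List.∈ L → N i j ≈ W i j) → M ⊒ k →
    ∃ λ k′ → N ⊒ k′ × k ℕ.+ 2 ℕ.* n ℕ.≤ k′ ℕ.+ length L ℕ.+ 2 ℕ.* (edgeCount G ℕ.+ ω G)
  switch-⊒ {k} {n} G {W} unitW M N L M≈ N≈ (f , ind) with avoid-columns ind (endpoints bad List.++ L)
    where open Switching (switch W (edges G) (All.tabulate λ e∈ → unit unitW (edges-Adj G e∈)))
  ... | k′ , ρ , k≤ , avoids , ind′ = k′ , (f ∘ ρ , Independent-transfer id x (x ∘ f ∘ ρ) (λ j → unit≉0 (x-inverse (f (ρ j)))) entry ind′) , bound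
    where
    open Switching (switch W (edges G) (All.tabulate λ e∈ → unit unitW (edges-Adj G e∈)))
    agree : ∀ i j → ¬ j List.∈ endpoints bad → ones G i j * x j ≈ x i * W i j
    agree i j j∉ with em {Adj G i j}
    ... | no ¬adj = trans (*-congʳ (reflexive (ones-¬Adj G ¬adj))) (trans (zeroˡ _) (sym (trans (*-congˡ (off unitW ¬adj)) (zeroʳ _))))
    ... | yes adj = trans (trans (*-congʳ (reflexive (ones-Adj G adj))) (*-identityˡ _)) (edge (edges-complete G adj))
      where
      edge : (i , j) List.∈ edges G ⊎ (j , i) List.∈ edges G → x j ≈ x i * W i j
      edge (inj₁ e∈) with good e∈
      ... | inj₁ e∈bad = contradiction (proj₂ (endpoints-∈ e∈bad)) j∉
      ... | inj₂ eq = sym eq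
      -- `edges` lists one orientation only; the equation for the other one comes from
      -- `W j i * W i j ≈ 1`.
      edge (inj₂ e∈) with good e∈
      ... | inj₁ e∈bad = contradiction (proj₁ (endpoints-∈ e∈bad)) j∉
      ... | inj₂ eq = begin
        x j                        ≈⟨ *-identityʳ _ ⟨
        x j * 1#                   ≈⟨ *-congˡ (unit unitW (edges-Adj G e∈)) ⟨
        x j * (W j i * W i j)      ≈⟨ *-assoc _ _ _ ⟨
        x j * W j i * W i j        ≈⟨ *-congʳ eq ⟩
        x i * W i j                ∎
    entry : ∀ i j → M i (f (ρ j)) * x (f (ρ j)) ≈ x i * N i (f (ρ j))
    entry i j = begin
      M i l * x l        ≈⟨ *-congʳ (M≈ i l l∉L) ⟩
      ones G i l * x l   ≈⟨ agree i l l∉bad ⟩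
      x i * W i l        ≈⟨ *-congˡ (N≈ i l l∉L) ⟨
      x i * N i l        ∎
      where
      l = f (ρ j)
      l∉bad : ¬ l List.∈ endpoints bad
      l∉bad l∈ = avoids j (List.∈-++⁺ˡ l∈)
      l∉L : ¬ l List.∈ L
      l∉L l∈ = avoids j (List.∈-++⁺ʳ (endpoints bad) l∈)
    E = edgeCount G
    bad≤ : length bad ℕ.+ n ℕ.≤ E ℕ.+ ω G
    bad≤ = ℕ.≤-trans count (ℕ.+-mono-≤ (ℕ.≤-reflexive (length-edges G))
      (separated⇒≤ω G λ {a} {b} path → separated (Star.map (edges-complete G) path)))
    bound : k ℕ.+ 2 ℕ.* n ℕ.≤ k′ ℕ.+ length L ℕ.+ 2 ℕ.* (E ℕ.+ ω G)
    bound = double-bound k′ (length bad) (length L) (ℕ.≤-trans k≤ (ℕ.≤-reflexive (≡.cong (k′ ℕ.+_)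
      (≡.trans (List.length-++ (endpoints bad)) (≡.cong (ℕ._+ length L) (length-endpoints bad)))))) bad≤

  restrict : (Fin n → Fin n → Carrier) → (S : Subset n) → Fin (card S) → Fin (card S) → Carrier
  restrict W S i j = W (elements S i) (elements S j)

  restrict-unit : {G : Graph n} {W : Fin n → Fin n → Carrier} → UnitWeighting G W →
    ∀ S → UnitWeighting (inducedGraph G S) (restrict W S)
  restrict-unit unitW S = record { off = off unitW ; unit = unit unitW }

  -- Numerical rank

  Matrixᴰ : ℕ → ℕ → Set
  Matrixᴰ m n = Fin m → Fin n → Carrier

  -- Written out without the record `Independent`, so that over ℂ this `rank` agrees by computation
  -- with the rank of the statement.
  HasColumns : ∀ {m n} → Matrixᴰ m n → ℕ → Set
  HasColumns {n = n} A k = ∃ λ (f : Fin k → Fin n) →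
    ∀ (c : Fin k → Carrier) → (∀ i → sum (λ j → c j * A i (f j)) ≈ 0#) → ∀ j → c j ≈ 0#

  rank : ∀ {m n} → Matrixᴰ m n → ℕ
  rank {n = n} A = greatest (HasColumns A) (λ _ → em) n

  rank-max : ∀ {m n k} {A : Matrixᴰ m n} → A ⊒ k → k ℕ.≤ rank A
  rank-max {m} {n} {k} {A} (f , ind) = greatest-max
    {P = HasColumns A} {P? = λ _ → em}
    (f , trivial ind) (Fin.injective⇒≤ (Independent⇒injective ind))

  ⊒-zero : {I J : Set} {A : I → J → Carrier} → A ⊒ 0
  ⊒-zero = (λ ()) , independent λ _ _ ()

  rank-⊒ : ∀ {m n} (A : Matrixᴰ m n) → A ⊒ rank A
  rank-⊒ {m} {n} A =
    let f , ind = greatest-holds {P = HasColumns A} {P? = λ _ → em}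
                    n ((λ ()) , λ _ _ ())
    in f , independent ind

  module _ {m n m′ n′ : ℕ} {A : Matrixᴰ m n} {B : Matrixᴰ m′ n′} where

    rank-mono : (∀ {k} → A ⊒ k → B ⊒ k) → rank A ℕ.≤ rank B
    rank-mono h = rank-max (h (rank-⊒ A))

    rank-delete : (∀ {k} → A ⊒ 2 ℕ.+ k → B ⊒ k) → rank A ℕ.≤ 2 ℕ.+ rank B
    rank-delete h = go (rank A) (rank-⊒ A)
      where
      go : ∀ k → A ⊒ k → k ℕ.≤ 2 ℕ.+ rank B
      go zero          _  = z≤n
      go (suc zero)    _  = s≤s z≤n
      go (suc (suc k)) A⊒ = s≤s (s≤s (rank-max (h A⊒)))

    rank-shift : ∀ h → (∀ {k} → A ⊒ h ℕ.+ k ⇔ B ⊒ k) → rank A ≡ h ℕ.+ rank B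
    rank-shift h equiv = ℕ.≤-antisym
      (ℕ.≤-trans (ℕ.≤-reflexive (≡.sym rank≡)) (ℕ.+-monoʳ-≤ h
        (rank-max (Equivalence.to equiv (≡.subst (A ⊒_) (≡.sym rank≡) (rank-⊒ A))))))
      (rank-max (Equivalence.from equiv (rank-⊒ B)))
      where
      rank≡ : h ℕ.+ (rank A ℕ.∸ h) ≡ rank A
      -- `B ⊒ 0` always holds, so `A` has h independent columns and the truncated subtraction is
      -- exact.
      rank≡ = ℕ.m+[n∸m]≡n (ℕ.≤-trans (ℕ.m≤m+n h 0) (rank-max (Equivalence.from equiv ⊒-zero)))

    rank-shift₂ : ∀ h → (∀ {k} → A ⊒ h ℕ.+ (2 ℕ.+ k) ⇔ B ⊒ k) → rank A ≡ h ℕ.+ (2 ℕ.+ rank B)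
    rank-shift₂ h equiv = ≡.trans (rank-shift (h ℕ.+ 2) λ {k} → mk⇔
      (Equivalence.to equiv ∘ ≡.subst (A ⊒_) (ℕ.+-assoc h 2 k))
      (≡.subst (A ⊒_) (≡.sym (ℕ.+-assoc h 2 k)) ∘ Equivalence.from equiv)) (ℕ.+-assoc h 2 (rank B))

  rank-cong : ∀ {m n} {A B : Matrixᴰ m n} → (∀ i j → A i j ≈ B i j) → rank A ≡ rank B
  rank-cong eq = ℕ.≤-antisym (rank-mono (⊒-reindex id id eq)) (rank-mono (⊒-reindex id id λ i j → sym (eq i j)))

  rank-lower-bound : ∀ {n} (G : Graph n) {W} → UnitWeighting G W →
    rank (ones G) ℕ.+ 2 ℕ.* n ℕ.≤ rank W ℕ.+ 2 ℕ.* (edgeCount G ℕ.+ ω G)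
  rank-lower-bound {n} G {W} unitW =
    let k′ , ⊒k′ , bound = switch-⊒ G unitW (ones G) W [] (λ _ _ _ → refl) (λ _ _ _ → refl) (rank-⊒ (ones G))
    in ℕ.≤-trans bound (ℕ.+-monoˡ-≤ (2 ℕ.* (edgeCount G ℕ.+ ω G))
         (ℕ.≤-trans (ℕ.≤-reflexive (ℕ.+-identityʳ k′)) (rank-max ⊒k′)))

  -1^odd : ∀ t → (∃ λ a → t ≡ a ℕ.* 2) ⊎ (- 1#) ^ t ≈ - 1#
  -1^odd zero = inj₁ (0 , ≡.refl)
  -1^odd (suc zero) = inj₂ (*-identityʳ _)
  -1^odd (suc (suc t)) with -1^odd t
  ... | inj₁ (a , ≡.refl) = inj₁ (suc a , ≡.refl)
  ... | inj₂ odd = inj₂ (trans (*-congˡ (*-congˡ odd)) (trans (sym (*-assoc _ _ _)) (trans (*-congʳ -1*-1≈1) (*-identityˡ _))))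
    where
    -1*-1≈1 : - 1# * - 1# ≈ 1#
    -1*-1≈1 = solve 0 (:- :1 :* :- :1 := :1) refl

  -1^t² : ∀ t → (- 1#) ^ t * (- 1#) ^ t ≈ 1#
  -1^t² zero = *-identityˡ 1#
  -1^t² (suc t) = trans (solve 1 (λ x → (:- :1 :* x) :* (:- :1 :* x) := x :* x) refl ((- 1#) ^ t)) (-1^t² t)

  -- Ranks of a weighted graph with a pendant cycle

  module PendantRanks {n : ℕ} (G : Graph n) {q : ℕ} (C : PendantCycle G (3 ℕ.+ q)) where
    open Pendant G C
    open PendantCycle C using (vertex)

    -- The vertices of `H` with v split off as `nothing`, the shape required by the elimination
    -- lemmas; `toH` and `fromH` translate to the enumeration of `SH`.
    ι : Maybe (Fin (card SF)) → Fin n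
    ι nothing  = c 0
    ι (just i) = elements SF i

    ιF-off : ∀ i → ¬ OnCycle (elements SF i)
    ιF-off i = ∈SF⁻ (elements-∈ SF i)

    ι-injective : ∀ {i j} → ι i ≡ ι j → i ≡ j
    ι-injective {nothing} {nothing} eq = ≡.refl
    ι-injective {nothing} {just j}  eq = contradiction (≡.subst OnCycle eq (c-OnCycle 0 z≤n)) (ιF-off j)
    ι-injective {just i}  {nothing} eq = contradiction (≡.subst OnCycle (≡.sym eq) (c-OnCycle 0 z≤n)) (ιF-off i)
    ι-injective {just i}  {just j}  eq = ≡.cong just (elements-injective SF eq)

    toH : ∀ i → ∃ λ j → elements SH j ≡ ι i
    toH nothing  = index SH (∈SH⁺ (inj₂ ≡.refl))
    toH (just i) = index SH (∈SH⁺ (inj₁ (ιF-off i)))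

    fromH : ∀ j → ∃ λ i → ι i ≡ elements SH j
    fromH j with ∈SH⁻ (elements-∈ SH j)
    ... | inj₁ off = let i , eq = index SF (∈SF⁺ off) in just i , eq
    ... | inj₂ eq = nothing , ≡.sym eq

    fromH-toH : ∀ i → proj₁ (fromH (proj₁ (toH i))) ≡ i
    fromH-toH i = ι-injective (≡.trans (proj₂ (fromH (proj₁ (toH i)))) (proj₂ (toH i)))

    toH-fromH : ∀ j → proj₁ (toH (proj₁ (fromH j))) ≡ j
    toH-fromH j = elements-injective SH (≡.trans (proj₂ (toH (proj₁ (fromH j)))) (proj₂ (fromH j)))

    e : Maybe (Fin (card SF)) → Carrier
    e nothing  = 1#
    e (just _) = 0#

    module Unfold (W : Fin n → Fin n → Carrier) (unitW : UnitWeighting G W) where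

      B : Maybe (Fin (card SF)) → Maybe (Fin (card SF)) → Carrier
      B i j = W (ι i) (ι j)

      w w′ : ℕ → Carrier
      w  k = W (c k) (c (suc k))
      w′ k = W (c (suc k)) (c k)

      ww′≈1 : ∀ k → w k * w′ k ≈ 1#
      ww′≈1 k = unit unitW (c-Adj k)

      W-diag : ∀ x → W x x ≈ 0#
      W-diag x = off unitW (adj-irrefl G)

      open EvenCycle B (W-diag (c 0)) e refl (λ _ → refl) w w′ ww′≈1 public

      V : ℕ → Set
      V m = Ext m (Maybe (Fin (card SF)))

      pos : ∀ m → V m → Fin n
      pos zero    i        = ι i
      pos (suc m) nothing  = c (suc m)
      pos (suc m) (just i) = pos m i

      pos-range : ∀ m i → ¬ OnCycle (pos m i) ⊎ ∃ λ k → k ℕ.≤ m × pos m i ≡ c k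
      pos-range zero    nothing  = inj₂ (0 , z≤n , ≡.refl)
      pos-range zero    (just i) = inj₁ (ιF-off i)
      pos-range (suc m) nothing  = inj₂ (suc m , ℕ.≤-refl , ≡.refl)
      pos-range (suc m) (just i) with pos-range m i
      ... | inj₁ off = inj₁ off
      ... | inj₂ (k , k≤m , eq) = inj₂ (k , ℕ.m≤n⇒m≤1+n k≤m , eq)

      pos≢ : ∀ {m l} i → m ℕ.< l → l ℕ.< p → pos m i ≢ c l
      pos≢ {m} {l} i m<l l<p eq with pos-range m i
      ... | inj₁ off = off (l , l<p , ≡.sym eq)
      ... | inj₂ (k , k≤m , eq′) = ℕ.<⇒≢ (ℕ.≤-<-trans k≤m m<l)
        (c-injective (ℕ.<-trans (ℕ.≤-<-trans k≤m m<l) l<p) l<p (≡.trans (≡.sym eq′) eq))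

      -- Couples the value of an indicator vector with its reason, so that one case split evaluates
      -- both the entry of `W` and that of `Q`.
      Indicates : Fin n → Fin n → Carrier → Set
      Indicates y x v = (x ≡ y × v ≡ 1#) ⊎ (x ≢ y × v ≡ 0#)

      e-indicates : ∀ i → Indicates (c 0) (ι i) (e i)
      e-indicates nothing  = inj₁ (≡.refl , ≡.refl)
      e-indicates (just i) = inj₂ ((λ eq → ιF-off i (0 , s≤s z≤n , ≡.sym eq)) , ≡.refl)

      tip-indicates : ∀ m i → m ℕ.< p → Indicates (c m) (pos m i) (tip m i)
      tip-indicates zero    i        _ = e-indicates i
      tip-indicates (suc m) nothing  _ = inj₁ (≡.refl , ≡.refl)
      tip-indicates (suc m) (just i) m<p = inj₂ (pos≢ i (ℕ.n<1+n m) m<p , ≡.refl)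

      base-indicates : ∀ m i → m ℕ.< p → Indicates (c 0) (pos m i) (base m i)
      base-indicates zero    i        _ = e-indicates i
      base-indicates (suc m) nothing  m<p = inj₂ ((λ eq → ℕ.1+n≢0 (c-injective m<p (s≤s z≤n) eq)) , ≡.refl)
      base-indicates (suc m) (just i) m<p = base-indicates m i (ℕ.<-trans (ℕ.n<1+n m) m<p)

      W-far : ∀ {k x} → suc k ℕ.< p → x ≢ c k → x ≢ c (2 ℕ.+ k) → W x (c (suc k)) ≈ 0# × W (c (suc k)) x ≈ 0#
      W-far {k} {x} 1+k<p x≢ x≢′ = off unitW (¬adj ∘ adj-sym G) , off unitW ¬adj
        where
        ¬adj : ¬ Adj G (c (suc k)) x
        ¬adj adj with c-neighbours 1+k<p adj
        ... | inj₁ eq = x≢ eq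
        ... | inj₂ eq = x≢′ eq

      -- Before `c last` is added, a new path vertex `c (suc m)` sees only its predecessor, since
      -- its other neighbour `c (2 + m)` is not yet present.
      W-path : ∀ m i j → m ℕ.< last → W (pos m i) (pos m j) ≈ K m i j
      W-path zero    i        j        _ = refl
      W-path (suc m) nothing  nothing  _ = W-diag _
      W-path (suc m) (just i) (just j) m< = W-path m i j (ℕ.<-trans (ℕ.n<1+n m) m<)
      W-path (suc m) (just i) nothing  m< with tip-indicates m i (ℕ.<-trans (ℕ.n<1+n m) (ℕ.m≤n⇒m≤1+n m<))
      ... | inj₁ (eq , t≡1) = trans (reflexive (≡.cong (λ x → W x _) eq)) (sym (trans (*-congˡ (reflexive t≡1)) (*-identityʳ _)))
      ... | inj₂ (x≢ , t≡0) = trans (proj₁ (W-far (ℕ.m≤n⇒m≤1+n m<) x≢ (pos≢ i (ℕ.m≤n⇒m≤1+n (ℕ.n<1+n m)) (s≤s m<))))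
        (sym (trans (*-congˡ (reflexive t≡0)) (zeroʳ _)))
      W-path (suc m) nothing  (just i) m< with tip-indicates m i (ℕ.<-trans (ℕ.n<1+n m) (ℕ.m≤n⇒m≤1+n m<))
      ... | inj₁ (eq , t≡1) = trans (reflexive (≡.cong (λ x → W _ x) eq)) (sym (trans (*-congˡ (reflexive t≡1)) (*-identityʳ _)))
      ... | inj₂ (x≢ , t≡0) = trans (proj₂ (W-far (ℕ.m≤n⇒m≤1+n m<) x≢ (pos≢ i (ℕ.m≤n⇒m≤1+n (ℕ.n<1+n m)) (s≤s m<))))
        (sym (trans (*-congˡ (reflexive t≡0)) (zeroʳ _)))

      z z′ : Carrier
      -- `c p` is `c 0`, so index `last` gives the closing edge.
      z  = w last
      z′ = w′ last

      private
        m : ℕ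
        m = suc q

        far : ∀ i → pos m i ≢ c m → pos m i ≢ c 0 → W (pos m i) (c last) ≈ 0# × W (c last) (pos m i) ≈ 0#
        far i ≢m ≢0 = W-far ℕ.≤-refl ≢m (λ eq → ≢0 (≡.trans eq c-period))

        corner-case : ∀ i (t b : Carrier) → Indicates (c m) (pos m i) t → Indicates (c 0) (pos m i) b →
          W (pos m i) (c last) ≈ w m * t + z * (0# * 0#) + z′ * (b * 1#) ×
          W (c last) (pos m i) ≈ w′ m * t + z * (1# * b) + z′ * (0# * 0#)
        corner-case i t b (inj₁ (eq , _)) (inj₁ (eq′ , _)) =
          contradiction (c-injective (ℕ.m≤n⇒m≤1+n (ℕ.n<1+n m)) (s≤s z≤n) (≡.trans (≡.sym eq) eq′)) λ ()
        corner-case i t b (inj₁ (eq , ≡.refl)) (inj₂ (_ , ≡.refl)) =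
          trans (reflexive (≡.cong (λ x → W x (c last)) eq))
            (solve 3 (λ w z z′ → w := w :* :1 :+ z :* (:0 :* :0) :+ z′ :* (:0 :* :1)) refl (w m) z z′) ,
          trans (reflexive (≡.cong (W (c last)) eq))
            (solve 3 (λ w z z′ → w := w :* :1 :+ z :* (:1 :* :0) :+ z′ :* (:0 :* :0)) refl (w′ m) z z′)
        corner-case i t b (inj₂ (_ , ≡.refl)) (inj₁ (eq , ≡.refl)) =
          trans (reflexive (≡.cong (λ x → W x (c last)) (≡.trans eq (≡.sym c-period))))
            (solve 3 (λ w z z′ → z′ := w :* :0 :+ z :* (:0 :* :0) :+ z′ :* (:1 :* :1)) refl (w m) z z′) ,
          trans (reflexive (≡.cong (W (c last)) (≡.trans eq (≡.sym c-period))))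
            (solve 3 (λ w z z′ → z := w :* :0 :+ z :* (:1 :* :1) :+ z′ :* (:0 :* :0)) refl (w′ m) z z′)
        corner-case i t b (inj₂ (≢m , ≡.refl)) (inj₂ (≢0 , ≡.refl)) =
          trans (proj₁ (far i ≢m ≢0))
            (solve 3 (λ w z z′ → :0 := w :* :0 :+ z :* (:0 :* :0) :+ z′ :* (:0 :* :1)) refl (w m) z z′) ,
          trans (proj₂ (far i ≢m ≢0))
            (solve 3 (λ w z z′ → :0 := w :* :0 :+ z :* (:1 :* :0) :+ z′ :* (:0 :* :0)) refl (w′ m) z z′)

        corner-entries : ∀ i → _ × _
        corner-entries i = corner-case i (tip m i) (base m i)
          (tip-indicates m i (ℕ.m≤n⇒m≤1+n (ℕ.n<1+n m))) (base-indicates m i (ℕ.m≤n⇒m≤1+n (ℕ.n<1+n m)))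

      W≈Q : ∀ i j → W (pos last i) (pos last j) ≈ Q last z z′ i j
      W≈Q nothing  nothing  = trans (W-diag _) (solve 2 (λ z z′ → :0 := :0 :+ z :* (:1 :* :0) :+ z′ :* (:0 :* :1)) refl z z′)
      W≈Q (just i) nothing  = proj₁ (corner-entries i)
      W≈Q nothing  (just j) = proj₂ (corner-entries j)
      W≈Q (just i) (just j) = trans (W-path m i j ℕ.≤-refl)
        (solve 5 (λ k z z′ a b → k := k :+ z :* (:0 :* b) :+ z′ :* (a :* :0)) refl (K m i j) z z′ (base m i) (base m j))

      pos-cycle : ∀ m {k} → k ℕ.≤ m → ∃ λ i → pos m i ≡ c k
      pos-cycle zero    z≤n = nothing , ≡.refl
      pos-cycle (suc m) k≤ with ℕ.m≤n⇒m<n∨m≡n k≤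
      ... | inj₂ ≡.refl = nothing , ≡.refl
      ... | inj₁ (s≤s k≤m) = let i , eq = pos-cycle m k≤m in just i , eq

      pos-off : ∀ m x → ¬ OnCycle x → ∃ λ i → pos m i ≡ x
      pos-off zero    x off = let i , eq = index SF (∈SF⁺ off) in just i , eq
      pos-off (suc m) x off = let i , eq = pos-off m x off in just i , eq

      pos-surjective : ∀ x → ∃ λ i → pos last i ≡ x
      pos-surjective x with OnCycle? x
      ... | yes (k , s≤s k≤ , eq) = let i , eq′ = pos-cycle last k≤ in i , ≡.trans eq′ eq
      ... | no off = pos-off last x off

      W⇔Q : W ⊒ k ⇔ Q last z z′ ⊒ k
      W⇔Q = mk⇔
        (⊒-reindex (proj₁ ∘ pos-surjective) (proj₁ ∘ pos-surjective) λ x y → trans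
          (reflexive (≡.sym (≡.cong₂ W (proj₂ (pos-surjective x)) (proj₂ (pos-surjective y)))))
          (W≈Q (proj₁ (pos-surjective x)) (proj₁ (pos-surjective y))))
        (⊒-reindex (pos last) (pos last) λ i j → sym (W≈Q i j))

      WF : Fin (card SF) → Fin (card SF) → Carrier
      WF = restrict W SF

      WH : Fin (card SH) → Fin (card SH) → Carrier
      WH = restrict W SH

      B⇔WH : B ⊒ k ⇔ WH ⊒ k
      B⇔WH = mk⇔
        (⊒-reindex (proj₁ ∘ toH) (proj₁ ∘ toH) λ i j → reflexive (≡.sym (≡.cong₂ W (proj₂ (toH i)) (proj₂ (toH j)))))
        (⊒-reindex (proj₁ ∘ fromH) (proj₁ ∘ fromH) λ i j → reflexive (≡.sym (≡.cong₂ W (proj₂ (fromH i)) (proj₂ (fromH j)))))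

      WF-⊒-WH : WF ⊒ k → WH ⊒ k
      WF-⊒-WH = Equivalence.to B⇔WH ∘ ⊒-reindex just just (λ _ _ → refl)

      WH-⊒-WF : WH ⊒ 2 ℕ.+ k → WF ⊒ k
      WH-⊒-WF = ⊒-delete {N = B} ∘ Equivalence.from B⇔WH

      contracted : ∀ ε t → last ≡ t ℕ.* 2 ℕ.+ ε → W ⊒ t ℕ.* 2 ℕ.+ k ⇔ Q ε (contract w ε t z) (contract w′ ε t z′) ⊒ k
      contracted {k} ε t eq = Q-contract ε t z z′ ⇔-∘ ≡.subst (λ l → W ⊒ t ℕ.* 2 ℕ.+ k ⇔ Q l z z′ ⊒ t ℕ.* 2 ℕ.+ k) eq W⇔Q

      module EvenCase (t : ℕ) (last≡ : last ≡ t ℕ.* 2 ℕ.+ 1) where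
        private
          y  = contract w 1 t z
          y′ = contract w′ 1 t z′
          yy′≈1 : y * y′ ≈ 1#
          yy′≈1 = contract-unit 1 t z z′ (ww′≈1 last)

        ζ : Carrier
        ζ = w′ 0 + y

        singular-⇔ : ∀ {k} → ζ ≈ 0# → W ⊒ t ℕ.* 2 ℕ.+ k ⇔ WH ⊒ k
        singular-⇔ ζ≈0 = B⇔WH ⇔-∘ (Q-singular yy′≈1 ζ≈0 ⇔-∘ contracted 1 t last≡)

        regular-⇔ : ∀ {k} → ¬ ζ ≈ 0# → W ⊒ t ℕ.* 2 ℕ.+ (2 ℕ.+ k) ⇔ WF ⊒ k
        regular-⇔ ζ≉0 = Q-regular yy′≈1 ζ≉0 ⇔-∘ contracted 1 t last≡

        -- As p / 2 = t + 1, ζ vanishes exactly when the product around the cycle is (-1)^(p/2), the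
        -- Type A condition.
        ζ-product : w 0 * ζ ≈ 1# + (- 1#) ^ t * prod w p
        ζ-product = begin
          w 0 * (w′ 0 + y)              ≈⟨ distribˡ _ _ _ ⟩
          w 0 * w′ 0 + w 0 * y          ≈⟨ +-cong (ww′≈1 0) (*-congʳ (sym (*-identityˡ _))) ⟩
          1# + prod w 1 * y                ≈⟨ +-congˡ (≡.subst (λ l → prod w 1 * y ≈ (- 1#) ^ t * (prod w l * z)) (≡.sym last≡) (contract-product w 1 t z)) ⟩
          1# + (- 1#) ^ t * prod w p       ∎

        ζ≈0⇒product : ζ ≈ 0# → prod w p ≈ (- 1#) ^ suc t
        ζ≈0⇒product ζ≈0 = begin
          prod w p
            ≈⟨ *-identityˡ _ ⟨
          1# * prod w p
            ≈⟨ *-congʳ (-1^t² t) ⟨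
          x * x * prod w p
            ≈⟨ solve 2 (λ x p → x :* x :* p := x :* (:1 :+ x :* p) :+ :- :1 :* x) refl x (prod w p) ⟩
          x * (1# + x * prod w p) + - 1# * x
            ≈⟨ +-congʳ (*-congˡ (trans (sym ζ-product) (trans (*-congˡ ζ≈0) (zeroʳ _)))) ⟩
          x * 0# + - 1# * x
            ≈⟨ trans (+-congʳ (zeroʳ _)) (+-identityˡ _) ⟩
          - 1# * x ∎
          where x = (- 1#) ^ t

        -- Meant for `G`, whose product is 1: an odd t, that is 4 dividing p, makes its ζ vanish.
        product⇒ζ≈0 : prod w p ≈ 1# → (- 1#) ^ t ≈ - 1# → ζ ≈ 0#
        product⇒ζ≈0 prod≈1 odd = cancel (begin
          w 0 * ζ                    ≈⟨ ζ-product ⟩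
          1# + (- 1#) ^ t * prod w p    ≈⟨ +-congˡ (*-cong odd prod≈1) ⟩
          1# + - 1# * 1#             ≈⟨ solve 0 (:1 :+ :- :1 :* :1 := :0) refl ⟩
          0#                         ∎) (unit≉0 (ww′≈1 0))

      module OddCase (t : ℕ) (last≡ : last ≡ t ℕ.* 2 ℕ.+ 0) where

        looped : Maybe (Fin (card SF)) → Maybe (Fin (card SF)) → Carrier
        looped = Q 0 (contract w 0 t z) (contract w′ 0 t z′)

        odd-⇔ : W ⊒ t ℕ.* 2 ℕ.+ k ⇔ looped ⊒ k
        odd-⇔ = contracted 0 t last≡

        -- For ε = 0 tip and base are both v, so the closing edge has become a loop there and
        -- affects one column only.
        looped-≢nothing : ∀ i j → j ≢ nothing → looped i j ≈ B i j
        looped-≢nothing i nothing  j≢ = contradiction ≡.refl j≢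
        looped-≢nothing i (just j) j≢ = solve 4 (λ b y y′ e → b :+ y :* (e :* :0) :+ y′ :* (e :* :0) := b) refl
          (B i (just j)) (contract w 0 t z) (contract w′ 0 t z′) (e i)

    module OddSwitch (t : ℕ) (last≡ : last ≡ t ℕ.* 2 ℕ.+ 0) where
      private
        looped : ∀ W → UnitWeighting G W → Maybe (Fin (card SF)) → Maybe (Fin (card SF)) → Carrier
        looped W unitW = Unfold.OddCase.looped W unitW t last≡

      -- Both matrices reduce to `H` with some loop at v. Listing v as an exceptional column lets
      -- `switch-⊒` on `H` compare them whatever the loops are, at the price of one column.
      odd-switch : ∀ {W} → UnitWeighting G W → ones G ⊒ t ℕ.* 2 ℕ.+ k →
        ∃ λ k′ → W ⊒ t ℕ.* 2 ℕ.+ k′ × k ℕ.+ 2 ℕ.* card SH ℕ.≤ k′ ℕ.+ 1 ℕ.+ 2 ℕ.* (edgeCount H ℕ.+ ω H)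
      odd-switch {W = W} unitW ones⊒ =
        let k′ , N⊒ , bound = switch-⊒ H (restrict-unit unitW SH) (onH (ones G) (ones-unit G)) (onH W unitW)
              (proj₁ (toH nothing) ∷ []) (onH≈ (ones G) (ones-unit G)) (onH≈ W unitW)
              (⊒-reindex (proj₁ ∘ toH) (proj₁ ∘ toH)
                (λ i j → reflexive (≡.sym (≡.cong₂ (looped (ones G) (ones-unit G)) (fromH-toH i) (fromH-toH j))))
                (Equivalence.to (Unfold.OddCase.odd-⇔ (ones G) (ones-unit G) t last≡) ones⊒))
        in k′ , Equivalence.from (Unfold.OddCase.odd-⇔ W unitW t last≡) (⊒-reindex (proj₁ ∘ fromH) (proj₁ ∘ fromH) (λ _ _ → refl) N⊒) , bound
        where
        onH : ∀ V → UnitWeighting G V → Fin (card SH) → Fin (card SH) → Carrier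
        onH V unitV i j = looped V unitV (proj₁ (fromH i)) (proj₁ (fromH j))
        onH≈ : ∀ V (unitV : UnitWeighting G V) i j → ¬ j List.∈ proj₁ (toH nothing) ∷ [] →
          onH V unitV i j ≈ V (elements SH i) (elements SH j)
        onH≈ V unitV i j j∉ = trans
          (Unfold.OddCase.looped-≢nothing V unitV t last≡ (proj₁ (fromH i)) (proj₁ (fromH j))
            λ eq → j∉ (here (≡.trans (≡.sym (toH-fromH j)) (≡.cong (proj₁ ∘ toH) eq))))
          (reflexive (≡.cong₂ V (proj₂ (fromH i)) (proj₂ (fromH j))))

    -- Comparing the ranks of the gain graph and its underlying graph

    module Gain (W : Fin n → Fin n → Carrier) (unitW : UnitWeighting G W) where

      cycleProduct : Carrier
      cycleProduct = product λ i → W (vertex i) (vertex (next i))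

      -- The product starts at index 0 of the cycle, the contraction at the root; commutativity
      -- absorbs the rotation.
      cycleProduct≈prod : cycleProduct ≈ prod (λ k → W (c k) (c (suc k))) p
      cycleProduct≈prod = trans (product-permute step rotation)
        (trans (product-cong {x = step ∘ rot ∘ toℕ} {y = λ k → w (toℕ k)} entry) (product≈prod w p))
        where
        open Algebra.Properties.CommutativeMonoid.Sum *-commutativeMonoid using () renaming (sum-permute to product-permute; sum-cong-≋ to product-cong)
        step : Fin p → Carrier
        step i = W (vertex i) (vertex (next i))
        w : ℕ → Carrier
        w k = W (c k) (c (suc k))
        entry : ∀ (k : Fin p) → step (rot (toℕ k)) ≈ w (toℕ k)
        entry k = reflexive (≡.cong (λ i → W (c (toℕ k)) (vertex i)) (next-rot (toℕ k)))

      record Conclusion : Set where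
        field
          half       : ℕ
          p≡half*2   : p ≡ half ℕ.* 2
          product≈   : cycleProduct ≈ (- 1#) ^ half
          p%4≡2      : p % 4 ≡ 2
          extremal-H : rank (restrict W SH) ℕ.+ 2 ℕ.* (edgeCount H ℕ.+ ω H) ≡ rank (ones H) ℕ.+ 2 ℕ.* card SH
          extremal-F : rank (restrict W SF) ℕ.+ 2 ℕ.* (edgeCount F ℕ.+ ω F) ≡ rank (ones F) ℕ.+ 2 ℕ.* card SF
          rΦ≡        : + rank W ≡ + p ℤ.- + 2 ℤ.+ + rank (restrict W SF)
          rFᵠ≡rHᵠ    : rank (restrict W SF) ≡ rank (restrict W SH)
          rG≡p+rH    : rank (ones G) ≡ p ℕ.+ rank (ones H)
          rF≡rH      : rank (ones F) ≡ rank (ones H)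

      module _ (extremal : rank W ℕ.+ 2 ℕ.* (edgeCount G ℕ.+ ω G) ≡ rank (ones G) ℕ.+ 2 ℕ.* n) where
        private
          rΦ rFᵠ rHᵠ rG rF rH : ℕ
          rΦ  = rank W
          rFᵠ = rank (restrict W SF)
          rHᵠ = rank (restrict W SH)
          rG  = rank (ones G)
          rF  = rank (ones F)
          rH  = rank (ones H)

        gap-F : rΦ ℕ.+ 2 ℕ.* (edgeCount F ℕ.+ ω F) ℕ.+ 2 ℕ.≤ rG ℕ.+ 2 ℕ.* card SF
        gap-F = rank-gap {rΦ} {rG} {edgeCount G ℕ.+ ω G} {n} {edgeCount F ℕ.+ ω F} {card SF} extremal (cyclomatic-F em)

        gap-H : rΦ ℕ.+ 2 ℕ.* (edgeCount H ℕ.+ ω H) ℕ.+ 2 ℕ.≤ rG ℕ.+ 2 ℕ.* card SH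
        gap-H = rank-gap {rΦ} {rG} {edgeCount G ℕ.+ ω G} {n} {edgeCount H ℕ.+ ω H} {card SH} extremal (cyclomatic-H em)

        difference-F : rΦ ℕ.+ rF ℕ.+ 2 ℕ.≤ rG ℕ.+ rFᵠ
        difference-F = rank-difference {rΦ} {rG} {y = edgeCount F ℕ.+ ω F} {m = card SF} gap-F (rank-lower-bound F (restrict-unit unitW SF))

        difference-H : rΦ ℕ.+ rH ℕ.+ 2 ℕ.≤ rG ℕ.+ rHᵠ
        difference-H = rank-difference {rΦ} {rG} {y = edgeCount H ℕ.+ ω H} {m = card SH} gap-H (rank-lower-bound H (restrict-unit unitW SH))

        odd-impossible : ∀ t → ¬ last ≡ t ℕ.* 2 ℕ.+ 0
        odd-impossible t last≡ =
          let k′ , W⊒ , bound = odd-switch unitW (≡.subst (ones G ⊒_) rG≡ (rank-⊒ (ones G)))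
          in odd-contradiction {rΦ} {rG} {edgeCount H ℕ.+ ω H} {card SH} h gap-H rG≡ (rank-max W⊒) bound
          where
          open OddSwitch t last≡
          h = t ℕ.* 2
          rG≡ : rG ≡ h ℕ.+ (rG ℕ.∸ h)
          rG≡ = ≡.sym (ℕ.m+[n∸m]≡n (ℕ.≤-trans (ℕ.m≤m+n h 0)
            (rank-max (Equivalence.from (Unfold.OddCase.odd-⇔ (ones G) (ones-unit G) t last≡) ⊒-zero))))

        module Even (t : ℕ) (last≡ : last ≡ t ℕ.* 2 ℕ.+ 1) where
          private
            module EΦ = Unfold.EvenCase W unitW t last≡
            module EG = Unfold.EvenCase (ones G) (ones-unit G) t last≡

          h : ℕ
          h = t ℕ.* 2

          p≡2+h : p ≡ 2 ℕ.+ h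
          p≡2+h = ≡.trans (≡.cong suc last≡) (≡.cong suc (ℕ.+-comm h 1))

          singular-Φ : EΦ.ζ ≈ 0# → rΦ ≡ h ℕ.+ rHᵠ
          singular-Φ ζ≈0 = rank-shift h (EΦ.singular-⇔ ζ≈0)

          regular-Φ : ¬ EΦ.ζ ≈ 0# → rΦ ≡ h ℕ.+ (2 ℕ.+ rFᵠ)
          regular-Φ ζ≉0 = rank-shift₂ h (EΦ.regular-⇔ ζ≉0)

          singular-G : EG.ζ ≈ 0# → rG ≡ h ℕ.+ rH
          singular-G ζ≈0 = rank-shift h (EG.singular-⇔ ζ≈0)

          regular-G : ¬ EG.ζ ≈ 0# → rG ≡ h ℕ.+ (2 ℕ.+ rF)
          regular-G ζ≉0 = rank-shift₂ h (EG.regular-⇔ ζ≉0)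

          rF≤rH : rF ℕ.≤ rH
          rF≤rH = rank-mono (Unfold.WF-⊒-WH (ones G) (ones-unit G))

          rFᵠ≤rHᵠ : rFᵠ ℕ.≤ rHᵠ
          rFᵠ≤rHᵠ = rank-mono (Unfold.WF-⊒-WH W unitW)

          rH≤2+rF : rH ℕ.≤ 2 ℕ.+ rF
          rH≤2+rF = rank-delete (Unfold.WH-⊒-WF (ones G) (ones-unit G))

          module Surviving (ζΦ≈0 : EΦ.ζ ≈ 0#) (ζG≉0 : ¬ EG.ζ ≈ 0#) where
            rΦ≡ : rΦ ≡ h ℕ.+ rHᵠ
            rΦ≡ = singular-Φ ζΦ≈0

            rG≡ : rG ≡ h ℕ.+ (2 ℕ.+ rF)
            rG≡ = regular-G ζG≉0

            -- In `difference-H` the surplus 2 cancels against the 2 of `rG≡`, leaving r(H) ≤ r(F).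
            rF≡rH : rF ≡ rH
            rF≡rH = ℕ.≤-antisym rF≤rH (ℕ.+-cancelˡ-≤ rHᵠ _ _ (ℕ.≤-trans
              (shifted-≤ {rΦ} {rG} h rΦ≡ rG≡ difference-H) (ℕ.≤-reflexive (ℕ.+-comm rF rHᵠ))))

            -- `difference-F` reduces in the same way to r(H^φ) ≤ r(F^φ).
            rFᵠ≡rHᵠ : rFᵠ ≡ rHᵠ
            rFᵠ≡rHᵠ = ℕ.≤-antisym rFᵠ≤rHᵠ (ℕ.+-cancelˡ-≤ rF _ _ (ℕ.≤-trans
              (ℕ.≤-reflexive (ℕ.+-comm rF rHᵠ)) (shifted-≤ {rΦ} {rG} h rΦ≡ rG≡ difference-F)))

            extremal-H : rHᵠ ℕ.+ 2 ℕ.* (edgeCount H ℕ.+ ω H) ≡ rH ℕ.+ 2 ℕ.* card SH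
            extremal-H = gap-to-equality {y = edgeCount H ℕ.+ ω H} {n = card SH} {m = h} rF≡rH
              (≡.subst₂ (λ x y → x ℕ.+ 2 ℕ.* (edgeCount H ℕ.+ ω H) ℕ.+ 2 ℕ.≤ y ℕ.+ 2 ℕ.* card SH) rΦ≡ rG≡ gap-H)
              (rank-lower-bound H (restrict-unit unitW SH))

            extremal-F : rFᵠ ℕ.+ 2 ℕ.* (edgeCount F ℕ.+ ω F) ≡ rF ℕ.+ 2 ℕ.* card SF
            extremal-F = gap-to-equality {y = edgeCount F ℕ.+ ω F} {n = card SF} {m = h} ≡.refl
              (≡.subst₂ (λ x y → x ℕ.+ 2 ℕ.* (edgeCount F ℕ.+ ω F) ℕ.+ 2 ℕ.≤ y ℕ.+ 2 ℕ.* card SF)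
                (≡.trans rΦ≡ (≡.cong (h ℕ.+_) (≡.sym rFᵠ≡rHᵠ))) rG≡ gap-F)
              (rank-lower-bound F (restrict-unit unitW SF))

            p%4≡2 : p % 4 ≡ 2
            p%4≡2 with -1^odd t
            ... | inj₂ odd = contradiction (EG.product⇒ζ≈0 (prod-ones _ p λ k → reflexive (ones-Adj G (c-Adj k))) odd) ζG≉0
            ... | inj₁ (a , eq) = [2+2t]%4≡2 a p≡2+h eq

            rG≡p+rH : rG ≡ p ℕ.+ rH
            rG≡p+rH = ≡.trans rG≡ (≡.trans (≡.sym (ℕ.+-assoc h 2 rF))
              (≡.cong₂ ℕ._+_ (≡.trans (ℕ.+-comm h 2) (≡.sym p≡2+h)) rF≡rH))

            conclusion : Conclusion
            conclusion = record
              { half = suc t ; p≡half*2 = p≡2+h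
              ; product≈ = trans cycleProduct≈prod (EΦ.ζ≈0⇒product ζΦ≈0)
              ; p%4≡2 = p%4≡2 ; extremal-H = extremal-H ; extremal-F = extremal-F
              ; rΦ≡ = minus-two (≡.trans rΦ≡ (≡.cong (h ℕ.+_) (≡.sym rFᵠ≡rHᵠ))) p≡2+h ; rFᵠ≡rHᵠ = rFᵠ≡rHᵠ ; rG≡p+rH = rG≡p+rH ; rF≡rH = rF≡rH }

          conclusion : Conclusion
          conclusion with em {EΦ.ζ ≈ 0#} | em {EG.ζ ≈ 0#}
          ... | yes ζΦ≈0 | no ζG≉0 = Surviving.conclusion ζΦ≈0 ζG≉0
          ... | yes ζΦ≈0 | yes ζG≈0 = contradiction difference-H
                (no-gap h (singular-Φ ζΦ≈0) (ℕ.≤-reflexive (singular-G ζG≈0)))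
          -- In either case for `G`, r(G) ≤ h + 2 + r(F), while r(Φ) = h + 2 + r(F^φ), so the loss
          -- cannot exceed that on `F`.
          ... | no ζΦ≉0 | ζG? = contradiction difference-F
                (no-gap (h ℕ.+ 2) (≡.trans (regular-Φ ζΦ≉0) (≡.sym (ℕ.+-assoc h 2 rFᵠ)))
                  (ℕ.≤-trans (rG≤ ζG?) (ℕ.≤-reflexive (≡.sym (ℕ.+-assoc h 2 rF)))))
            where
            rG≤ : Dec (EG.ζ ≈ 0#) → rG ℕ.≤ h ℕ.+ (2 ℕ.+ rF)
            rG≤ (yes ζG≈0) = ℕ.≤-trans (ℕ.≤-reflexive (singular-G ζG≈0)) (ℕ.+-monoʳ-≤ h rH≤2+rF)
            rG≤ (no ζG≉0)  = ℕ.≤-reflexive (regular-G ζG≉0)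

        conclusion : Conclusion
        conclusion with halve q
        -- `last` = 2 + q has the parity of q, so even q means odd p.
        ... | s , inj₁ eq = contradiction (≡.cong (2 ℕ.+_) eq) (odd-impossible (suc s))
        ... | s , inj₂ eq = Even.conclusion (suc s) (≡.cong (2 ℕ.+_) eq)

open import Defs
open CauchyLemmas

-- ℂ as an integral domain

-- The ring laws hold term by term in ℚ, so that only the congruences need estimates.
≈ᵣ-pointwise : ∀ {x y} → (∀ n → seq x n ≡ seq y n) → x ≈ᵣ y
≈ᵣ-pointwise {x} {y} eq = mk≈ᵣ λ ε 0<ε → 0 , λ n _ → ≡.subst (ℚ._< ε)
  (≡.cong ℚ.∣_∣ (≡.sym (≡.trans (≡.cong (ℚ._- seq y n) (eq n)) (ℚ.+-inverseʳ (seq y n))))) 0<ε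

∣+∣<ε : ∀ {a b ε} → ℚ.∣ a ∣ ℚ.< ½ ℚ.* ε → ℚ.∣ b ∣ ℚ.< ½ ℚ.* ε → ℚ.∣ a ℚ.+ b ∣ ℚ.< ε
∣+∣<ε {a} {b} {ε} a< b< = ≡.subst (ℚ.∣ a ℚ.+ b ∣ ℚ.<_) (halves ε)
  (ℚ.≤-<-trans (ℚ.∣p+q∣≤∣p∣+∣q∣ a b) (ℚ.+-mono-< a< b<))

private
  module ℚSolver = Data.Rational.Solver.+-*-Solver

neg-diff : ∀ a b → ℚ.∣ (ℚ.- a) ℚ.- (ℚ.- b) ∣ ≡ ℚ.∣ a ℚ.- b ∣
neg-diff a b = ≡.trans (≡.cong ℚ.∣_∣ (≡.sym (ℚ.neg-distrib-+ a (ℚ.- b)))) (ℚ.∣-p∣≡∣p∣ (a ℚ.- b))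

diff-sym : ∀ a b → ℚ.∣ a ℚ.- b ∣ ≡ ℚ.∣ b ℚ.- a ∣
diff-sym a b = ≡.trans (≡.sym (ℚ.∣-p∣≡∣p∣ (a ℚ.- b)))
  (≡.cong ℚ.∣_∣ (solve 2 (λ a b → :- (a :- b) := b :- a) ≡.refl a b))
  where open ℚSolver

≈ᵣ-sym : ∀ {x y} → x ≈ᵣ y → y ≈ᵣ x
≈ᵣ-sym {x} {y} (mk≈ᵣ h) = mk≈ᵣ λ ε 0<ε → let N , h′ = h ε 0<ε in
  N , λ n n≥ → ≡.subst (ℚ._< ε) (diff-sym (seq x n) (seq y n)) (h′ n n≥)

-- The ε/2 argument shared by transitivity and addition.
≈ᵣ-add : ∀ {x y x′ y′ z z′} → x ≈ᵣ y → x′ ≈ᵣ y′ →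
  (∀ n → seq z n ℚ.- seq z′ n ≡ (seq x n ℚ.- seq y n) ℚ.+ (seq x′ n ℚ.- seq y′ n)) → z ≈ᵣ z′
≈ᵣ-add (mk≈ᵣ h) (mk≈ᵣ h′) eq = mk≈ᵣ λ ε 0<ε →
  let M , hM = h (½ ℚ.* ε) (halve-pos 0<ε)
      N , hN = h′ (½ ℚ.* ε) (halve-pos 0<ε)
  in M ℕ.⊔ N , λ n n≥ → ≡.subst (λ t → ℚ.∣ t ∣ ℚ.< ε) (≡.sym (eq n))
       (∣+∣<ε (hM n (ℕ.m⊔n≤o⇒m≤o M N n≥)) (hN n (ℕ.m⊔n≤o⇒n≤o M N n≥)))

≈ᵣ-trans : ∀ {x y z} → x ≈ᵣ y → y ≈ᵣ z → x ≈ᵣ z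
≈ᵣ-trans {x} {y} {z} x≈y y≈z = ≈ᵣ-add x≈y y≈z λ n →
  solve 3 (λ a b c → a :- c := (a :- b) :+ (b :- c)) ≡.refl (seq x n) (seq y n) (seq z n)
  where open ℚSolver

+ᵣ-cong : ∀ {x y x′ y′} → x ≈ᵣ y → x′ ≈ᵣ y′ → x +ᵣ x′ ≈ᵣ y +ᵣ y′
+ᵣ-cong {x} {y} {x′} {y′} x≈y x′≈y′ = ≈ᵣ-add x≈y x′≈y′ λ n →
  solve 4 (λ a b a′ b′ → (a :+ a′) :- (b :+ b′) := (a :- b) :+ (a′ :- b′)) ≡.refl (seq x n) (seq y n) (seq x′ n) (seq y′ n)
  where open ℚSolver

-ᵣ-cong : ∀ {x y} → x ≈ᵣ y → -ᵣ x ≈ᵣ -ᵣ y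
-ᵣ-cong {x} {y} (mk≈ᵣ h) = mk≈ᵣ λ ε 0<ε → let N , h′ = h ε 0<ε in
  N , λ n n≥ → ≡.subst (ℚ._< ε) (≡.sym (neg-diff (seq x n) (seq y n))) (h′ n n≥)

*ᵣ-cong : ∀ {x y x′ y′} → x ≈ᵣ y → x′ ≈ᵣ y′ → x *ᵣ x′ ≈ᵣ y *ᵣ y′
*ᵣ-cong {x} {y} {x′} {y′} (mk≈ᵣ h) (mk≈ᵣ h′) = mk≈ᵣ λ ε 0<ε →
  let A , 0<A , K , bx = eventually-bounded {seq x} (cauchy x)
      B , 0<B , L , by = eventually-bounded {seq y′} (cauchy y′)
      δ , 0<δ , eq     = scale (A ℚ.+ B) ε (ℚ.+-mono-< 0<A 0<B) 0<ε
      M , hM           = h δ 0<δ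
      N , hN           = h′ δ 0<δ
  in (K ℕ.⊔ L) ℕ.⊔ (M ℕ.⊔ N) , λ n n≥ →
    let ≥KL = ℕ.m⊔n≤o⇒m≤o (K ℕ.⊔ L) (M ℕ.⊔ N) n≥
        ≥MN = ℕ.m⊔n≤o⇒n≤o (K ℕ.⊔ L) (M ℕ.⊔ N) n≥
    in *-close {seq x n} {seq x′ n} {seq y n} {seq y′ n} {A} {B} {δ} {ε} 0<A 0<B eq
         (bx n (ℕ.m⊔n≤o⇒m≤o K L ≥KL)) (by n (ℕ.m⊔n≤o⇒n≤o K L ≥KL))
         (hM n (ℕ.m⊔n≤o⇒m≤o M N ≥MN)) (hN n (ℕ.m⊔n≤o⇒n≤o M N ≥MN))

ℝ-commutativeRing : CommutativeRing 0ℓ 0ℓ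
ℝ-commutativeRing = record
  { Carrier = ℝ ; _≈_ = _≈ᵣ_ ; _+_ = _+ᵣ_ ; _*_ = _*ᵣ_ ; -_ = -ᵣ_ ; 0# = 0ᵣ ; 1# = 1ᵣ
  ; isCommutativeRing = record
    { isRing = record
      { +-isAbelianGroup = record
        { isGroup = record
          { isMonoid = record
            { isSemigroup = record
              { isMagma = record
                { isEquivalence = record { refl = ≈ᵣ-pointwise λ _ → ≡.refl ; sym = ≈ᵣ-sym ; trans = ≈ᵣ-trans }
                ; ∙-cong = +ᵣ-cong }
              ; assoc = λ x y z → ≈ᵣ-pointwise λ n → ℚ.+-assoc (seq x n) (seq y n) (seq z n) }
            ; identity = (λ x → ≈ᵣ-pointwise λ n → ℚ.+-identityˡ (seq x n))
                       , (λ x → ≈ᵣ-pointwise λ n → ℚ.+-identityʳ (seq x n)) }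
          ; inverse = (λ x → ≈ᵣ-pointwise λ n → ℚ.+-inverseˡ (seq x n))
                    , (λ x → ≈ᵣ-pointwise λ n → ℚ.+-inverseʳ (seq x n))
          ; ⁻¹-cong = -ᵣ-cong }
        ; comm = λ x y → ≈ᵣ-pointwise λ n → ℚ.+-comm (seq x n) (seq y n) }
      ; *-cong = *ᵣ-cong
      ; *-assoc = λ x y z → ≈ᵣ-pointwise λ n → ℚ.*-assoc (seq x n) (seq y n) (seq z n)
      ; *-identity = (λ x → ≈ᵣ-pointwise λ n → ℚ.*-identityˡ (seq x n))
                   , (λ x → ≈ᵣ-pointwise λ n → ℚ.*-identityʳ (seq x n))
      ; distrib = (λ x y z → ≈ᵣ-pointwise λ n → ℚ.*-distribˡ-+ (seq x n) (seq y n) (seq z n))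
                , (λ x y z → ≈ᵣ-pointwise λ n → ℚ.*-distribʳ-+ (seq x n) (seq y n) (seq z n)) }
    ; *-comm = λ x y → ≈ᵣ-pointwise λ n → ℚ.*-comm (seq x n) (seq y n) } }

module ℝ-ring = CommutativeRing ℝ-commutativeRing
module ℝ-solver = IntegerCoefficientSolver ℝ-commutativeRing

ℂ-commutativeRing : CommutativeRing 0ℓ 0ℓ
ℂ-commutativeRing = record
  { Carrier = ℂ ; _≈_ = _≈_ ; _+_ = _+_ ; _*_ = _*_ ; -_ = -_ ; 0# = 0ℂ ; 1# = 1ℂ
  ; isCommutativeRing = record
    { isRing = record
      { +-isAbelianGroup = record
        { isGroup = record
          { isMonoid = record
            { isSemigroup = record
              { isMagma = record
                { isEquivalence = record
                  { refl = mk≈ R.refl R.refl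
                  ; sym = λ { (mk≈ p q) → mk≈ (R.sym p) (R.sym q) }
                  ; trans = λ { (mk≈ p q) (mk≈ p′ q′) → mk≈ (R.trans p p′) (R.trans q q′) } }
                ; ∙-cong = λ { (mk≈ p q) (mk≈ p′ q′) → mk≈ (R.+-cong p p′) (R.+-cong q q′) } }
              ; assoc = λ x y z → mk≈ (R.+-assoc (re x) (re y) (re z)) (R.+-assoc (im x) (im y) (im z)) }
            ; identity = (λ x → mk≈ (R.+-identityˡ (re x)) (R.+-identityˡ (im x)))
                       , (λ x → mk≈ (R.+-identityʳ (re x)) (R.+-identityʳ (im x))) }
          ; inverse = (λ x → mk≈ (R.-‿inverseˡ (re x)) (R.-‿inverseˡ (im x)))
                    , (λ x → mk≈ (R.-‿inverseʳ (re x)) (R.-‿inverseʳ (im x)))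
          ; ⁻¹-cong = λ { (mk≈ p q) → mk≈ (R.-‿cong p) (R.-‿cong q) } }
        ; comm = λ x y → mk≈ (R.+-comm (re x) (re y)) (R.+-comm (im x) (im y)) }
      ; *-cong = λ { (mk≈ p q) (mk≈ p′ q′) → mk≈
          (R.+-cong (R.*-cong p p′) (R.-‿cong (R.*-cong q q′)))
          (R.+-cong (R.*-cong p q′) (R.*-cong q p′)) }
      ; *-assoc = λ x y z → mk≈
          (solve 6 (λ a b c d e f → (a :* c :+ :- (b :* d)) :* e :+ :- ((a :* d :+ b :* c) :* f)
                                 := a :* (c :* e :+ :- (d :* f)) :+ :- (b :* (c :* f :+ d :* e)))
            R.refl (re x) (im x) (re y) (im y) (re z) (im z))
          (solve 6 (λ a b c d e f → (a :* c :+ :- (b :* d)) :* f :+ (a :* d :+ b :* c) :* e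
                                 := a :* (c :* f :+ d :* e) :+ b :* (c :* e :+ :- (d :* f)))
            R.refl (re x) (im x) (re y) (im y) (re z) (im z))
      ; *-identity = (λ x → 1*x x) , (λ x → trans′ (*-comm′ x 1ℂ) (1*x x))
      ; distrib = (λ x y z → distribˡ′ x y z)
                , (λ x y z → trans′ (*-comm′ (y + z) x) (trans′ (distribˡ′ x y z) (+-cong′ (*-comm′ x y) (*-comm′ x z)))) }
    ; *-comm = *-comm′ } }
  where
  module R = ℝ-ring
  open ℝ-solver
  trans′ : ∀ {x y z} → x ≈ y → y ≈ z → x ≈ z
  trans′ (mk≈ p q) (mk≈ p′ q′) = mk≈ (R.trans p p′) (R.trans q q′)
  +-cong′ : ∀ {x y x′ y′} → x ≈ y → x′ ≈ y′ → x + x′ ≈ y + y′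
  +-cong′ (mk≈ p q) (mk≈ p′ q′) = mk≈ (R.+-cong p p′) (R.+-cong q q′)
  *-comm′ : ∀ x y → x * y ≈ y * x
  *-comm′ x y = mk≈
    (solve 4 (λ a b c d → a :* c :+ :- (b :* d) := c :* a :+ :- (d :* b)) R.refl (re x) (im x) (re y) (im y))
    (solve 4 (λ a b c d → a :* d :+ b :* c := c :* b :+ d :* a) R.refl (re x) (im x) (re y) (im y))
  1*x : ∀ x → 1ℂ * x ≈ x
  1*x x = mk≈
    (solve 2 (λ a b → :1 :* a :+ :- (:0 :* b) := a) R.refl (re x) (im x))
    (solve 2 (λ a b → :1 :* b :+ :0 :* a := b) R.refl (re x) (im x))
  distribˡ′ : ∀ x y z → x * (y + z) ≈ x * y + x * z
  distribˡ′ x y z = mk≈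
    (solve 6 (λ a b c d e f → a :* (c :+ e) :+ :- (b :* (d :+ f)) := (a :* c :+ :- (b :* d)) :+ (a :* e :+ :- (b :* f)))
      R.refl (re x) (im x) (re y) (im y) (re z) (im z))
    (solve 6 (λ a b c d e f → a :* (d :+ f) :+ b :* (c :+ e) := (a :* d :+ b :* c) :+ (a :* f :+ b :* e))
      R.refl (re x) (im x) (re y) (im y) (re z) (im z))

module ℂ-ring = CommutativeRing ℂ-commutativeRing

-- Cancellation in ℝ and ℂ

const≉0 : ∀ {x q} → 0ℚ ℚ.< q → (∀ n → q ℚ.≤ seq x n) → ¬ x ≈ᵣ 0ᵣ
const≉0 {x} {q} 0<q q≤x (mk≈ᵣ h) =
  let N , h′ = h q 0<q in
  ℚ.<-irrefl ≡.refl (begin-strict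
    q                       ≤⟨ q≤x N ⟩
    seq x N                 ≡⟨ ℚ.0≤p⇒∣p∣≡p (ℚ.≤-trans (ℚ.<⇒≤ 0<q) (q≤x N)) ⟨
    ℚ.∣ seq x N ∣           ≡⟨ ≡.cong ℚ.∣_∣ (ℚ.+-identityʳ (seq x N)) ⟨
    ℚ.∣ seq x N ℚ.- 0ℚ ∣    <⟨ h′ N ℕ.≤-refl ⟩
    q                       ∎)
  where open ℚ.≤-Reasoning

1ℂ≉0 : ¬ 1ℂ ≈ 0ℂ
1ℂ≉0 (mk≈ p _) = const≉0 {q = 1ℚ} (ℚ.positive⁻¹ 1ℚ) (λ _ → ℚ.≤-refl) p

*-mono-∣∣ : ∀ {a b x y} → 0ℚ ℚ.≤ a → 0ℚ ℚ.≤ b → a ℚ.≤ ℚ.∣ x ∣ → b ℚ.≤ ℚ.∣ y ∣ → a ℚ.* b ℚ.≤ ℚ.∣ x ℚ.* y ∣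
*-mono-∣∣ {a} {b} {x} {y} 0≤a 0≤b a≤x b≤y = begin
  a ℚ.* b                ≤⟨ ℚ.*-monoʳ-≤-nonNeg b {{ℚ.nonNegative 0≤b}} a≤x ⟩
  ℚ.∣ x ∣ ℚ.* b          ≤⟨ ℚ.*-monoˡ-≤-nonNeg ℚ.∣ x ∣ {{ℚ.nonNegative (ℚ.0≤∣p∣ x)}} b≤y ⟩
  ℚ.∣ x ∣ ℚ.* ℚ.∣ y ∣    ≡⟨ ℚ.∣p*q∣≡∣p∣*∣q∣ x y ⟨
  ℚ.∣ x ℚ.* y ∣          ∎
  where open ℚ.≤-Reasoning

0<* : ∀ {a b} → 0ℚ ℚ.< a → 0ℚ ℚ.< b → 0ℚ ℚ.< a ℚ.* b
0<* {a} {b} 0<a 0<b = ≡.subst (ℚ._< a ℚ.* b) (ℚ.*-zeroʳ a) (ℚ.*-monoʳ-<-pos a {{ℚ.positive 0<a}} 0<b)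

square-nonneg : ∀ x → x ℚ.* x ≡ ℚ.∣ x ℚ.* x ∣
square-nonneg x with ℚ.∣p∣≡p∨∣p∣≡-p x
... | inj₁ eq = ≡.trans (≡.cong₂ ℚ._*_ (≡.sym eq) (≡.sym eq)) (≡.sym (ℚ.∣p*q∣≡∣p∣*∣q∣ x x))
... | inj₂ eq = ≡.trans (solve 1 (λ x → x :* x := (:- x) :* (:- x)) ≡.refl x)
                 (≡.trans (≡.cong₂ ℚ._*_ (≡.sym eq) (≡.sym eq)) (≡.sym (ℚ.∣p*q∣≡∣p∣*∣q∣ x x)))
  where open ℚSolver

-- With tolerance ε², a term |x| ≥ ε would give ε² ≤ x² ≤ x² + y² < ε².
x²+y²≈0⇒x≈0 : ∀ {x y} → x *ᵣ x +ᵣ y *ᵣ y ≈ᵣ 0ᵣ → x ≈ᵣ 0ᵣ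
x²+y²≈0⇒x≈0 {x} {y} (mk≈ᵣ h) = mk≈ᵣ λ ε 0<ε →
  let N , h′ = h (ε ℚ.* ε) (0<* 0<ε 0<ε) in
  N , λ n n≥ → decidable-stable (_ ℚ.<? _) λ x≮ε →
    let a = seq x n
        b = seq y n
    in ℚ.<-irrefl ≡.refl (begin-strict
      ε ℚ.* ε                                       ≤⟨ *-mono-∣∣ {x = a} {a} (ℚ.<⇒≤ 0<ε) (ℚ.<⇒≤ 0<ε) (ε≤ {a} x≮ε) (ε≤ {a} x≮ε) ⟩
      ℚ.∣ a ℚ.* a ∣                                 ≡⟨ ℚ.+-identityʳ _ ⟨
      ℚ.∣ a ℚ.* a ∣ ℚ.+ 0ℚ                          ≤⟨ ℚ.+-monoʳ-≤ ℚ.∣ a ℚ.* a ∣ (ℚ.0≤∣p∣ (b ℚ.* b)) ⟩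
      ℚ.∣ a ℚ.* a ∣ ℚ.+ ℚ.∣ b ℚ.* b ∣               ≡⟨ ≡.cong₂ ℚ._+_ (≡.sym (square-nonneg a)) (≡.sym (square-nonneg b)) ⟩
      a ℚ.* a ℚ.+ b ℚ.* b                           ≡⟨ ℚ.+-identityʳ _ ⟨
      (a ℚ.* a ℚ.+ b ℚ.* b) ℚ.- 0ℚ                  ≤⟨ p≤∣p∣ _ ⟩
      ℚ.∣ (a ℚ.* a ℚ.+ b ℚ.* b) ℚ.- 0ℚ ∣            <⟨ h′ n n≥ ⟩
      ε ℚ.* ε                                       ∎)
  where
  open ℚ.≤-Reasoning
  ε≤ : ∀ {a ε} → ¬ ℚ.∣ a ℚ.- 0ℚ ∣ ℚ.< ε → ε ℚ.≤ ℚ.∣ a ∣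
  ε≤ {a} {ε} ≮ = ≡.subst (λ t → ε ℚ.≤ ℚ.∣ t ∣) (ℚ.+-identityʳ a) (ℚ.≮⇒≥ ≮)
  p≤∣p∣ : ∀ p → p ℚ.≤ ℚ.∣ p ∣
  p≤∣p∣ p with ℚ.∣p∣≡p∨∣p∣≡-p p | ℚ.≤-total 0ℚ p
  ... | inj₁ eq | _        = ℚ.≤-reflexive (≡.sym eq)
  ... | inj₂ _  | inj₁ 0≤p = ℚ.≤-reflexive (≡.sym (ℚ.0≤p⇒∣p∣≡p 0≤p))
  ... | inj₂ _  | inj₂ p≤0 = ℚ.≤-trans p≤0 (ℚ.0≤∣p∣ p)

∣_∣² : ℂ → ℝ
∣ z ∣² = re z *ᵣ re z +ᵣ im z *ᵣ im z

∣z∣²≈0⇒z≈0 : ∀ {z} → ∣ z ∣² ≈ᵣ 0ᵣ → z ≈ 0ℂ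
∣z∣²≈0⇒z≈0 h = mk≈ (x²+y²≈0⇒x≈0 h) (x²+y²≈0⇒x≈0 (≈ᵣ-trans (ℝ-ring.+-comm _ _) h))

∣zw∣² : ∀ z w → ∣ z * w ∣² ≈ᵣ ∣ z ∣² *ᵣ ∣ w ∣²
∣zw∣² z w = solve 4 (λ a b c d →
  (a :* c :+ :- (b :* d)) :* (a :* c :+ :- (b :* d)) :+ (a :* d :+ b :* c) :* (a :* d :+ b :* c)
  := (a :* a :+ b :* b) :* (c :* c :+ d :* d)) ℝ-ring.refl (re z) (im z) (re w) (im w)
  where open ℝ-solver

unimodular⇒z*conj≈1 : ∀ {z} → Unimodular z → z * conj z ≈ 1ℂ
unimodular⇒z*conj≈1 {z} h = mk≈
  (≈ᵣ-trans (solve 2 (λ a b → a :* a :+ :- (b :* :- b) := a :* a :+ b :* b) ℝ-ring.refl (re z) (im z)) h)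
  (solve 2 (λ a b → a :* :- b :+ b :* a := :0) ℝ-ring.refl (re z) (im z))
  where open ℝ-solver

module _ (em : ExcludedMiddle 0ℓ) where

  -- Classically, some ε is reached arbitrarily late. Beyond the Cauchy index for ε/2, one such term
  -- keeps all others at least ε/2 from 0.
  ≉0⇒away : ∀ {x} → ¬ x ≈ᵣ 0ᵣ → ∃ λ δ → 0ℚ ℚ.< δ × ∃ λ N → ∀ n → N ℕ.≤ n → δ ℚ.≤ ℚ.∣ seq x n ∣
  ≉0⇒away {x} x≉0 with em {∃ λ ε → 0ℚ ℚ.< ε × ¬ ∃ λ N → ∀ n → N ℕ.≤ n → ℚ.∣ seq x n ℚ.- 0ℚ ∣ ℚ.< ε}
  ... | no none = contradiction (mk≈ᵣ λ ε 0<ε → decidable-stable em λ h → none (ε , 0<ε , h)) x≉0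
  ... | yes (ε , 0<ε , far) with cauchy x (½ ℚ.* ε) (halve-pos 0<ε)
  ...   | N , h with em {∃ λ n → N ℕ.≤ n × ε ℚ.≤ ℚ.∣ seq x n ∣}
  ...     | no none = contradiction (N , λ n n≥ → ≡.subst (λ t → ℚ.∣ t ∣ ℚ.< ε) (≡.sym (ℚ.+-identityʳ _))
                        (decidable-stable (_ ℚ.<? _) λ ≮ → none (n , n≥ , ℚ.≮⇒≥ ≮))) far
  ...     | yes (n , n≥ , big) = ½ ℚ.* ε , halve-pos 0<ε , N , λ m m≥ → decidable-stable (_ ℚ.≤? _) λ ≰ →
              ℚ.<-irrefl ≡.refl (begin-strict
                ε                                               ≤⟨ big ⟩
                ℚ.∣ seq x n ∣                                   ≡⟨ ≡.cong ℚ.∣_∣ (solve 2 (λ a b → a := (a :- b) :+ b) ≡.refl (seq x n) (seq x m)) ⟩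
                ℚ.∣ (seq x n ℚ.- seq x m) ℚ.+ seq x m ∣         <⟨ ∣+∣<ε (h n m n≥ m≥) (ℚ.≰⇒> ≰) ⟩
                ε                                               ∎)
    where
    open ℚ.≤-Reasoning
    open ℚSolver

  ℝ-cancel : ∀ {x y} → x *ᵣ y ≈ᵣ 0ᵣ → ¬ x ≈ᵣ 0ᵣ → y ≈ᵣ 0ᵣ
  ℝ-cancel {x} {y} (mk≈ᵣ h) x≉0 with ≉0⇒away x≉0
  ... | δ , 0<δ , M , away = mk≈ᵣ λ ε 0<ε →
    let N , h′ = h (δ ℚ.* ε) (0<* 0<δ 0<ε) in
    M ℕ.⊔ N , λ n n≥ → decidable-stable (_ ℚ.<? _) λ y≮ε → ℚ.<-irrefl ≡.refl (begin-strict
      δ ℚ.* ε                               ≤⟨ *-mono-∣∣ {x = seq x n} {seq y n ℚ.- 0ℚ} (ℚ.<⇒≤ 0<δ) (ℚ.<⇒≤ 0<ε) (away n (ℕ.m⊔n≤o⇒m≤o M N n≥)) (ℚ.≮⇒≥ y≮ε) ⟩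
      ℚ.∣ seq x n ℚ.* (seq y n ℚ.- 0ℚ) ∣    ≡⟨ ≡.cong ℚ.∣_∣ (≡.cong (seq x n ℚ.*_) (ℚ.+-identityʳ (seq y n))) ⟩
      ℚ.∣ seq x n ℚ.* seq y n ∣             ≡⟨ ≡.cong ℚ.∣_∣ (ℚ.+-identityʳ (seq x n ℚ.* seq y n)) ⟨
      ℚ.∣ seq x n ℚ.* seq y n ℚ.- 0ℚ ∣      <⟨ h′ n (ℕ.m⊔n≤o⇒n≤o M N n≥) ⟩
      δ ℚ.* ε                               ∎)
    where open ℚ.≤-Reasoning

  -- Multiplicativity of |z|² reduces this to cancellation in ℝ.
  ℂ-cancel : ∀ {z w} → z * w ≈ 0ℂ → ¬ z ≈ 0ℂ → w ≈ 0ℂ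
  ℂ-cancel {z} {w} (mk≈ p q) z≉0 = ∣z∣²≈0⇒z≈0 (ℝ-cancel
    (≈ᵣ-trans (≈ᵣ-sym (∣zw∣² z w)) (≈ᵣ-trans (+ᵣ-cong (*ᵣ-cong p p) (*ᵣ-cong q q))
      (≈ᵣ-trans (+ᵣ-cong (ℝ-ring.zeroˡ 0ᵣ) (ℝ-ring.zeroˡ 0ᵣ)) (ℝ-ring.+-identityˡ 0ᵣ))))
    (λ h → z≉0 (∣z∣²≈0⇒z≈0 h)))

  ℂ-integralDomain : IntegralDomain
  ℂ-integralDomain = record { commutativeRing = ℂ-commutativeRing ; 1≉0 = 1ℂ≉0 ; cancel = ℂ-cancel }

-- Gain graphs as weightings, and the theorem

gainMatrix-Adj : ∀ {n} (Φ : GainGraph n) {i j} (e : Adj (graph Φ) i j) → gainMatrix Φ i j ≡ gain Φ e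
gainMatrix-Adj Φ {i} {j} e with adjacent (graph Φ) i j | gain Φ {i} {j} | e
... | true | g | _ = ≡.refl

gainMatrix-¬Adj : ∀ {n} (Φ : GainGraph n) {i j} → ¬ Adj (graph Φ) i j → gainMatrix Φ i j ≡ 0ℂ
gainMatrix-¬Adj Φ {i} {j} ¬e with adjacent (graph Φ) i j | gain Φ {i} {j}
... | true  | g = contradiction _ ¬e
... | false | g = ≡.refl

gainMatrix-induced : ∀ {n} (Φ : GainGraph n) S i j →
  gainMatrix (induced Φ S) i j ≡ gainMatrix Φ (elements S i) (elements S j)
gainMatrix-induced Φ S i j with T? (adjacent (graph Φ) (elements S i) (elements S j))
... | yes e = ≡.trans (gainMatrix-Adj (induced Φ S) {i} {j} e) (≡.sym (gainMatrix-Adj Φ e))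
... | no ¬e = ≡.trans (gainMatrix-¬Adj (induced Φ S) {i} {j} ¬e) (≡.sym (gainMatrix-¬Adj Φ ¬e))

module _ (em : ExcludedMiddle 0ℓ) {n : ℕ} (Φ : GainGraph n) where
  open Classical em

  private
    D : IntegralDomain
    D = ℂ-integralDomain em

    G : Graph n
    G = graph Φ

  gain-unit : OverDomain.UnitWeighting em D G (gainMatrix Φ)
  gain-unit = record
    { off  = λ ¬e → ℂ-ring.reflexive (gainMatrix-¬Adj Φ ¬e)
    ; unit = λ e → ℂ-ring.trans
        (ℂ-ring.*-cong (ℂ-ring.reflexive (gainMatrix-Adj Φ e))
          (ℂ-ring.trans (ℂ-ring.reflexive (gainMatrix-Adj Φ (adj-sym G e))) (gain-sym Φ e)))
        (unimodular⇒z*conj≈1 (unimodular Φ e)) }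

  rᵍ-induced : ∀ S → rᵍ (induced Φ S) ≡ rank (λ i j → gainMatrix Φ (elements S i) (elements S j))
  rᵍ-induced S = OverDomain.rank-cong em D λ i j → ℂ-ring.reflexive (gainMatrix-induced Φ S i j)

  module _ {q : ℕ} (C : PendantCycle G (3 ℕ.+ q)) where
    private
      p = 3 ℕ.+ q
      Conclusion : Set
      Conclusion = OverDomain.PendantRanks.Gain.Conclusion em D G C (gainMatrix Φ) gain-unit
      module Conclusion = OverDomain.PendantRanks.Gain.Conclusion

    cycleGain≈cycleProduct : cycleGain Φ (cycle C) ≈ OverDomain.PendantRanks.Gain.cycleProduct em D G C (gainMatrix Φ) gain-unit
    cycleGain≈cycleProduct = product-cong λ i → ℂ-ring.reflexive (≡.sym (gainMatrix-Adj Φ (PendantCycle.edge C i)))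
      where open Algebra.Properties.CommutativeMonoid.Sum ℂ-ring.*-commutativeMonoid using () renaming (sum-cong-≋ to product-cong)

    typeA : Conclusion → TypeA Φ (cycle C)
    typeA concl = divides half p≡half*2 , ℂ-ring.trans cycleGain≈cycleProduct (ℂ-ring.trans product≈
      (ℂ-ring.reflexive (≡.cong ((- 1ℂ) ^_) (≡.sym (≡.trans (≡.cong (_/ 2) p≡half*2) (m*n/n≡m half 2))))))
      where open Conclusion concl

    interpret : Conclusion →
      let Fᵠ = induced Φ (∁ (vertices C))
          F  = graph Fᵠ
          Hᵠ = induced Φ (∁ (vertices C) ∪ ⁅ attachment C ⁆)
          H  = graph Hᵠ
      in
      (TypeA Φ (cycle C) × p % 4 ≡ 2)
      × (+ rᵍ Hᵠ ≡ + r H ℤ.- + 2 ℤ.* θ H × + rᵍ Fᵠ ≡ + r F ℤ.- + 2 ℤ.* θ F)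
      × (+ rᵍ Φ ≡ + p ℤ.- + 2 ℤ.+ + rᵍ Fᵠ × rᵍ Fᵠ ≡ rᵍ Hᵠ × r G ≡ p ℕ.+ r H × r F ≡ r H)
    interpret concl =
      (typeA concl , p%4≡2)
      , (≡.trans (≡.cong +_ rHᵠ≡) (Equivalence.from (extremal-⇔ rHᵠ (r H) (edgeCount H) (card SH) (ω H)) extremal-H)
        , ≡.trans (≡.cong +_ rFᵠ≡) (Equivalence.from (extremal-⇔ rFᵠ (r F) (edgeCount F) (card SF) (ω F)) extremal-F))
      , (≡.trans rΦ≡ (≡.cong (λ x → + p ℤ.- + 2 ℤ.+ + x) (≡.sym rFᵠ≡))
        , ≡.trans rFᵠ≡ (≡.trans rFᵠ≡rHᵠ (≡.sym rHᵠ≡)) , rG≡p+rH , rF≡rH)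
      where
      open Conclusion concl
      SF SH : Subset n
      SF = ∁ (vertices C)
      SH = SF ∪ ⁅ attachment C ⁆
      F = inducedGraph G SF
      H = inducedGraph G SH
      rFᵠ rHᵠ : ℕ
      rFᵠ = rank (λ i j → gainMatrix Φ (elements SF i) (elements SF j))
      rHᵠ = rank (λ i j → gainMatrix Φ (elements SH i) (elements SH j))
      rFᵠ≡ : rᵍ (induced Φ SF) ≡ rFᵠ
      rFᵠ≡ = rᵍ-induced SF
      rHᵠ≡ : rᵍ (induced Φ SH) ≡ rHᵠ
      rHᵠ≡ = rᵍ-induced SH

theorem4p4 : (em : ExcludedMiddle 0ℓ) → let open Classical em in
    ∀ {n p : ℕ} (Φ : GainGraph n) (C : PendantCycle (graph Φ) p) →
    let G  = graph Φ
        Fᵠ = induced Φ (∁ (vertices C))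
        F  = graph Fᵠ
        Hᵠ = induced Φ (∁ (vertices C) ∪ ⁅ attachment C ⁆)
        H  = graph Hᵠ
    in
    + rᵍ Φ ≡ + r G ℤ.- + 2 ℤ.* θ G →
    (TypeA Φ (cycle C) × p % 4 ≡ 2)
    × (+ rᵍ Hᵠ ≡ + r H ℤ.- + 2 ℤ.* θ H × + rᵍ Fᵠ ≡ + r F ℤ.- + 2 ℤ.* θ F)
    × (+ rᵍ Φ ≡ + p ℤ.- + 2 ℤ.+ + rᵍ Fᵠ × rᵍ Fᵠ ≡ rᵍ Hᵠ × r G ≡ p ℕ.+ r H × r F ≡ r H)
theorem4p4 em {p = 0} Φ C = contradiction (PendantCycle.p≥3 C) λ ()
theorem4p4 em {p = 1} Φ C = contradiction (PendantCycle.p≥3 C) λ { (s≤s ()) }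
theorem4p4 em {p = 2} Φ C = contradiction (PendantCycle.p≥3 C) λ { (s≤s (s≤s ())) }
theorem4p4 em {n} {suc (suc (suc q))} Φ C extremal = interpret em Φ C
  (OverDomain.PendantRanks.Gain.conclusion em (ℂ-integralDomain em) (graph Φ) C (gainMatrix Φ) (gain-unit em Φ)
    (Equivalence.to (extremal-⇔ (rᵍ Φ) (r (graph Φ)) (edgeCount (graph Φ)) n (ω (graph Φ))) extremal))
  where open Classical em
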